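{- The following two statements are equivalent. (A) For each permutation $\pi$, the polynomial $\sum_{\sigma\in s^{ -1}(\pi)}x^{\mathrm{des}(\sigma)+1}$ has only real roots (and is, therefore, log-concave). (B) For each $k\geq 0$ and each integral binary nestohedron $P\subseteq\mathbb R^{k+1}$, the polynomial $\sum_{\mathbf q\in P\cap\mathbb Z^{k+1}}N_{\mathbf q}(x)$ has only real roots (and is, therefore, log-concave).
   Context: A permutation is an ordering, written in one-line notation, of a finite set of positive integers. West's stack-sorting map $s$ sends the empty permutation to itself, and if $\pi=LmR$ is a nonempty permutation with largest entry $m$, then $s(\pi)=s(L)\,s(R)\,m$. $\mathrm{des}(\sigma)$ is the number of indices $i$ with $\sigma_i>\sigma_{i+1}$. The zero polynomial (which arises in (A) when $s^{ -1}(\pi)=\emptyset$) is regarded as having only real roots. The Narayana polynomials are $N_n(x)=\sum_{i=1}^n\frac1n\binom ni\binom n{i-1}x^i$ for $n\ge 1$; for $\mathbf q=(q_0,\ldots,q_k)\in\mathbb Z_{>0}^{k+1}$, $N_{\mathbf q}(x)=\prod_{i=0}^kN_{q_i}(x)$. A binary building set on $[k+1]=\{1,\ldots,k+1\}$ is a collection $\mathcal B$ of nonempty subsets of $[k+1]$ such that every set in $\mathcal B$ is an interval $\{i,i+1,\ldots,j\}$, every singleton subset of $[k+1]$ is in $\mathcal B$, and any two non-disjoint $I,J\in\mathcal B$ satisfy $I\subseteq J$ or $J\subseteq I$. For $I\subseteq[k+1]$ let $\Delta_I=\mathrm{conv}(\{e_i:i\in I\})\subseteq\mathbb R^{k+1}$,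 with $e_1,\ldots,e_{k+1}$ the standard basis. A binary nestohedron in $\mathbb R^{k+1}$ is a Minkowski sum $\sum_{I\in\mathcal B}y_I\Delta_I$, where $\mathcal B$ is a binary building set on $[k+1]$ and every $y_I$ is a positive real number. It is integral if all its vertices are in $\mathbb Z^{k+1}$ (all lattice points of an integral binary nestohedron then have positive coordinates). -}

module Defs where

open import Data.Bool using (if_then_else_)
open import Data.Fin using (Fin) renaming (_≤_ to _≤ᶠ_)
open import Data.Fin.Properties using () renaming (_≟_ to _≟ᶠ_)
open import Data.Fin.Subset using (Subset; ⁅_⁆; _∩_; Nonempty)
  renaming (_∈_ to _∈ˢ_; _⊆_ to _⊆ˢ_)
open import Data.Integer using (ℤ; +_; ∣_∣)
open import Data.List
  using (List; []; _∷_; _++_; [_]; break; drop; foldr; length; map; replicate; upTo)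
import Data.List.Extrema.Nat as Extrema
open import Data.List.Membership.Propositional using (_∈_)
import Data.List.Membership.Propositional.Properties as ∈
open import Data.List.Properties using (length-++)
open import Data.List.Relation.Unary.All as All using (All; []; _∷_)
import Data.List.Relation.Unary.All.Properties as All
open import Data.List.Relation.Unary.Unique.Propositional using (Unique)
open import Data.Nat as ℕ using (ℕ; zero; suc; _⊔_; z≤n)
open import Data.Nat.Combinatorics using (_C_)
import Data.Nat.Properties as ℕ
open import Data.Product using (Σ-syntax; ∃-syntax; _×_; _,_; proj₁; proj₂)
open import Data.Rational as ℚ using (ℚ; 0ℚ; 1ℚ; ½)
import Data.Rational.Properties as ℚ
open import Data.Rational.Solver using (module +-*-Solver)
open import Data.Sum using (_⊎_; inj₁; inj₂)
open import Data.Vec as Vec using (Vec)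
open import Data.Vec.Functional using (Vector) renaming (foldr to foldrᵛ)
open import Function using (_∘_)
open import Function.Bundles using (_⇔_)
open import Relation.Binary.PropositionalEquality
  using (_≡_; refl; sym; trans; cong; cong₂; subst; module ≡-Reasoning)
open import Relation.Nullary using (does; yes; no; contradiction)
open import Relation.Nullary.Decidable using (dec-true; dec-false)

------------------------------------------------------------------------
-- Real numbers: Cauchy sequences of rationals, with _≈_ as equality

infix  4 _≈_ _≤_ _<_
infixl 6 _+_ _-_
infixl 7 _*_

record ℝ : Set where
  constructor mkℝ
  field
    seq    : ℕ → ℚ
    cauchy : ∀ ε → 0ℚ ℚ.< ε →
             ∃[ N ] (∀ m n → N ℕ.≤ m → N ℕ.≤ n → ℚ.∣ seq m ℚ.- seq n ∣ ℚ.< ε)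

open ℝ public

_≈_ _≤_ _<_ : ℝ → ℝ → Set
x ≈ y = ∀ ε → 0ℚ ℚ.< ε → ∃[ N ] (∀ n → N ℕ.≤ n → ℚ.∣ seq x n ℚ.- seq y n ∣ ℚ.< ε)
x ≤ y = ∀ ε → 0ℚ ℚ.< ε → ∃[ N ] (∀ n → N ℕ.≤ n → seq x n ℚ.< seq y n ℚ.+ ε)
x < y = ∃[ ε ] (0ℚ ℚ.< ε × ∃[ N ] (∀ n → N ℕ.≤ n → seq x n ℚ.+ ε ℚ.< seq y n))

fromℚ : ℚ → ℝ
fromℚ q = mkℝ (λ _ → q) λ ε 0<ε →
  0 , λ _ _ _ _ → subst (ℚ._< ε) (sym (cong ℚ.∣_∣ (ℚ.+-inverseʳ q))) 0<ε

fromℤ : ℤ → ℝ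
fromℤ i = fromℚ (i ℚ./ 1)

0ℝ 1ℝ : ℝ
0ℝ = fromℚ 0ℚ
1ℝ = fromℚ 1ℚ

-_ : ℝ → ℝ
- x = mkℝ (λ n → ℚ.- seq x n) λ ε 0<ε →
  let N , p = cauchy x ε 0<ε
  in  N , λ m n N≤m N≤n → subst (ℚ._< ε) (sym (lemma (seq x m) (seq x n))) (p m n N≤m N≤n)
  where
  open +-*-Solver
  lemma : ∀ a b → ℚ.∣ (ℚ.- a) ℚ.- (ℚ.- b) ∣ ≡ ℚ.∣ a ℚ.- b ∣
  lemma a b = trans
    (cong ℚ.∣_∣ (solve 2 (λ a b → (:- a) :- (:- b) := :- (a :- b)) refl a b))
    (ℚ.∣-p∣≡∣p∣ (a ℚ.- b))

_+_ : ℝ → ℝ → ℝ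
x + y = mkℝ (λ n → seq x n ℚ.+ seq y n) λ ε 0<ε →
  let 0<δ    = subst (ℚ._< ½ ℚ.* ε) (ℚ.*-zeroʳ ½) (ℚ.*-monoʳ-<-pos ½ 0<ε)
      M , p  = cauchy x (½ ℚ.* ε) 0<δ
      N , q  = cauchy y (½ ℚ.* ε) 0<δ
  in  M ⊔ N , λ m n l l′ →
        lemma ε (seq x m) (seq x n) (seq y m) (seq y n)
          (p m n (ℕ.m⊔n≤o⇒m≤o M N l) (ℕ.m⊔n≤o⇒m≤o M N l′))
          (q m n (ℕ.m⊔n≤o⇒n≤o M N l) (ℕ.m⊔n≤o⇒n≤o M N l′))
  where
  open +-*-Solver
  open ℚ.≤-Reasoning
  lemma : ∀ ε a a′ b b′ → ℚ.∣ a ℚ.- a′ ∣ ℚ.< ½ ℚ.* ε → ℚ.∣ b ℚ.- b′ ∣ ℚ.< ½ ℚ.* ε →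
          ℚ.∣ (a ℚ.+ b) ℚ.- (a′ ℚ.+ b′) ∣ ℚ.< ε
  lemma ε a a′ b b′ p q = begin-strict
    ℚ.∣ (a ℚ.+ b) ℚ.- (a′ ℚ.+ b′) ∣
      ≡⟨ cong ℚ.∣_∣ (solve 4 (λ a a′ b b′ →
           (a :+ b) :- (a′ :+ b′) := (a :- a′) :+ (b :- b′)) refl a a′ b b′) ⟩
    ℚ.∣ (a ℚ.- a′) ℚ.+ (b ℚ.- b′) ∣     ≤⟨ ℚ.∣p+q∣≤∣p∣+∣q∣ (a ℚ.- a′) (b ℚ.- b′) ⟩
    ℚ.∣ a ℚ.- a′ ∣ ℚ.+ ℚ.∣ b ℚ.- b′ ∣   <⟨ ℚ.+-mono-< p q ⟩
    ½ ℚ.* ε ℚ.+ ½ ℚ.* ε                 ≡⟨ solve 1 (λ ε → con ½ :* ε :+ con ½ :* ε := ε) refl ε ⟩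
    ε                                   ∎

_-_ : ℝ → ℝ → ℝ
x - y = x + (- y)

private
  bounded : ∀ x → ∃[ B ] (ℚ.Positive B × ∃[ N ] (∀ n → N ℕ.≤ n → ℚ.∣ seq x n ∣ ℚ.≤ B))
  bounded x with cauchy x 1ℚ (ℚ.positive⁻¹ 1ℚ)
  ... | N , p = B , ℚ.nonNeg+pos⇒pos ℚ.∣ seq x N ∣ {{ℚ.nonNegative (ℚ.0≤∣p∣ (seq x N))}} 1ℚ , N , bound
    where
    open +-*-Solver
    open ℚ.≤-Reasoning
    B = ℚ.∣ seq x N ∣ ℚ.+ 1ℚ
    bound : ∀ n → N ℕ.≤ n → ℚ.∣ seq x n ∣ ℚ.≤ B
    bound n N≤n = begin
      ℚ.∣ seq x n ∣
        ≡⟨ cong ℚ.∣_∣ (solve 2 (λ a b → a := b :+ (a :- b)) refl (seq x n) (seq x N)) ⟩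
      ℚ.∣ seq x N ℚ.+ (seq x n ℚ.- seq x N) ∣       ≤⟨ ℚ.∣p+q∣≤∣p∣+∣q∣ (seq x N) _ ⟩
      ℚ.∣ seq x N ∣ ℚ.+ ℚ.∣ seq x n ℚ.- seq x N ∣
        ≤⟨ ℚ.+-monoʳ-≤ ℚ.∣ seq x N ∣ (ℚ.<⇒≤ (p n N N≤n ℕ.≤-refl)) ⟩
      B                                             ∎

_*_ : ℝ → ℝ → ℝ
x * y = mkℝ (λ n → seq x n ℚ.* seq y n) λ ε 0<ε →
  let A , A>0 , M₁ , p₁ = bounded x
      B , B>0 , M₂ , p₂ = bounded y
      K>0     = ℚ.pos+pos⇒pos A {{A>0}} B {{B>0}}
      K≢0     = ℚ.pos⇒nonZero (A ℚ.+ B) {{K>0}}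
      1/K     = (ℚ.1/ (A ℚ.+ B)) {{K≢0}}
      δ       = 1/K ℚ.* ε
      0<δ     = subst (ℚ._< δ) (ℚ.*-zeroʳ 1/K)
                  (ℚ.*-monoʳ-<-pos 1/K {{ℚ.1/pos⇒pos (A ℚ.+ B) {{K>0}}}} 0<ε)
      Kδ≡ε    = trans (sym (ℚ.*-assoc (A ℚ.+ B) 1/K ε))
                  (trans (cong (ℚ._* ε) (ℚ.*-inverseʳ (A ℚ.+ B) {{K≢0}})) (ℚ.*-identityˡ ε))
      N₁ , q₁ = cauchy x δ 0<δ
      N₂ , q₂ = cauchy y δ 0<δ
      M       = M₁ ⊔ M₂
      N       = N₁ ⊔ N₂
  in  M ⊔ N , λ m n l l′ →
        let M≤m = ℕ.m⊔n≤o⇒m≤o M N l ; N≤m = ℕ.m⊔n≤o⇒n≤o M N l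
            M≤n = ℕ.m⊔n≤o⇒m≤o M N l′ ; N≤n = ℕ.m⊔n≤o⇒n≤o M N l′
        in  subst (_ ℚ.<_) Kδ≡ε
              (lemma A B δ {{A>0}} {{B>0}} (seq x m) (seq x n) (seq y m) (seq y n)
                (p₁ m (ℕ.m⊔n≤o⇒m≤o M₁ M₂ M≤m)) (p₂ n (ℕ.m⊔n≤o⇒n≤o M₁ M₂ M≤n))
                (q₁ m n (ℕ.m⊔n≤o⇒m≤o N₁ N₂ N≤m) (ℕ.m⊔n≤o⇒m≤o N₁ N₂ N≤n))
                (q₂ m n (ℕ.m⊔n≤o⇒n≤o N₁ N₂ N≤m) (ℕ.m⊔n≤o⇒n≤o N₁ N₂ N≤n)))
  where
  open +-*-Solver
  open ℚ.≤-Reasoning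
  lemma : ∀ A B δ {{_ : ℚ.Positive A}} {{_ : ℚ.Positive B}} a a′ b b′ →
          ℚ.∣ a ∣ ℚ.≤ A → ℚ.∣ b′ ∣ ℚ.≤ B →
          ℚ.∣ a ℚ.- a′ ∣ ℚ.< δ → ℚ.∣ b ℚ.- b′ ∣ ℚ.< δ →
          ℚ.∣ a ℚ.* b ℚ.- a′ ℚ.* b′ ∣ ℚ.< (A ℚ.+ B) ℚ.* δ
  lemma A B δ a a′ b b′ a≤A b′≤B p q = begin-strict
    ℚ.∣ a ℚ.* b ℚ.- a′ ℚ.* b′ ∣
      ≡⟨ cong ℚ.∣_∣ (solve 4 (λ a a′ b b′ →
           a :* b :- a′ :* b′ := a :* (b :- b′) :+ b′ :* (a :- a′)) refl a a′ b b′) ⟩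
    ℚ.∣ a ℚ.* (b ℚ.- b′) ℚ.+ b′ ℚ.* (a ℚ.- a′) ∣
      ≤⟨ ℚ.∣p+q∣≤∣p∣+∣q∣ (a ℚ.* (b ℚ.- b′)) (b′ ℚ.* (a ℚ.- a′)) ⟩
    ℚ.∣ a ℚ.* (b ℚ.- b′) ∣ ℚ.+ ℚ.∣ b′ ℚ.* (a ℚ.- a′) ∣
      ≡⟨ cong₂ ℚ._+_ (ℚ.∣p*q∣≡∣p∣*∣q∣ a (b ℚ.- b′)) (ℚ.∣p*q∣≡∣p∣*∣q∣ b′ (a ℚ.- a′)) ⟩
    ℚ.∣ a ∣ ℚ.* ℚ.∣ b ℚ.- b′ ∣ ℚ.+ ℚ.∣ b′ ∣ ℚ.* ℚ.∣ a ℚ.- a′ ∣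
      ≤⟨ ℚ.+-mono-≤
           (ℚ.*-monoʳ-≤-nonNeg ℚ.∣ b ℚ.- b′ ∣ {{ℚ.nonNegative (ℚ.0≤∣p∣ (b ℚ.- b′))}} a≤A)
           (ℚ.*-monoʳ-≤-nonNeg ℚ.∣ a ℚ.- a′ ∣ {{ℚ.nonNegative (ℚ.0≤∣p∣ (a ℚ.- a′))}} b′≤B) ⟩
    A ℚ.* ℚ.∣ b ℚ.- b′ ∣ ℚ.+ B ℚ.* ℚ.∣ a ℚ.- a′ ∣
      <⟨ ℚ.+-mono-< (ℚ.*-monoʳ-<-pos A q) (ℚ.*-monoʳ-<-pos B p) ⟩
    A ℚ.* δ ℚ.+ B ℚ.* δ
      ≡⟨ solve 3 (λ A B δ → A :* δ :+ B :* δ := (A :+ B) :* δ) refl A B δ ⟩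
    (A ℚ.+ B) ℚ.* δ ∎

∑ᵛ : ∀ {n} → Vector ℝ n → ℝ
∑ᵛ = foldrᵛ _+_ 0ℝ

------------------------------------------------------------------------
-- Complex numbers

infixl 6 _+ᶜ_
infixl 7 _*ᶜ_
infix  4 _≈ᶜ_

record ℂ : Set where
  constructor _+i_
  field
    re im : ℝ

open ℂ public

_≈ᶜ_ : ℂ → ℂ → Set
z ≈ᶜ w = re z ≈ re w × im z ≈ im w

_+ᶜ_ _*ᶜ_ : ℂ → ℂ → ℂ
z +ᶜ w = (re z + re w) +i (im z + im w)
z *ᶜ w = (re z * re w - im z * im w) +i (re z * im w + im z * re w)

fromℝ : ℝ → ℂ
fromℝ x = x +i 0ℝ

0ᶜ : ℂ
0ᶜ = fromℝ 0ℝ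

------------------------------------------------------------------------
-- Polynomials with rational coefficients, constant term first; trailing
-- zeros are allowed, so zero is any list all of whose entries are 0

Poly : Set
Poly = List ℚ

IsZero : Poly → Set
IsZero = All (_≡ 0ℚ)

infixl 6 _⊕_
infixl 7 _⊗_

_⊕_ : Poly → Poly → Poly
[]      ⊕ q       = q
p       ⊕ []      = p
(a ∷ p) ⊕ (b ∷ q) = (a ℚ.+ b) ∷ (p ⊕ q)

_⊗_ : Poly → Poly → Poly
[]      ⊗ q = []
(a ∷ p) ⊗ q = map (a ℚ.*_) q ⊕ (0ℚ ∷ (p ⊗ q))

monomial : ℚ → ℕ → Poly
monomial c i = replicate i 0ℚ ++ [ c ]

∑ : ∀ {A : Set} → List A → (A → Poly) → Poly
∑ xs f = foldr _⊕_ [] (map f xs)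

eval : Poly → ℂ → ℂ
eval []      z = 0ᶜ
eval (a ∷ p) z = fromℝ (fromℚ a) +ᶜ z *ᶜ eval p z

OnlyRealRoots : Poly → Set
OnlyRealRoots p = IsZero p ⊎ (∀ z → eval p z ≈ᶜ 0ᶜ → im z ≈ 0ℝ)

------------------------------------------------------------------------
-- Enumerations of finite sets

-- The sum of f over a finite set {a | P a} is ∑ xs f for any xs Enumerates P.
infix 4 _Enumerates_

_Enumerates_ : ∀ {A : Set} → List A → (A → Set) → Set
xs Enumerates P = Unique xs × (∀ a → (a ∈ xs) ⇔ P a)

------------------------------------------------------------------------
-- Stack-sorting

IsPermutation : List ℕ → Set
IsPermutation π = All (0 ℕ.<_) π × Unique π

-- The first argument bounds the recursion depth; the length of the
-- list always suffices, so stackSort satisfies s(LmR) = s(L) s(R) m; see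
-- stackSort-split.
stackSortUpTo : ℕ → List ℕ → List ℕ
stackSortUpTo zero    π       = []
stackSortUpTo (suc d) []      = []
stackSortUpTo (suc d) π@(_ ∷ _) =
  let m   = Extrema.max 0 π
      LmR = break (ℕ._≟ m) π
  in  stackSortUpTo d (proj₁ LmR) ++ stackSortUpTo d (drop 1 (proj₂ LmR)) ++ [ m ]

stackSort : List ℕ → List ℕ
stackSort π = stackSortUpTo (length π) π

private
  max-split : ∀ L {m R} → All (ℕ._< m) L → All (ℕ._≤ m) R → Extrema.max 0 (L ++ m ∷ R) ≡ m
  max-split L {m} L<m R≤m = Extrema.max≈v⁺ (∈.∈-insert L)
    (All.++⁺ (All.map ℕ.<⇒≤ L<m) (ℕ.≤-refl ∷ R≤m)) z≤n

  break-split : ∀ L {m} R → All (ℕ._< m) L → break (ℕ._≟ m) (L ++ m ∷ R) ≡ (L , m ∷ R)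
  break-split []      {m} R []
    rewrite dec-true (m ℕ.≟ m) refl = refl
  break-split (x ∷ L) {m} R (x<m ∷ L<m)
    rewrite dec-false (x ℕ.≟ m) (ℕ.<⇒≢ x<m) | break-split L R L<m = refl

  step : ℕ → List ℕ → ℕ → List ℕ
  step d π m = let LmR = break (ℕ._≟ m) π in
    stackSortUpTo d (proj₁ LmR) ++ stackSortUpTo d (drop 1 (proj₂ LmR)) ++ [ m ]

  upTo-split : ∀ d L {m} R → All (ℕ._< m) L → All (ℕ._≤ m) R →
               stackSortUpTo (suc d) (L ++ m ∷ R) ≡
               stackSortUpTo d L ++ stackSortUpTo d R ++ [ m ]
  upTo-split d L {m} R L<m R≤m = begin
    stackSortUpTo (suc d) (L ++ m ∷ R)                ≡⟨ nonempty L ⟩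
    step d (L ++ m ∷ R) (Extrema.max 0 (L ++ m ∷ R))
      ≡⟨ cong (step d (L ++ m ∷ R)) (max-split L L<m R≤m) ⟩
    step d (L ++ m ∷ R) m
      ≡⟨ cong (λ (l , r) → stackSortUpTo d l ++ stackSortUpTo d (drop 1 r) ++ [ m ])
              (break-split L R L<m) ⟩
    stackSortUpTo d L ++ stackSortUpTo d R ++ [ m ]   ∎
    where
    open ≡-Reasoning
    nonempty : ∀ L → stackSortUpTo (suc d) (L ++ m ∷ R) ≡
                     step d (L ++ m ∷ R) (Extrema.max 0 (L ++ m ∷ R))
    nonempty []      = refl
    nonempty (_ ∷ _) = refl

  data MaxView : List ℕ → Set where
    []   : MaxView []
    node : ∀ L m R → All (ℕ._< m) L → All (ℕ._≤ m) R → MaxView (L ++ m ∷ R)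

  maxView : ∀ π → MaxView π
  maxView []      = []
  maxView (x ∷ π) with maxView π
  ... | []                 = node [] x [] [] []
  ... | node L m R L<m R≤m with x ℕ.<? m
  ...   | yes x<m = node (x ∷ L) m R (x<m ∷ L<m) R≤m
  ...   | no  x≮m = node [] x (L ++ m ∷ R) []
      (All.++⁺ (All.map (λ y<m → ℕ.≤-trans (ℕ.<⇒≤ y<m) m≤x) L<m)
               (m≤x ∷ All.map (λ y≤m → ℕ.≤-trans y≤m m≤x) R≤m))
    where m≤x = ℕ.≮⇒≥ x≮m

  length-left : ∀ L {m : ℕ} R {d} → length (L ++ m ∷ R) ℕ.≤ suc d → length L ℕ.≤ d
  length-left L {m} R l rewrite length-++ L {m ∷ R} | ℕ.+-suc (length L) (length R) =
    ℕ.≤-trans (ℕ.m≤m+n (length L) (length R)) (ℕ.s≤s⁻¹ l)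

  length-right : ∀ L {m : ℕ} R {d} → length (L ++ m ∷ R) ℕ.≤ suc d → length R ℕ.≤ d
  length-right L {m} R l rewrite length-++ L {m ∷ R} | ℕ.+-suc (length L) (length R) =
    ℕ.≤-trans (ℕ.m≤n+m (length R) (length L)) (ℕ.s≤s⁻¹ l)

  upTo-nil : ∀ d → stackSortUpTo d [] ≡ []
  upTo-nil zero    = refl
  upTo-nil (suc d) = refl

  upTo-enough : ∀ d e π → length π ℕ.≤ d → length π ℕ.≤ e → stackSortUpTo d π ≡ stackSortUpTo e π
  upTo-enough d e π l l′ with maxView π
  upTo-enough d       e       _ l l′ | [] = trans (upTo-nil d) (sym (upTo-nil e))
  upTo-enough zero    _       _ l l′ | node []      m R _ _ = contradiction l λ ()
  upTo-enough zero    _       _ l l′ | node (_ ∷ _) m R _ _ = contradiction l λ ()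
  upTo-enough (suc _) zero    _ l l′ | node []      m R _ _ = contradiction l′ λ ()
  upTo-enough (suc _) zero    _ l l′ | node (_ ∷ _) m R _ _ = contradiction l′ λ ()
  upTo-enough (suc d) (suc e) _ l l′ | node L m R L<m R≤m
    rewrite upTo-split d L R L<m R≤m | upTo-split e L R L<m R≤m =
    cong₂ (λ σ τ → σ ++ τ ++ [ m ])
      (upTo-enough d e L (length-left L R l) (length-left L R l′))
      (upTo-enough d e R (length-right L R l) (length-right L R l′))

stackSort-split : ∀ L {m} R → All (ℕ._< m) L → All (ℕ._< m) R →
                  stackSort (L ++ m ∷ R) ≡ stackSort L ++ stackSort R ++ [ m ]
stackSort-split L {m} R L<m R<m
  rewrite length-++ L {m ∷ R} | ℕ.+-suc (length L) (length R)
        | upTo-split (length L ℕ.+ length R) L R L<m (All.map ℕ.<⇒≤ R<m) =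
  cong₂ (λ σ τ → σ ++ τ ++ [ m ])
    (upTo-enough _ _ L (ℕ.m≤m+n (length L) (length R)) ℕ.≤-refl)
    (upTo-enough _ _ R (ℕ.m≤n+m (length R) (length L)) ℕ.≤-refl)

des : List ℕ → ℕ
des []          = 0
des (x ∷ [])    = 0
des (x ∷ y ∷ σ) = if does (y ℕ.<? x) then suc (des (y ∷ σ)) else des (y ∷ σ)

------------------------------------------------------------------------
-- Narayana polynomials

narayana : ℕ → Poly
narayana zero      = []
narayana n@(suc _) =
  ∑ (map suc (upTo n)) λ i → monomial ((+ 1 ℚ./ n) ℚ.* fromℕ (n C i) ℚ.* fromℕ (n C (i ℕ.∸ 1))) i
  where
  fromℕ : ℕ → ℚ
  fromℕ k = + k ℚ./ 1

-- Meant for vectors of positive integers, such as the lattice points of an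
-- integral binary nestohedron; there ∣_∣ is the coercion to ℕ.
narayanaᵛ : ∀ {n} → Vec ℤ n → Poly
narayanaᵛ = Vec.foldr′ _⊗_ [ 1ℚ ] ∘ Vec.map (λ q → narayana ∣ q ∣)

------------------------------------------------------------------------
-- Convex geometry in ℝⁿ

Point : ℕ → Set
Point n = Vector ℝ n

PointSet : ℕ → Set₁
PointSet n = Point n → Set

infix  4 _≈ᵖ_
infixl 6 _+ᵖ_ _⊞_
infixr 7 _·ᵖ_ _·ˢ_
infix  7 _∙_

_≈ᵖ_ : ∀ {n} → Point n → Point n → Set
u ≈ᵖ v = ∀ i → u i ≈ v i

0ᵖ : ∀ {n} → Point n
0ᵖ _ = 0ℝ

_+ᵖ_ : ∀ {n} → Point n → Point n → Point n
(u +ᵖ v) i = u i + v i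

_·ᵖ_ : ∀ {n} → ℝ → Point n → Point n
(r ·ᵖ v) i = r * v i

∑ᵖ : ∀ {m n} → Vector (Point n) m → Point n
∑ᵖ = foldrᵛ _+ᵖ_ 0ᵖ

_∙_ : ∀ {n} → Point n → Point n → ℝ
u ∙ v = ∑ᵛ (λ i → u i * v i)

basis : ∀ {n} → Fin n → Point n
basis i j = if does (i ≟ᶠ j) then 1ℝ else 0ℝ

conv : ∀ {n} → PointSet n → PointSet n
conv S x = ∃[ m ] Σ[ c ∈ Vector ℝ m ] Σ[ p ∈ Vector (Point _) m ]
  (∀ j → 0ℝ ≤ c j) × ∑ᵛ c ≈ 1ℝ × (∀ j → S (p j)) × x ≈ᵖ ∑ᵖ (λ j → c j ·ᵖ p j)

_·ˢ_ : ∀ {n} → ℝ → PointSet n → PointSet n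
(r ·ˢ S) x = ∃[ s ] (S s × x ≈ᵖ r ·ᵖ s)

_⊞_ : ∀ {n} → PointSet n → PointSet n → PointSet n
(S ⊞ T) x = ∃[ s ] ∃[ t ] (S s × T t × x ≈ᵖ s +ᵖ t)

Δ : ∀ {n} → Subset n → PointSet n
Δ I = conv (λ v → ∃[ i ] (i ∈ˢ I × v ≈ᵖ basis i))

-- A vertex is a zero-dimensional face: the unique point at which some
-- linear functional attains its maximum.
IsVertex : ∀ {n} → PointSet n → PointSet n
IsVertex P v = P v × ∃[ c ] (∀ x → P x → (c ∙ x ≤ c ∙ v) × (c ∙ x ≈ c ∙ v → x ≈ᵖ v))

fromℤᵖ : ∀ {n} → Vec ℤ n → Point n
fromℤᵖ q i = fromℤ (Vec.lookup q i)

IsIntegral : ∀ {n} → PointSet n → Set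
IsIntegral P = ∀ v → IsVertex P v → ∃[ q ] (v ≈ᵖ fromℤᵖ q)

LatticePoint : ∀ {n} → PointSet n → Vec ℤ n → Set
LatticePoint P q = P (fromℤᵖ q)

------------------------------------------------------------------------
-- Binary nestohedra

IsInterval : ∀ {n} → Subset n → Set
IsInterval {n} I = Σ[ i ∈ Fin n ] Σ[ j ∈ Fin n ] (∀ x → (x ∈ˢ I) ⇔ (i ≤ᶠ x × x ≤ᶠ j))

record IsBinaryBuildingSet {n} (ℬ : List (Subset n)) : Set where
  field
    unique     : Unique ℬ
    nonempty   : ∀ {I} → I ∈ ℬ → Nonempty I
    intervals  : ∀ {I} → I ∈ ℬ → IsInterval I
    singletons : ∀ i → ⁅ i ⁆ ∈ ℬ
    laminar    : ∀ {I J} → I ∈ ℬ → J ∈ ℬ → Nonempty (I ∩ J) → (I ⊆ˢ J) ⊎ (J ⊆ˢ I)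

-- Only the values of y on members of ℬ matter.
record BinaryNestohedron (n : ℕ) : Set where
  field
    ℬ           : List (Subset n)
    buildingSet : IsBinaryBuildingSet ℬ
    y           : Subset n → ℝ
    y-positive  : ∀ {I} → I ∈ ℬ → 0ℝ < y I

⟦_⟧ : ∀ {n} → BinaryNestohedron n → PointSet n
⟦ P ⟧ = foldr _⊞_ (λ x → x ≈ᵖ 0ᵖ) (map (λ I → y I ·ˢ Δ I) ℬ)
  where open BinaryNestohedron P

{-# OPTIONS --safe #-}

-- For a permutation π let F(π) = Σ x^(des σ + 1) over σ ∈ s⁻¹(π). Cutting σ
-- at its maximum gives F(π n) = Σ F(α) F(β) over the factorisations π = α β,
-- where F of the empty word is x on the left and 1 on the right. For
-- increasing permutations this says that the generating function
-- u = Σ F(1 2 … n) zⁿ satisfies u = z (x + u) (1 + u), so Lagrange inversion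
-- identifies F(1 2 … n) with N_n. Otherwise π consists of a word α ending in
-- its maximum M, a nonempty word β with entries below M, and t increasing
-- maxima of π; then F(π) = Σ F(α with i maxima appended) F(β with j maxima
-- appended) over i + j = t − 1. Iterating, F(π) is a sum of products N_q, with
-- q running over the ways to distribute the weights at the nodes of a binary
-- tree among the leaves below them. These q are the lattice points of a binary
-- nestohedron whose building set consists of the nodes of positive weight: a
-- point lies in it as soon as the coordinate sum over each subtree is at least
-- the weight of the subtree, with equality for the whole tree. Every tree
-- arises from a permutation, and every binary building set refines to a tree.
-- The weights y_I of an integral binary nestohedron are integers, by induction
-- on ∣ I ∣: the vertex maximising a functional with the values on I smallest
-- has a coordinate that is the sum of y_I and weights of proper subsets of I.
module Submission where

open import Algebra.Bundles using (CommutativeRing; CommutativeSemiring)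
open import Level using (0ℓ)

-- Both sides meet in power series. For a fixed word, F with `a` increasing maxima appended is a
-- sequence in `a`: a series in z with coefficients in x. It depends on the number of those maxima
-- and not on their values, so the sum over i + j = t - 1 is the product `⋆` shifted by one place.
-- The shift is the price of a descent, since one maximum is spent on covering it. A word with too
-- few maxima has no preimages; its `deficit` counts the missing ones. At a node, the maxima left
-- over after paying for the descent and for the deficits of both parts become the weight. This is
-- why weight 0 must be allowed, and the same freedom lets a building set whose forest is neither
-- binary nor connected be refined to a tree.
--
-- On the side of polytopes the obstacle is that the order of the reals is undecidable. Hence
-- weights are shown to be integers before trees are built, vertices come from functionals with
-- integer values, and an integral point of a face is located through a coordinate with a positive
-- lower bound.

-- Power series over a commutative semiring

module Series (R : CommutativeSemiring 0ℓ 0ℓ) where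

  open import Data.Nat as ℕ using (ℕ; zero; suc; z≤n; s≤s)
  open import Data.Nat.Properties as ℕ using ()
  open CommutativeSemiring R
  open import Relation.Binary.Reasoning.Setoid setoid
  open import Algebra.Properties.CommutativeSemigroup +-commutativeSemigroup
    using (interchange)

  Seq : Set
  Seq = ℕ → Carrier

  tail : Seq → Seq
  tail f n = f (suc n)

  infixl 7 _⋆_

  -- The Cauchy product, peeled at index 0 of the left factor so that no index n - i has to be
  -- formed.
  _⋆_ : Seq → Seq → Seq
  (f ⋆ g) zero    = f 0 * g 0
  (f ⋆ g) (suc n) = f 0 * g (suc n) + (tail f ⋆ g) n

  0ₛ 1ₛ : Seq
  0ₛ _ = 0#
  1ₛ zero    = 1#
  1ₛ (suc _) = 0#

  infixl 6 _+ₛ_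
  _+ₛ_ : Seq → Seq → Seq
  (f +ₛ g) n = f n + g n

  shift : Seq → Seq
  shift f zero    = 0#
  shift f (suc n) = f n

  -- The n-th coefficient sees only indices up to n. The bound matters where an induction provides
  -- the factors on an initial range only.
  ⋆-cong≤ : ∀ n {f f′ g g′ : Seq} →
            (∀ i → i ℕ.≤ n → f i ≈ f′ i) → (∀ i → i ℕ.≤ n → g i ≈ g′ i) →
            (f ⋆ g) n ≈ (f′ ⋆ g′) n
  ⋆-cong≤ zero    p q = *-cong (p 0 z≤n) (q 0 z≤n)
  ⋆-cong≤ (suc n) p q = +-cong
    (*-cong (p 0 z≤n) (q (suc n) ℕ.≤-refl))
    (⋆-cong≤ n (λ i l → p (suc i) (s≤s l)) (λ i l → q i (ℕ.m≤n⇒m≤1+n l)))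

  ⋆-cong : ∀ {f f′ g g′ : Seq} → (∀ i → f i ≈ f′ i) → (∀ i → g i ≈ g′ i) →
           ∀ n → (f ⋆ g) n ≈ (f′ ⋆ g′) n
  ⋆-cong p q n = ⋆-cong≤ n (λ i _ → p i) (λ i _ → q i)

  ⋆-zeroˡ : ∀ g n → (0ₛ ⋆ g) n ≈ 0#
  ⋆-zeroˡ g zero    = zeroˡ _
  ⋆-zeroˡ g (suc n) = trans (+-cong (zeroˡ _) (⋆-zeroˡ g n)) (+-identityˡ _)

  ⋆-identityˡ : ∀ g n → (1ₛ ⋆ g) n ≈ g n
  ⋆-identityˡ g zero    = *-identityˡ _
  ⋆-identityˡ g (suc n) = trans (+-cong (*-identityˡ _) (⋆-zeroˡ g n)) (+-identityʳ _)

  ⋆-distribʳ : ∀ h f g n → ((f +ₛ g) ⋆ h) n ≈ (f ⋆ h) n + (g ⋆ h) n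
  ⋆-distribʳ h f g zero    = distribʳ _ _ _
  ⋆-distribʳ h f g (suc n) =
    trans (+-cong (distribʳ _ _ _) (⋆-distribʳ h (tail f) (tail g) n)) (interchange _ _ _ _)

  ⋆-scaleˡ : ∀ a f g n → ((λ i → a * f i) ⋆ g) n ≈ a * (f ⋆ g) n
  ⋆-scaleˡ a f g zero    = *-assoc _ _ _
  ⋆-scaleˡ a f g (suc n) =
    trans (+-cong (*-assoc _ _ _) (⋆-scaleˡ a (tail f) g n)) (sym (distribˡ _ _ _))

  -- The mirror image of the defining recursion, peeling at index 0 of the right factor;
  -- commutativity follows from the two together.
  ⋆-last : ∀ f g n → (f ⋆ g) (suc n) ≈ (f ⋆ tail g) n + f (suc n) * g 0
  ⋆-last f g zero    = refl
  ⋆-last f g (suc n) =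
    trans (+-congˡ (⋆-last (tail f) g n)) (sym (+-assoc _ _ _))

  ⋆-comm : ∀ f g n → (f ⋆ g) n ≈ (g ⋆ f) n
  ⋆-comm f g zero    = *-comm _ _
  ⋆-comm f g (suc n) = begin
    f 0 * g (suc n) + (tail f ⋆ g) n   ≈⟨ +-cong (*-comm _ _) (⋆-comm (tail f) g n) ⟩
    g (suc n) * f 0 + (g ⋆ tail f) n   ≈⟨ +-comm _ _ ⟩
    (g ⋆ tail f) n + g (suc n) * f 0   ≈⟨ ⋆-last g f n ⟨
    (g ⋆ f) (suc n)                    ∎

  ⋆-assoc : ∀ f g h n → ((f ⋆ g) ⋆ h) n ≈ (f ⋆ (g ⋆ h)) n
  ⋆-assoc f g h zero    = *-assoc _ _ _
  ⋆-assoc f g h (suc n) = begin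
    (f 0 * g 0) * h (suc n) + (tail (f ⋆ g) ⋆ h) n
      ≈⟨ +-congˡ (⋆-distribʳ h (λ i → f 0 * g (suc i)) (tail f ⋆ g) n) ⟩
    (f 0 * g 0) * h (suc n) + (((λ i → f 0 * g (suc i)) ⋆ h) n + ((tail f ⋆ g) ⋆ h) n)
      ≈⟨ +-cong (*-assoc _ _ _) (+-cong (⋆-scaleˡ (f 0) (tail g) h n) (⋆-assoc (tail f) g h n)) ⟩
    f 0 * (g 0 * h (suc n)) + (f 0 * (tail g ⋆ h) n + (tail f ⋆ (g ⋆ h)) n)
      ≈⟨ +-assoc _ _ _ ⟨
    (f 0 * (g 0 * h (suc n)) + f 0 * (tail g ⋆ h) n) + (tail f ⋆ (g ⋆ h)) n
      ≈⟨ +-congʳ (distribˡ _ _ _) ⟨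
    f 0 * (g ⋆ h) (suc n) + (tail f ⋆ (g ⋆ h)) n ∎

  ⋆-shiftˡ : ∀ f g n → (shift f ⋆ g) (suc n) ≈ (f ⋆ g) n
  ⋆-shiftˡ f g n = trans (+-congʳ (zeroˡ _)) (+-identityˡ _)

  ⋆-swapʳ : ∀ f g h n → ((f ⋆ g) ⋆ h) n ≈ ((f ⋆ h) ⋆ g) n
  ⋆-swapʳ f g h n = begin
    ((f ⋆ g) ⋆ h) n   ≈⟨ ⋆-assoc f g h n ⟩
    (f ⋆ (g ⋆ h)) n   ≈⟨ ⋆-cong (λ _ → refl) (⋆-comm g h) n ⟩
    (f ⋆ (h ⋆ g)) n   ≈⟨ ⋆-assoc f h g n ⟨
    ((f ⋆ h) ⋆ g) n   ∎

import Algebra.Structures.Biased as Biased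
open import Data.Bool using (if_then_else_; true; false)
open import Data.Bool.Properties using () renaming (_≟_ to _≟ᵇ_)
open import Data.Fin as Fin using (Fin; zero; suc; _↑ˡ_; _↑ʳ_; splitAt; toℕ)
open import Data.Fin.Properties as Fin using (_≟_; splitAt-↑ˡ; splitAt-↑ʳ; join-splitAt)
open import Data.Fin.Subset
  using (Subset; ⊥; ⊤; Nonempty; inside; outside; ⁅_⁆; _∩_; ∣_∣) renaming (_∈_ to _∈ˢ_; _⊆_ to
    _⊆ˢ_; _∉_ to _∉ˢ_)
open import Data.Fin.Subset.Properties
  using (∉⊥; _∈?_; nonempty?; ∈⊤; x∈p∩q⁻; x∈p∩q⁺; ⊆-antisym; p⊂q⇒∣p∣<∣q∣; Empty-unique)
open import Data.Integer as ℤ using (ℤ; +_; +≤+; -[1+_])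
import Data.Integer.Properties as ℤ
open import Data.List
  using (List; []; _∷_; _++_; map; cartesianProductWith; length; foldr; upTo; [_]; reverse)
import Data.List.Membership.DecPropositional as DecMembership
import Data.List.Membership.Propositional as ∈
import Data.List.Membership.Propositional.Properties as ∈
open import Data.List.Membership.Propositional.Properties.WithK using (unique∧set⇒bag)
open import Data.List.Properties
  using (length-++; ++-identityʳ; ++-assoc; reverse-++; unfold-reverse; reverse-involutive;
    reverse-injective; ∷-injective; ∷-injectiveʳ)
open import Data.List.Relation.Binary.BagAndSetEquality using (∼bag⇒↭)
open import Data.List.Relation.Binary.Disjoint.Propositional using (Disjoint)
open import Data.List.Relation.Binary.Permutation.Propositional as ↭
  using (_↭_; ↭-sym; ↭-trans; prep)
import Data.List.Relation.Binary.Permutation.Propositional.Properties as ↭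
import Data.List.Relation.Binary.Permutation.Setoid.Properties as ↭ₛ
open import Data.List.Relation.Unary.All as All using ([]; _∷_; All; all?)
import Data.List.Relation.Unary.All.Properties as All
open import Data.List.Relation.Unary.AllPairs using ([]; _∷_)
open import Data.List.Relation.Unary.Any using (here; there)
open import Data.List.Relation.Unary.Unique.Propositional using (Unique)
import Data.List.Relation.Unary.Unique.Propositional.Properties as Unique
open import Data.Nat as ℕ using (ℕ; zero; suc; NonZero; _≤_; _<_; _⊔_; s≤s; _∸_; z≤n)
open import Data.Nat.Combinatorics using (nCk≡nC[n∸k]; nCn≡1; nC1≡n; nCk+nC[k+1]≡[n+1]C[k+1])
open import Data.Nat.Combinatorics.Specification using (k>n⇒nCk≡0)
import Data.Nat.Properties as ℕ
open import Data.Nat.Tactic.RingSolver using (solve-∀)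
open import Data.Product using (_,_; _×_; ∃-syntax; proj₁; proj₂; Σ-syntax)
open import Data.Rational as ℚ using (ℚ; 0ℚ; 1ℚ; _/_; ½)
import Data.Rational.Properties as ℚ
open import Data.Rational.Unnormalised as ℚᵘ using (mkℚᵘ; *≡*; *≤*)
import Data.Rational.Unnormalised.Properties as ℚᵘ
open import Data.Sum using (inj₁; inj₂; _⊎_)
open import Data.Vec as Vec using (Vec; []; _∷_; lookup; here; there)
open import Data.Vec.Functional using (Vector) renaming (_++_ to _++ᶠ_; foldr to foldrᵛ)
open import Data.Vec.Properties as Vec
  using ([]=⇒lookup; lookup⇒[]=; lookup-++ˡ; lookup-++ʳ; ++-injectiveˡ; ++-injectiveʳ;
    lookup∘tabulate; lookup-replicate; lookup-zipWith; ≡-dec)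
open import Defs as D
  using (IsZero; _⊕_; _⊗_; _Enumerates_; monomial; narayana; IsPermutation; stackSort;
    stackSort-split; des; narayanaᵛ; ℝ; seq; cauchy; ℂ; re; im; _≈ᶜ_; _+ᶜ_; _*ᶜ_; fromℝ; eval;
    OnlyRealRoots; PointSet; Δ; _⊞_; _·ˢ_; _≈ᵖ_; 0ᵖ; IsInterval; IsBinaryBuildingSet;
    BinaryNestohedron; ⟦_⟧; LatticePoint; IsIntegral; IsVertex)
open import Function using (_∘_; _$_)
open import Function.Bundles using (mk⇔; _⇔_; Equivalence)
open import Function.Construct.Composition using (_⇔-∘_)
open import Function.Construct.Symmetry using (⇔-sym)
open import Relation.Binary.Definitions using (tri<; tri≈; tri>)
open import Relation.Binary.PropositionalEquality as ≡
  using (_≡_; cong; cong₂; sym; trans; subst₂; refl; subst; _≢_)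
open import Relation.Binary.Structures using (IsEquivalence)
open import Relation.Nullary using (¬_; does; yes; no; contradiction; Dec)
open import Relation.Nullary.Decidable using (dec-true; dec-false; _×-dec_; ¬?; decidable-stable)

-- Polynomials up to trailing zeros, and sums over finite sets

module Polynomial where

  open import Data.List.Membership.Propositional using (_∈_)

  open import Defs using (Poly; ∑)

  ℚ-semiring : CommutativeSemiring 0ℓ 0ℓ
  ℚ-semiring = CommutativeRing.commutativeSemiring ℚ.+-*-commutativeRing

  open Series ℚ-semiring

  coeff : Poly → ℕ → ℚ
  coeff []      _       = 0ℚ
  coeff (a ∷ p) zero    = a
  coeff (a ∷ p) (suc n) = coeff p n

  infix 4 _≋_

  -- Coefficient lists may end in zeros, so equality is coefficientwise. The record wrapper lets
  -- both polynomials be inferred.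
  record _≋_ (p q : Poly) : Set where
    constructor coeffwise
    field at : ∀ n → coeff p n ≡ coeff q n

  open _≋_ public

  ≋-isEquivalence : IsEquivalence _≋_
  ≋-isEquivalence = record
    { refl  = coeffwise λ _ → ≡.refl
    ; sym   = λ e → coeffwise λ n → ≡.sym (at e n)
    ; trans = λ e f → coeffwise λ n → ≡.trans (at e n) (at f n)
    }

  coeff-⊕ : ∀ p q n → coeff (p ⊕ q) n ≡ coeff p n ℚ.+ coeff q n
  coeff-⊕ []      q       n       = ≡.sym (ℚ.+-identityˡ _)
  coeff-⊕ (a ∷ p) []      n       = ≡.sym (ℚ.+-identityʳ _)
  coeff-⊕ (a ∷ p) (b ∷ q) zero    = ≡.refl
  coeff-⊕ (a ∷ p) (b ∷ q) (suc n) = coeff-⊕ p q n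

  coeff-map : ∀ a p n → coeff (map (a ℚ.*_) p) n ≡ a ℚ.* coeff p n
  coeff-map a []      n       = ≡.sym (ℚ.*-zeroʳ a)
  coeff-map a (b ∷ p) zero    = ≡.refl
  coeff-map a (b ∷ p) (suc n) = coeff-map a p n

  coeff-⊗ : ∀ p q n → coeff (p ⊗ q) n ≡ (coeff p ⋆ coeff q) n
  coeff-⊗ []      q n       = ≡.sym (⋆-zeroˡ (coeff q) n)
  coeff-⊗ (a ∷ p) q zero    =
    ≡.trans (coeff-⊕ (map (a ℚ.*_) q) _ 0) (≡.trans (ℚ.+-identityʳ _) (coeff-map a q 0))
  coeff-⊗ (a ∷ p) q (suc n) =
    ≡.trans (coeff-⊕ (map (a ℚ.*_) q) _ (suc n))
            (cong₂ ℚ._+_ (coeff-map a q (suc n)) (coeff-⊗ p q n))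

  coeff-one : ∀ n → coeff (1ℚ ∷ []) n ≡ 1ₛ n
  coeff-one zero    = ≡.refl
  coeff-one (suc n) = ≡.refl

  private
    ⊕-cong : ∀ {p p′ q q′} → p ≋ p′ → q ≋ q′ → p ⊕ q ≋ p′ ⊕ q′
    ⊕-cong {p} {p′} {q} {q′} e f = coeffwise λ n →
      ≡.trans (coeff-⊕ p q n) (≡.trans (cong₂ ℚ._+_ (at e n) (at f n)) (≡.sym (coeff-⊕ p′ q′ n)))

    ⊕-assoc : ∀ p q r → (p ⊕ q) ⊕ r ≋ p ⊕ (q ⊕ r)
    ⊕-assoc p q r = coeffwise λ n → begin
      coeff ((p ⊕ q) ⊕ r) n                        ≡⟨ coeff-⊕ (p ⊕ q) r n ⟩
      coeff (p ⊕ q) n ℚ.+ coeff r n                ≡⟨ cong (ℚ._+ _) (coeff-⊕ p q n) ⟩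
      (coeff p n ℚ.+ coeff q n) ℚ.+ coeff r n      ≡⟨ ℚ.+-assoc (coeff p n) _ _ ⟩
      coeff p n ℚ.+ (coeff q n ℚ.+ coeff r n)      ≡⟨ cong (coeff p n ℚ.+_) (coeff-⊕ q r n) ⟨
      coeff p n ℚ.+ coeff (q ⊕ r) n                ≡⟨ coeff-⊕ p (q ⊕ r) n ⟨
      coeff (p ⊕ (q ⊕ r)) n                        ∎
      where open ≡.≡-Reasoning

    ⊕-comm : ∀ p q → p ⊕ q ≋ q ⊕ p
    ⊕-comm p q = coeffwise λ n →
      ≡.trans (coeff-⊕ p q n) (≡.trans (ℚ.+-comm (coeff p n) _) (≡.sym (coeff-⊕ q p n)))

    ⊗-cong : ∀ {p p′ q q′} → p ≋ p′ → q ≋ q′ → p ⊗ q ≋ p′ ⊗ q′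
    ⊗-cong {p} {p′} {q} {q′} e f = coeffwise λ n →
      ≡.trans (coeff-⊗ p q n) (≡.trans (⋆-cong (at e) (at f) n) (≡.sym (coeff-⊗ p′ q′ n)))

    ⊗-assoc : ∀ p q r → (p ⊗ q) ⊗ r ≋ p ⊗ (q ⊗ r)
    ⊗-assoc p q r = coeffwise λ n → begin
      coeff ((p ⊗ q) ⊗ r) n                ≡⟨ coeff-⊗ (p ⊗ q) r n ⟩
      (coeff (p ⊗ q) ⋆ coeff r) n          ≡⟨ ⋆-cong (coeff-⊗ p q) (λ _ → ≡.refl) n ⟩
      ((coeff p ⋆ coeff q) ⋆ coeff r) n    ≡⟨ ⋆-assoc (coeff p) (coeff q) (coeff r) n ⟩
      (coeff p ⋆ (coeff q ⋆ coeff r)) n    ≡⟨ ⋆-cong {coeff p} (λ _ → ≡.refl) (coeff-⊗ q r) n ⟨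
      (coeff p ⋆ coeff (q ⊗ r)) n          ≡⟨ coeff-⊗ p (q ⊗ r) n ⟨
      coeff (p ⊗ (q ⊗ r)) n                ∎
      where open ≡.≡-Reasoning

    ⊗-comm : ∀ p q → p ⊗ q ≋ q ⊗ p
    ⊗-comm p q = coeffwise λ n →
      ≡.trans (coeff-⊗ p q n) (≡.trans (⋆-comm (coeff p) (coeff q) n) (≡.sym (coeff-⊗ q p n)))

    ⊗-identityˡ : ∀ p → (1ℚ ∷ []) ⊗ p ≋ p
    ⊗-identityˡ p = coeffwise λ n → ≡.trans (coeff-⊗ (1ℚ ∷ []) p n)
      (≡.trans (⋆-cong coeff-one (λ _ → ≡.refl) n) (⋆-identityˡ (coeff p) n))

    ⊗-distribʳ : ∀ r p q → (p ⊕ q) ⊗ r ≋ (p ⊗ r) ⊕ (q ⊗ r)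
    ⊗-distribʳ r p q = coeffwise λ n → begin
      coeff ((p ⊕ q) ⊗ r) n                ≡⟨ coeff-⊗ (p ⊕ q) r n ⟩
      (coeff (p ⊕ q) ⋆ coeff r) n          ≡⟨ ⋆-cong (coeff-⊕ p q) (λ _ → ≡.refl) n ⟩
      ((coeff p +ₛ coeff q) ⋆ coeff r) n   ≡⟨ ⋆-distribʳ (coeff r) (coeff p) (coeff q) n ⟩
      (coeff p ⋆ coeff r) n ℚ.+ (coeff q ⋆ coeff r) n
        ≡⟨ cong₂ ℚ._+_ (coeff-⊗ p r n) (coeff-⊗ q r n) ⟨
      coeff (p ⊗ r) n ℚ.+ coeff (q ⊗ r) n  ≡⟨ coeff-⊕ (p ⊗ r) (q ⊗ r) n ⟨
      coeff ((p ⊗ r) ⊕ (q ⊗ r)) n          ∎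
      where open ≡.≡-Reasoning

  -- With this semiring the sequences are used a second time: sequences of polynomials are series in
  -- z with coefficients in x, where the generating functions of the proof live.
  poly-semiring : CommutativeSemiring 0ℓ 0ℓ
  poly-semiring = record
    { Carrier = Poly ; _≈_ = _≋_ ; _+_ = _⊕_ ; _*_ = _⊗_ ; 0# = [] ; 1# = 1ℚ ∷ []
    ; isCommutativeSemiring = Biased.isCommutativeSemiringˡ record
      { +-isCommutativeMonoid = Biased.isCommutativeMonoidˡ record
        { isSemigroup = record
          { isMagma = record { isEquivalence = ≋-isEquivalence ; ∙-cong = ⊕-cong }
          ; assoc = ⊕-assoc }
        ; identityˡ = λ _ → coeffwise λ _ → ≡.refl
        ; comm = ⊕-comm }
      ; *-isCommutativeMonoid = Biased.isCommutativeMonoidˡ record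
        { isSemigroup = record
          { isMagma = record { isEquivalence = ≋-isEquivalence ; ∙-cong = ⊗-cong }
          ; assoc = ⊗-assoc }
        ; identityˡ = ⊗-identityˡ
        ; comm = ⊗-comm }
      ; distribʳ = ⊗-distribʳ
      ; zeroˡ = λ _ → coeffwise λ _ → ≡.refl
      }
    }

  module Poly = CommutativeSemiring poly-semiring
  open Poly public using ()
    renaming (refl to ≋-refl; sym to ≋-sym; trans to ≋-trans; reflexive to ≋-reflexive)
  open import Relation.Binary.Reasoning.Setoid Poly.setoid
  open import Algebra.Properties.CommutativeSemigroup Poly.+-commutativeSemigroup using (x∙yz≈y∙xz)

  ⊕-congˡ : ∀ p {q q′} → q ≋ q′ → p ⊕ q ≋ p ⊕ q′
  ⊕-congˡ p = Poly.+-cong (≋-refl {p})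

  ⊕-congʳ : ∀ q {p p′} → p ≋ p′ → p ⊕ q ≋ p′ ⊕ q
  ⊕-congʳ q e = Poly.+-cong e (≋-refl {q})

  ⊗-congˡ : ∀ p {q q′} → q ≋ q′ → p ⊗ q ≋ p ⊗ q′
  ⊗-congˡ p = Poly.*-cong (≋-refl {p})

  ⊗-congʳ : ∀ q {p p′} → p ≋ p′ → p ⊗ q ≋ p′ ⊗ q
  ⊗-congʳ q e = Poly.*-cong e (≋-refl {q})

  IsZero-resp-≋ : ∀ {p q} → p ≋ q → IsZero p → IsZero q
  IsZero-resp-≋ {p} {q} e zs = go q λ n → ≡.trans (≡.sym (at e n)) (coeff-zero zs n)
    where
    coeff-zero : ∀ {p} → IsZero p → ∀ n → coeff p n ≡ 0ℚ
    coeff-zero []       n       = ≡.refl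
    coeff-zero (z ∷ zs) zero    = z
    coeff-zero (z ∷ zs) (suc n) = coeff-zero zs n
    go : ∀ q → (∀ n → coeff q n ≡ 0ℚ) → IsZero q
    go []      z = []
    go (b ∷ q) z = z 0 ∷ go q (z ∘ suc)

  module _ {A : Set} where

    ∑-cong : ∀ (xs : List A) {f g : A → Poly} → (∀ {x} → x ∈ xs → f x ≋ g x) → ∑ xs f ≋ ∑ xs g
    ∑-cong []       e = ≋-refl
    ∑-cong (x ∷ xs) e = Poly.+-cong (e (here ≡.refl)) (∑-cong xs (e ∘ there))

    ∑-++ : ∀ (xs ys : List A) f → ∑ (xs ++ ys) f ≋ ∑ xs f ⊕ ∑ ys f
    ∑-++ []       ys f = ≋-refl
    ∑-++ (x ∷ xs) ys f = ≋-trans (⊕-congˡ (f x) (∑-++ xs ys f)) (≋-sym (Poly.+-assoc (f x) _ _))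

    ∑-↭ : ∀ {xs ys : List A} f → xs ↭ ys → ∑ xs f ≋ ∑ ys f
    ∑-↭ f ↭.refl          = ≋-refl
    ∑-↭ f (↭.prep x p)    = ⊕-congˡ (f x) (∑-↭ f p)
    ∑-↭ f (↭.swap x y p)  =
      ≋-trans (⊕-congˡ (f x) (⊕-congˡ (f y) (∑-↭ f p))) (x∙yz≈y∙xz (f x) (f y) _)
    ∑-↭ f (↭.trans p q)   = ≋-trans (∑-↭ f p) (∑-↭ f q)

    ∑-⊗ʳ : ∀ (xs : List A) f q → ∑ xs (λ x → f x ⊗ q) ≋ ∑ xs f ⊗ q
    ∑-⊗ʳ []       f q = ≋-refl
    ∑-⊗ʳ (x ∷ xs) f q = ≋-trans (⊕-congˡ (f x ⊗ q) (∑-⊗ʳ xs f q)) (≋-sym (Poly.distribʳ q (f x) _))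

    ∑-⊗ˡ : ∀ (xs : List A) p f → ∑ xs (λ x → p ⊗ f x) ≋ p ⊗ ∑ xs f
    ∑-⊗ˡ xs p f = begin
      ∑ xs (λ x → p ⊗ f x)   ≈⟨ ∑-cong xs (λ {x} _ → Poly.*-comm p (f x)) ⟩
      ∑ xs (λ x → f x ⊗ p)   ≈⟨ ∑-⊗ʳ xs f p ⟩
      ∑ xs f ⊗ p             ≈⟨ Poly.*-comm _ p ⟩
      p ⊗ ∑ xs f             ∎

  ∑-map : ∀ {A B : Set} (g : A → B) (xs : List A) f → ∑ (map g xs) f ≡ ∑ xs (f ∘ g)
  ∑-map g []       f = ≡.refl
  ∑-map g (x ∷ xs) f = cong (f (g x) ⊕_) (∑-map g xs f)

  module _ {A B C : Set} (_∙_ : A → B → C) where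

    -- The hypothesis is restricted to members of the lists because the weight of a preimage factors
    -- only when all entries lie below its maximum.
    ∑-products : ∀ xs ys {f : A → Poly} {g : B → Poly} {h : C → Poly} →
                 (∀ {x y} → x ∈ xs → y ∈ ys → h (x ∙ y) ≋ f x ⊗ g y) →
                 ∑ (cartesianProductWith _∙_ xs ys) h ≋ ∑ xs f ⊗ ∑ ys g
    ∑-products []       ys           e = ≋-refl
    ∑-products (x ∷ xs) ys {f} {g} {h} e = begin
      ∑ (map (x ∙_) ys ++ cartesianProductWith _∙_ xs ys) h
        ≈⟨ ∑-++ (map (x ∙_) ys) (cartesianProductWith _∙_ xs ys) h ⟩
      ∑ (map (x ∙_) ys) h ⊕ ∑ (cartesianProductWith _∙_ xs ys) h
        ≡⟨ cong (_⊕ _) (∑-map (x ∙_) ys h) ⟩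
      ∑ ys (λ y → h (x ∙ y)) ⊕ ∑ (cartesianProductWith _∙_ xs ys) h
        ≈⟨ Poly.+-cong (∑-cong ys (e (here ≡.refl))) (∑-products xs ys (e ∘ there)) ⟩
      ∑ ys (λ y → f x ⊗ g y) ⊕ ∑ xs f ⊗ ∑ ys g
        ≈⟨ ⊕-congʳ (∑ xs f ⊗ ∑ ys g) (∑-⊗ˡ ys (f x) g) ⟩
      f x ⊗ ∑ ys g ⊕ ∑ xs f ⊗ ∑ ys g
        ≈⟨ Poly.distribʳ (∑ ys g) (f x) (∑ xs f) ⟨
      (f x ⊕ ∑ xs f) ⊗ ∑ ys g ∎

  -- Lists without repetition and with the same members are rearrangements of each other. Hence a
  -- sum over a finite set is independent of the enumeration.
  enumerations-↭ : ∀ {A : Set} {P : A → Set} {xs ys} → xs Enumerates P → ys Enumerates P → xs ↭ ys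
  enumerations-↭ (ux , p) (uy , q) =
    ∼bag⇒↭ (unique∧set⇒bag ux uy λ {a} → ⇔-sym (q a) ⇔-∘ p a)

  ∑-enumerations : ∀ {A : Set} {P : A → Set} {xs ys} f → xs Enumerates P → ys Enumerates P →
                   ∑ xs f ≋ ∑ ys f
  ∑-enumerations f ex ey = ∑-↭ f (enumerations-↭ ex ey)

-- The embedding of the integers into the rationals

module Integers where

  private
    toℚᵘ-/1 : ∀ i → ℚ.toℚᵘ (i / 1) ℚᵘ.≃ mkℚᵘ i 0
    toℚᵘ-/1 i = ℚ.toℚᵘ-fromℚᵘ (mkℚᵘ i 0)

  /1-+ : ∀ i j → (i ℤ.+ j) / 1 ≡ i / 1 ℚ.+ j / 1
  /1-+ i j = ℚ.toℚᵘ-injective (begin-equality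
    ℚ.toℚᵘ ((i ℤ.+ j) / 1)                ≃⟨ toℚᵘ-/1 (i ℤ.+ j) ⟩
    mkℚᵘ (i ℤ.+ j) 0
      ≃⟨ *≡* (cong (ℤ._* + 1) (cong₂ ℤ._+_ (sym (ℤ.*-identityʳ i)) (sym (ℤ.*-identityʳ j)))) ⟩
    mkℚᵘ i 0 ℚᵘ.+ mkℚᵘ j 0                ≃⟨ ℚᵘ.+-cong (toℚᵘ-/1 i) (toℚᵘ-/1 j) ⟨
    ℚ.toℚᵘ (i / 1) ℚᵘ.+ ℚ.toℚᵘ (j / 1)    ≃⟨ ℚ.toℚᵘ-homo-+ (i / 1) (j / 1) ⟨
    ℚ.toℚᵘ (i / 1 ℚ.+ j / 1)              ∎)
    where open ℚᵘ.≤-Reasoning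

  /1-* : ∀ i j → (i ℤ.* j) / 1 ≡ (i / 1) ℚ.* (j / 1)
  /1-* i j = ℚ.toℚᵘ-injective (begin-equality
    ℚ.toℚᵘ ((i ℤ.* j) / 1)                ≃⟨ toℚᵘ-/1 (i ℤ.* j) ⟩
    mkℚᵘ i 0 ℚᵘ.* mkℚᵘ j 0                ≃⟨ ℚᵘ.*-cong (toℚᵘ-/1 i) (toℚᵘ-/1 j) ⟨
    ℚ.toℚᵘ (i / 1) ℚᵘ.* ℚ.toℚᵘ (j / 1)    ≃⟨ ℚ.toℚᵘ-homo-* (i / 1) (j / 1) ⟨
    ℚ.toℚᵘ ((i / 1) ℚ.* (j / 1))              ∎)
    where open ℚᵘ.≤-Reasoning

  /1-neg : ∀ i → (ℤ.- i) / 1 ≡ ℚ.- (i / 1)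
  /1-neg i = ℚ.toℚᵘ-injective (begin-equality
    ℚ.toℚᵘ ((ℤ.- i) / 1)      ≃⟨ toℚᵘ-/1 (ℤ.- i) ⟩
    ℚᵘ.- mkℚᵘ i 0             ≃⟨ ℚᵘ.-‿cong (toℚᵘ-/1 i) ⟨
    ℚᵘ.- ℚ.toℚᵘ (i / 1)       ≃⟨ ℚ.toℚᵘ-homo‿- (i / 1) ⟨
    ℚ.toℚᵘ (ℚ.- (i / 1))      ∎)
    where open ℚᵘ.≤-Reasoning

  /1-mono-≤ : ∀ {i j} → i ℤ.≤ j → i / 1 ℚ.≤ j / 1
  /1-mono-≤ {i} {j} i≤j = ℚ.toℚᵘ-cancel-≤ (begin
    ℚ.toℚᵘ (i / 1)   ≃⟨ toℚᵘ-/1 i ⟩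
    mkℚᵘ i 0         ≤⟨ *≤* (ℤ.*-monoʳ-≤-nonNeg (+ 1) i≤j) ⟩
    mkℚᵘ j 0         ≃⟨ toℚᵘ-/1 j ⟨
    ℚ.toℚᵘ (j / 1)   ∎)
    where open ℚᵘ.≤-Reasoning

  /1-cancel-≤ : ∀ {i j} → i / 1 ℚ.≤ j / 1 → i ℤ.≤ j
  /1-cancel-≤ {i} {j} le =
    subst₂ ℤ._≤_ (ℤ.*-identityʳ i) (ℤ.*-identityʳ j) (ℚᵘ.drop-*≤* lemma)
    where
    open ℚᵘ.≤-Reasoning
    lemma : mkℚᵘ i 0 ℚᵘ.≤ mkℚᵘ j 0
    lemma = begin
      mkℚᵘ i 0         ≃⟨ toℚᵘ-/1 i ⟨
      ℚ.toℚᵘ (i / 1)   ≤⟨ ℚ.toℚᵘ-mono-≤ le ⟩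
      ℚ.toℚᵘ (j / 1)   ≃⟨ toℚᵘ-/1 j ⟩
      mkℚᵘ j 0         ∎

  1/n*n≡1 : ∀ n .{{_ : NonZero n}} → (+ 1 / n) ℚ.* (+ n / 1) ≡ 1ℚ
  1/n*n≡1 n@(suc m) = ℚ.toℚᵘ-injective (begin-equality
    ℚ.toℚᵘ ((+ 1 / n) ℚ.* (+ n / 1))             ≃⟨ ℚ.toℚᵘ-homo-* (+ 1 / n) (+ n / 1) ⟩
    ℚ.toℚᵘ (+ 1 / n) ℚᵘ.* ℚ.toℚᵘ (+ n / 1)
      ≃⟨ ℚᵘ.*-cong (ℚ.toℚᵘ-fromℚᵘ (mkℚᵘ (+ 1) m)) (toℚᵘ-/1 (+ n)) ⟩
    mkℚᵘ (+ 1) m ℚᵘ.* mkℚᵘ (+ n) 0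
      ≃⟨ *≡* (trans (ℤ.*-identityʳ _) (cong (λ k → + suc k) (lemma m))) ⟩
    mkℚᵘ (+ 1) 0                                 ∎)
    where
    open ℚᵘ.≤-Reasoning
    open import Data.Nat.Tactic.RingSolver using (solve-∀)
    lemma : ∀ m → m ℕ.+ 0 ≡ m ℕ.* 1 ℕ.+ 0
    lemma = solve-∀

-- The recursion for F and the decomposition at a descent

module Fertility where

  open import Defs using (Poly)
  open Polynomial
  open Series poly-semiring
  open import Relation.Binary.Reasoning.Setoid Poly.setoid
  open import Algebra.Properties.CommutativeSemigroup Poly.+-commutativeSemigroup using (x∙yz≈y∙xz)

  X : Poly
  X = monomial 1ℚ 1

  -- Runs over all factorisations β ++ α. Words are reversed, so β is the image of the part to the
  -- right of the maximum of a preimage and α the image of the part to its left.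
  splitSum : (List ℕ → List ℕ → Poly) → List ℕ → Poly
  splitSum g []      = g [] []
  splitSum g (n ∷ w) = g [] (n ∷ w) ⊕ splitSum (λ β α → g (n ∷ β) α) w

  -- Omits the cut with empty first factor: when the word follows a block v, that cut is already
  -- counted as the last cut of v.
  tailSplits : (List ℕ → List ℕ → Poly) → List ℕ → Poly
  tailSplits g []      = []
  tailSplits g (n ∷ w) = splitSum (λ β α → g (n ∷ β) α) w

  splitSum-cong : ∀ {g h} w → (∀ β α → β ++ α ≡ w → g β α ≋ h β α) → splitSum g w ≋ splitSum h w
  splitSum-cong []      e = e [] [] refl
  splitSum-cong (n ∷ w) e = Poly.+-cong (e [] (n ∷ w) refl)
    (splitSum-cong w λ β α eq → e (n ∷ β) α (cong (n ∷_) eq))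

  tailSplits-cong : ∀ g h w → (∀ n β α → n ∷ β ++ α ≡ w → g (n ∷ β) α ≋ h (n ∷ β) α) →
                    tailSplits g w ≋ tailSplits h w
  tailSplits-cong g h []      e = ≋-refl
  tailSplits-cong g h (n ∷ w) e = splitSum-cong w λ β α eq → e n β α (cong (n ∷_) eq)

  splitSum-++ : ∀ g v w → splitSum g (v ++ w) ≋
                splitSum (λ β ρ → g β (ρ ++ w)) v ⊕ tailSplits (λ γ δ → g (v ++ γ) δ) w
  splitSum-++ g []      []      = ≋-sym (Poly.+-identityʳ (g [] []))
  splitSum-++ g []      (n ∷ w) = ≋-refl
  splitSum-++ g (m ∷ v) w       = ≋-trans
    (⊕-congˡ (g [] (m ∷ v ++ w)) (splitSum-++ (λ β α → g (m ∷ β) α) v w))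
    (≋-sym (Poly.+-assoc (g [] (m ∷ v ++ w)) _ _))

  splitSum-length : ∀ p q w → splitSum (λ β α → p (length β) ⊗ q (length α)) w ≡ (p ⋆ q) (length w)
  splitSum-length p q []      = refl
  splitSum-length p q (n ∷ w) = cong (p 0 ⊗ q (suc (length w)) ⊕_) (splitSum-length (tail p) q w)

  splitSum-last : ∀ g w → (∀ β n α → β ++ n ∷ α ≡ w → g β (n ∷ α) ≋ []) → splitSum g w ≋ g w []
  splitSum-last g []      z = ≋-refl
  splitSum-last g (n ∷ w) z = Poly.+-cong (z [] n w refl)
    (splitSum-last (λ β α → g (n ∷ β) α) w λ β m α eq → z (n ∷ β) m α (cong (n ∷_) eq))

  splitSum-⋆ : ∀ (u : List ℕ → Seq) v (r : List ℕ → Poly) a w →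
               splitSum (λ γ δ → (u γ ⋆ v) a ⊗ r δ) w ≋
               ((λ i → splitSum (λ γ δ → u γ i ⊗ r δ) w) ⋆ v) a
  splitSum-⋆ u v r a w = go u w
    where
    scaled : ∀ p q → (p ⋆ v) a ⊗ q ≋ ((λ i → p i ⊗ q) ⋆ v) a
    scaled p q = begin
      (p ⋆ v) a ⊗ q               ≈⟨ Poly.*-comm ((p ⋆ v) a) q ⟩
      q ⊗ (p ⋆ v) a               ≈⟨ ⋆-scaleˡ q p v a ⟨
      ((λ i → q ⊗ p i) ⋆ v) a     ≈⟨ ⋆-cong (λ i → Poly.*-comm q (p i)) (λ _ → ≋-refl) a ⟩
      ((λ i → p i ⊗ q) ⋆ v) a     ∎
    go : ∀ (u : List ℕ → Seq) w → splitSum (λ γ δ → (u γ ⋆ v) a ⊗ r δ) w ≋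
         ((λ i → splitSum (λ γ δ → u γ i ⊗ r δ) w) ⋆ v) a
    go u []      = scaled (u []) (r [])
    go u (n ∷ w) = ≋-trans
      (Poly.+-cong (scaled (u []) (r (n ∷ w))) (go (λ γ → u (n ∷ γ)) w))
      (≋-sym (⋆-distribʳ v (λ i → u [] i ⊗ r (n ∷ w)) _ a))

  -- Convention for the part to the right of the maximum: if it is empty there is no descent after
  -- the maximum, so it contributes 1, whereas an empty left part contributes x.
  orOne : (List ℕ → Poly) → List ℕ → Poly
  orOne f []      = 1ℚ ∷ []
  orOne f (n ∷ w) = f (n ∷ w)

  -- fertUpTo d w is the sum of x^(des σ + 1) over the preimages σ of the
  -- permutation whose reversal is w, provided that length w ≤ d.
  fertUpTo : ℕ → List ℕ → Poly
  fertUpTo zero    _       = X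
  fertUpTo (suc d) []      = X
  fertUpTo (suc d) (n ∷ w) = if does (all? (ℕ._<? n) w)
    then splitSum (λ β α → orOne (fertUpTo d) β ⊗ fertUpTo d α) w
    else []

  fert : List ℕ → Poly
  fert w = fertUpTo (length w) w

  private
    ++-bounds : ∀ (β α : List ℕ) {w d} → β ++ α ≡ w → length w ≤ d → length β ≤ d × length α ≤ d
    ++-bounds β α refl l rewrite length-++ β {α} =
      ℕ.≤-trans (ℕ.m≤m+n _ _) l , ℕ.≤-trans (ℕ.m≤n+m _ (length β)) l

    orOne-cong : ∀ {f g} β → f β ≋ g β → orOne f β ≋ orOne g β
    orOne-cong []      e = ≋-refl
    orOne-cong (n ∷ β) e = e

  fertUpTo-enough : ∀ d e w → length w ≤ d → length w ≤ e → fertUpTo d w ≋ fertUpTo e w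
  fertUpTo-enough zero    zero    []      l l′ = ≋-refl
  fertUpTo-enough zero    (suc e) []      l l′ = ≋-refl
  fertUpTo-enough (suc d) zero    []      l l′ = ≋-refl
  fertUpTo-enough (suc d) (suc e) []      l l′ = ≋-refl
  fertUpTo-enough (suc d) (suc e) (n ∷ w) (s≤s l) (s≤s l′) with all? (ℕ._<? n) w
  ... | no  _ = ≋-refl
  ... | yes _ = splitSum-cong w λ β α eq →
    let β≤d , α≤d = ++-bounds β α eq l
        β≤e , α≤e = ++-bounds β α eq l′
    in Poly.*-cong (orOne-cong β (fertUpTo-enough d e β β≤d β≤e)) (fertUpTo-enough d e α α≤d α≤e)

  splitTerm : List ℕ → List ℕ → Poly
  splitTerm β α = orOne fert β ⊗ fert α

  fert-∷ : ∀ {n w} → All (_< n) w → fert (n ∷ w) ≋ splitSum splitTerm w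
  fert-∷ {n} {w} w<n rewrite dec-true (all? (ℕ._<? n) w) w<n = splitSum-cong w λ β α eq →
    let β≤ , α≤ = ++-bounds β α eq ℕ.≤-refl
    in Poly.*-cong (orOne-cong β (fertUpTo-enough _ _ β β≤ ℕ.≤-refl))
                   (fertUpTo-enough _ _ α α≤ ℕ.≤-refl)

  -- A nonempty image of the stack-sorting map ends in its maximum, so a reversed word not headed by
  -- its maximum has no preimages.
  fert-dead : ∀ {n w} → ¬ All (_< n) w → fert (n ∷ w) ≡ []
  fert-dead {n} {w} w≮n rewrite dec-false (all? (ℕ._<? n) w) w≮n = refl

  -- Words are reversed: ms are increasing maxima appended to the permutation α.
  data Dominates : List ℕ → List ℕ → Set where
    []  : ∀ {α} → Dominates [] α
    _∷_ : ∀ {m ms α} → All (_< m) (ms ++ α) → Dominates ms α → Dominates (m ∷ ms) α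

  dominates-suffix : ∀ β {ρ α} → Dominates (β ++ ρ) α → Dominates ρ α
  dominates-suffix []      D       = D
  dominates-suffix (m ∷ β) (_ ∷ D) = dominates-suffix β D

  dominates-prefix : ∀ β {ρ α} → Dominates (β ++ ρ) α → Dominates β []
  dominates-prefix []      D = []
  dominates-prefix (m ∷ β) {ρ} {α} (h ∷ D) =
    subst (All _) (≡.sym (++-identityʳ β)) (All.++⁻ˡ β (All.++⁻ˡ (β ++ ρ) h)) ∷ dominates-prefix β D

  dominates-++ˡ : ∀ {ms} γ {δ} → Dominates ms (γ ++ δ) → Dominates ms γ
  dominates-++ˡ γ []      = []
  dominates-++ˡ {m ∷ ms} γ {δ} (h ∷ D) =
    All.++⁻ˡ (ms ++ γ) (subst (All _) (≡.sym (++-assoc ms γ δ)) h) ∷ dominates-++ˡ γ D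

  sup : List ℕ → ℕ
  sup = foldr _⊔_ 0

  <-suc-sup : ∀ w → All (_< suc (sup w)) w
  <-suc-sup []      = []
  <-suc-sup (n ∷ w) = s≤s (ℕ.m≤m⊔n n (sup w)) ∷
    All.map (λ l → ℕ.≤-trans l (s≤s (ℕ.m≤n⊔m n (sup w)))) (<-suc-sup w)

  tower : List ℕ → ℕ → List ℕ
  tower α zero    = []
  tower α (suc a) = suc (sup (tower α a ++ α)) ∷ tower α a

  tower-dominates : ∀ α a → Dominates (tower α a) α
  tower-dominates α zero    = []
  tower-dominates α (suc a) = <-suc-sup _ ∷ tower-dominates α a

  length-tower : ∀ α a → length (tower α a) ≡ a
  length-tower α zero    = refl
  length-tower α (suc a) = cong suc (length-tower α a)

  -- The series in z attached to α; its constant term is F of α itself.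
  fertₛ : List ℕ → Seq
  fertₛ α a = fert (tower α a ++ α)

  -- This is 1 + u, against x + u for `fertₛ []`: the two conventions for the empty word differ only
  -- at index 0.
  increasingₛ : Seq
  increasingₛ zero    = 1ℚ ∷ []
  increasingₛ (suc a) = fertₛ [] (suc a)

  private
    -- Only the number of appended maxima counts. The bound makes this an induction hypothesis,
    -- available for every α at once.
    Independent : ℕ → Set
    Independent a = ∀ α ms → length ms ≤ a → Dominates ms α → fert (ms ++ α) ≋ fertₛ α (length ms)

    -- A cut among the maxima, or right after them, leaves an increasing word on one side and α with
    -- the remaining maxima on the other; together these give the convolution. A cut after at least
    -- one letter of α leaves all the maxima on top of the first piece γ.
    splitSum-dominates : ∀ {a} → Independent a → ∀ α ms → length ms ≤ a → Dominates ms α →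
      splitSum splitTerm (ms ++ α) ≋
      (increasingₛ ⋆ fertₛ α) (length ms) ⊕ tailSplits (λ γ δ → fertₛ γ (length ms) ⊗ fert δ) α
    splitSum-dominates {a} I α ms l D = begin
      splitSum splitTerm (ms ++ α)
        ≈⟨ splitSum-++ splitTerm ms α ⟩
      splitSum (λ β ρ → splitTerm β (ρ ++ α)) ms ⊕ tailSplits (λ γ δ → splitTerm (ms ++ γ) δ) α
        ≈⟨ Poly.+-cong (splitSum-cong ms inner) (tailSplits-cong _ T α outer) ⟩
      splitSum (λ β ρ → increasingₛ (length β) ⊗ fertₛ α (length ρ)) ms ⊕ tailSplits T α
        ≡⟨ cong (_⊕ tailSplits T α) (splitSum-length increasingₛ (fertₛ α) ms) ⟩
      (increasingₛ ⋆ fertₛ α) (length ms) ⊕ tailSplits T α ∎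
      where
      T = λ γ δ → fertₛ γ (length ms) ⊗ fert δ
      increasing : ∀ β → length β ≤ a → Dominates β [] → orOne fert β ≋ increasingₛ (length β)
      increasing []      l D = ≋-refl
      increasing (m ∷ β) l D =
        ≋-trans (≋-reflexive (cong fert (≡.sym (++-identityʳ (m ∷ β))))) (I [] (m ∷ β) l D)
      inner : ∀ β ρ → β ++ ρ ≡ ms →
              splitTerm β (ρ ++ α) ≋ increasingₛ (length β) ⊗ fertₛ α (length ρ)
      inner β ρ refl =
        let β≤ , ρ≤ = ++-bounds β ρ refl l
        in Poly.*-cong (increasing β β≤ (dominates-prefix β D))
                       (I α ρ ρ≤ (dominates-suffix β D))
      outer : ∀ n γ δ → n ∷ γ ++ δ ≡ α →
              splitTerm (ms ++ n ∷ γ) δ ≋ fertₛ (n ∷ γ) (length ms) ⊗ fert δ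
      outer n γ δ refl = ⊗-congʳ (fert δ) (≋-trans (≋-reflexive (nonempty ms))
        (I (n ∷ γ) ms l (dominates-++ˡ (n ∷ γ) D)))
        where
        nonempty : ∀ ms → orOne fert (ms ++ n ∷ γ) ≡ fert (ms ++ n ∷ γ)
        nonempty []      = refl
        nonempty (_ ∷ _) = refl

    independent : ∀ a → Independent a
    independent a       α []       l D = ≋-refl
    independent (suc a) α (m ∷ ms) (s≤s l) (h ∷ D) = begin
      fert (m ∷ ms ++ α)                ≈⟨ fert-∷ h ⟩
      splitSum splitTerm (ms ++ α)      ≈⟨ splitSum-dominates (independent a) α ms l D ⟩
      -- The expression knows `ms` only by its length, so a tower of the same length can take its
      -- place.
      rhs (length ms)                   ≡⟨ cong rhs len ⟨
      rhs (length t)                    ≈⟨ splitSum-dominates (independent a) α t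
                                             (ℕ.≤-trans (ℕ.≤-reflexive len) l)
                                             (tower-dominates α (length ms)) ⟨
      splitSum splitTerm (t ++ α)       ≈⟨ fert-∷ (<-suc-sup (t ++ α)) ⟨
      fertₛ α (suc (length ms))         ∎
      where
      t   = tower α (length ms)
      len = length-tower α (length ms)
      rhs = λ k → (increasingₛ ⋆ fertₛ α) k ⊕ tailSplits (λ γ δ → fertₛ γ k ⊗ fert δ) α

  fert-dominates : ∀ α ms → Dominates ms α → fert (ms ++ α) ≋ fertₛ α (length ms)
  fert-dominates α ms = independent (length ms) α ms ℕ.≤-refl

  fertₛ-suc : ∀ α a → fertₛ α (suc a) ≋
              (increasingₛ ⋆ fertₛ α) a ⊕ tailSplits (λ γ δ → fertₛ γ a ⊗ fert δ) α
  fertₛ-suc α a = begin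
    fertₛ α (suc a)               ≈⟨ fert-∷ (<-suc-sup (tower α a ++ α)) ⟩
    splitSum splitTerm (tower α a ++ α)
      ≈⟨ splitSum-dominates (independent (length (tower α a))) α (tower α a) ℕ.≤-refl
           (tower-dominates α a) ⟩
    rhs (length (tower α a))      ≡⟨ cong rhs (length-tower α a) ⟩
    rhs a                         ∎
    where rhs = λ k → (increasingₛ ⋆ fertₛ α) k ⊕ tailSplits (λ γ δ → fertₛ γ k ⊗ fert δ) α

  -- The empty word has no inner cuts. What remains is the equation u = z (1 + u) (x + u),
  -- coefficient by coefficient.
  fertₛ-[]-suc : ∀ a → fertₛ [] (suc a) ≋ (increasingₛ ⋆ fertₛ []) a
  fertₛ-[]-suc a = ≋-trans (fertₛ-suc [] a) (Poly.+-identityʳ _)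

  -- The decomposition lemma for the descent from the maximum M, where the
  -- hooks are sorted by how many of the appended maxima they cover.
  module _ (M : ℕ) (b : ℕ) (β : List ℕ) (β<M : All (_< M) (b ∷ β)) where

    private
      dead : ∀ α₁ ρ → All (_< M) ρ → ∀ n → n < M → fert (n ∷ ρ ++ M ∷ α₁) ≡ []
      dead α₁ ρ ρ<M n n<M = fert-dead λ h →
        ℕ.<-asym n<M (All.head (All.++⁻ʳ ρ h))

      FB = fertₛ (b ∷ β)

      -- A cut inside b ∷ β leaves a second factor whose head is smaller than the later entry M,
      -- hence one without preimages. The cut right before M and the cuts beyond M survive.
      tailSplits-++ : ∀ α₁ (H : List ℕ → Poly) →
        tailSplits (λ γ δ → H γ ⊗ fert δ) (b ∷ β ++ M ∷ α₁) ≋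
        H (b ∷ β) ⊗ fert (M ∷ α₁) ⊕ tailSplits (λ γ δ → H (b ∷ β ++ γ) ⊗ fert δ) (M ∷ α₁)
      tailSplits-++ α₁ H = ≋-trans
        (splitSum-++ (λ γ δ → H (b ∷ γ) ⊗ fert δ) β (M ∷ α₁))
        (⊕-congʳ _ (splitSum-last (λ γ ρ → H (b ∷ γ) ⊗ fert (ρ ++ M ∷ α₁)) β vanish))
        where
        vanish : ∀ γ n ρ → γ ++ n ∷ ρ ≡ β → H (b ∷ γ) ⊗ fert (n ∷ ρ ++ M ∷ α₁) ≋ []
        vanish γ n ρ refl with n<M ∷ ρ<M ← All.++⁻ʳ γ (All.tail β<M)
          rewrite dead α₁ ρ ρ<M n n<M = Poly.zeroʳ (H (b ∷ γ))

      tailSplits-zero : ∀ (g : List ℕ → List ℕ → Poly) w →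
        (∀ n β α → n ∷ β ++ α ≡ w → g (n ∷ β) α ≋ []) → tailSplits g w ≋ []
      tailSplits-zero g []      z = ≋-refl
      tailSplits-zero g (n ∷ w) z = ≋-trans
        (splitSum-last _ w λ β m α eq → z n β (m ∷ α) (cong (n ∷_) eq))
        (z n w [] (cong (n ∷_) (++-identityʳ w)))

    fertₛ-++-zero : ∀ α₁ → fertₛ (b ∷ β ++ M ∷ α₁) 0 ≡ []
    fertₛ-++-zero α₁ = dead α₁ β (All.tail β<M) b (All.head β<M)

    private
      -- Quantified over α₁ because cuts beyond M call for the decomposition of words with a shorter
      -- α₁.
      Decomposes : ℕ → Set
      Decomposes a = ∀ α₁ → fertₛ (b ∷ β ++ M ∷ α₁) (suc a) ≋ (fertₛ (M ∷ α₁) ⋆ FB) a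

      decompose-zero : Decomposes 0
      decompose-zero α₁ = begin
        H 1
          ≈⟨ fertₛ-suc (b ∷ β ++ M ∷ α₁) 0 ⟩
        (1ℚ ∷ []) ⊗ H 0 ⊕ tailSplits (λ γ δ → fertₛ γ 0 ⊗ fert δ) (b ∷ β ++ M ∷ α₁)
          ≡⟨ cong (λ p → (1ℚ ∷ []) ⊗ p ⊕ T) (fertₛ-++-zero α₁) ⟩
        (1ℚ ∷ []) ⊗ [] ⊕ T
          ≈⟨ ⊕-congʳ T (Poly.zeroʳ (1ℚ ∷ [])) ⟩
        T
          ≈⟨ tailSplits-++ α₁ (λ γ → fertₛ γ 0) ⟩
        FB 0 ⊗ fert (M ∷ α₁) ⊕ tailSplits (λ γ δ → fertₛ (b ∷ β ++ γ) 0 ⊗ fert δ) (M ∷ α₁)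
          ≈⟨ ⊕-congˡ (FB 0 ⊗ fert (M ∷ α₁))
              (tailSplits-zero (λ γ δ → fertₛ (b ∷ β ++ γ) 0 ⊗ fert δ) (M ∷ α₁) vanish) ⟩
        FB 0 ⊗ fert (M ∷ α₁) ⊕ []
          ≈⟨ Poly.+-identityʳ _ ⟩
        FB 0 ⊗ fert (M ∷ α₁)
          ≈⟨ Poly.*-comm (FB 0) _ ⟩
        fert (M ∷ α₁) ⊗ FB 0 ∎
        where
        H = fertₛ (b ∷ β ++ M ∷ α₁)
        T = tailSplits (λ γ δ → fertₛ γ 0 ⊗ fert δ) (b ∷ β ++ M ∷ α₁)
        vanish : ∀ n γ δ → n ∷ γ ++ δ ≡ M ∷ α₁ → fertₛ (b ∷ β ++ n ∷ γ) 0 ⊗ fert δ ≋ []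
        vanish n γ δ refl = ⊗-congʳ (fert δ) (≋-reflexive (fertₛ-++-zero γ))

      -- Expanding both sides by `fertₛ-suc` gives three matching summands: cuts among the maxima
      -- yield E ⋆ FB, the cut right before M yields FA 0 ⊗ FB (a + 1), and cuts beyond M yield T ⋆
      -- FB.
      decompose-suc : ∀ a → (∀ i → i ≤ a → Decomposes i) → Decomposes (suc a)
      decompose-suc a IH α₁ = begin
        H (suc (suc a))
          ≈⟨ fertₛ-suc (b ∷ β ++ M ∷ α₁) (suc a) ⟩
        (increasingₛ ⋆ H) (suc a) ⊕ tailSplits (λ γ δ → fertₛ γ (suc a) ⊗ fert δ) (b ∷ β ++ M ∷ α₁)
          ≈⟨ Poly.+-cong left (tailSplits-++ α₁ (λ γ → fertₛ γ (suc a))) ⟩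
        ((E ⋆ FB) a) ⊕ (FB (suc a) ⊗ FA 0 ⊕ T′)
          ≈⟨ ⊕-congˡ ((E ⋆ FB) a) (⊕-congˡ (FB (suc a) ⊗ FA 0) right) ⟩
        ((E ⋆ FB) a) ⊕ (FB (suc a) ⊗ FA 0 ⊕ ((T ⋆ FB) a))
          ≈⟨ x∙yz≈y∙xz ((E ⋆ FB) a) (FB (suc a) ⊗ FA 0) ((T ⋆ FB) a) ⟩
        FB (suc a) ⊗ FA 0 ⊕ (((E ⋆ FB) a) ⊕ ((T ⋆ FB) a))
          ≈⟨ Poly.+-cong (Poly.*-comm (FB (suc a)) (FA 0)) (≋-sym (⋆-distribʳ FB E T a)) ⟩
        FA 0 ⊗ FB (suc a) ⊕ ((E +ₛ T) ⋆ FB) a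
          ≈⟨ ⊕-congˡ (FA 0 ⊗ FB (suc a))
               (⋆-cong {tail FA} (λ i → fertₛ-suc (M ∷ α₁) i) (λ _ → ≋-refl) a) ⟨
        (FA ⋆ FB) (suc a) ∎
        where
        H  = fertₛ (b ∷ β ++ M ∷ α₁)
        FA = fertₛ (M ∷ α₁)
        E  = increasingₛ ⋆ FA
        T : Seq
        T i = tailSplits (λ γ δ → fertₛ γ i ⊗ fert δ) (M ∷ α₁)
        T′  = tailSplits (λ γ δ → fertₛ (b ∷ β ++ γ) (suc a) ⊗ fert δ) (M ∷ α₁)
        -- The induction hypotheses as one statement on series: H agrees with z · FA · FB up to
        -- index a + 1, which is all that the convolution at a + 1 sees.
        shifted : ∀ i → i ≤ suc a → H i ≋ shift (FA ⋆ FB) i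
        shifted zero    l       = ≋-reflexive (fertₛ-++-zero α₁)
        shifted (suc i) (s≤s l) = IH i l α₁
        left : (increasingₛ ⋆ H) (suc a) ≋ (E ⋆ FB) a
        left = begin
          (increasingₛ ⋆ H) (suc a)                  ≈⟨ ⋆-comm increasingₛ H (suc a) ⟩
          (H ⋆ increasingₛ) (suc a)
            ≈⟨ ⋆-cong≤ (suc a) shifted (λ _ _ → ≋-refl) ⟩
          (shift (FA ⋆ FB) ⋆ increasingₛ) (suc a)    ≈⟨ ⋆-shiftˡ (FA ⋆ FB) increasingₛ a ⟩
          ((FA ⋆ FB) ⋆ increasingₛ) a                ≈⟨ ⋆-swapʳ FA FB increasingₛ a ⟩
          ((FA ⋆ increasingₛ) ⋆ FB) a
            ≈⟨ ⋆-cong (⋆-comm FA increasingₛ) (λ _ → ≋-refl) a ⟩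
          (E ⋆ FB) a                                 ∎
        right : T′ ≋ (T ⋆ FB) a
        right = ≋-trans
          (tailSplits-cong (λ γ δ → fertₛ (b ∷ β ++ γ) (suc a) ⊗ fert δ)
                           (λ γ δ → (fertₛ γ ⋆ FB) a ⊗ fert δ) (M ∷ α₁) pointwise)
          (splitSum-⋆ (λ γ → fertₛ (M ∷ γ)) FB fert a α₁)
          where
          pointwise : ∀ n γ δ → n ∷ γ ++ δ ≡ M ∷ α₁ →
                      fertₛ (b ∷ β ++ n ∷ γ) (suc a) ⊗ fert δ ≋ (fertₛ (n ∷ γ) ⋆ FB) a ⊗ fert δ
          pointwise n γ δ refl = ⊗-congʳ (fert δ) (IH a ℕ.≤-refl γ)

      decompose≤ : ∀ a i → i ≤ a → Decomposes i
      decompose≤ a       zero    _       = decompose-zero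
      decompose≤ (suc a) (suc i) (s≤s l) =
        decompose-suc i λ j j≤i → decompose≤ a j (ℕ.≤-trans j≤i l)

    fertₛ-++ : ∀ α₁ a → fertₛ (b ∷ β ++ M ∷ α₁) (suc a) ≋ (fertₛ (M ∷ α₁) ⋆ fertₛ (b ∷ β)) a
    fertₛ-++ α₁ a = decompose≤ a a ℕ.≤-refl α₁

-- Lagrange inversion and the Narayana numbers

module Narayana where

  open import Data.Nat using (_+_; _*_)
  open import Data.Nat.Combinatorics using (_C_)
  open import Data.List.Membership.Propositional using (_∈_)

  open import Defs using (Poly; ∑)
  open Integers
  open Polynomial
  open Series poly-semiring
  open Fertility using (X; fertₛ; increasingₛ; fertₛ-[]-suc)

  private
    absorption : ∀ n k → suc k * (suc n C suc k) ≡ suc n * (n C k)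
    absorption zero    zero    = refl
    absorption zero    (suc k) = ≡.trans
      (cong (suc (suc k) *_) (k>n⇒nCk≡0 {1} {suc (suc k)} (s≤s (s≤s z≤n))))
      (≡.trans (ℕ.*-zeroʳ (suc (suc k))) (≡.sym (cong (1 *_) (k>n⇒nCk≡0 {0} {suc k} (s≤s z≤n)))))
    absorption (suc n) zero    = begin
      1 * (suc (suc n) C 1)         ≡⟨ cong (1 *_) (nC1≡n (suc (suc n))) ⟩
      1 * suc (suc n)               ≡⟨ ℕ.*-comm 1 _ ⟩
      suc (suc n) * 1               ≡⟨ cong (suc (suc n) *_)
          (≡.trans (nCk≡nC[n∸k] {0} {suc n} z≤n) (nCn≡1 (suc n))) ⟨
      suc (suc n) * (suc n C 0)     ∎
      where open ≡.≡-Reasoning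
    absorption (suc n) (suc k) = begin
      suc (suc k) * (suc (suc n) C suc (suc k))
        ≡⟨ cong (suc (suc k) *_) (nCk+nC[k+1]≡[n+1]C[k+1] (suc n) (suc k)) ⟨
      suc (suc k) * (p + q)
        ≡⟨ expand k p q ⟩
      p + (suc k * p + suc (suc k) * q)
        ≡⟨ cong (_+_ p) (cong₂ _+_ (absorption n k) (absorption n (suc k))) ⟩
      p + (suc n * (n C k) + suc n * (n C suc k))
        ≡⟨ cong (_+_ p) (≡.trans (≡.sym (ℕ.*-distribˡ-+ (suc n) (n C k) _))
             (cong (suc n *_) (nCk+nC[k+1]≡[n+1]C[k+1] n k))) ⟩
      suc (suc n) * p ∎
      where
      open ≡.≡-Reasoning
      p = suc n C suc k
      q = suc n C suc (suc k)
      expand : ∀ k p q → suc (suc k) * (p + q) ≡ p + (suc k * p + suc (suc k) * q)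
      expand = solve-∀

    -- With u = z (x + u) (1 + u), powerCoeff k n i is the coefficient of
    -- zⁿ xⁱ in uᵏ.
    powerCoeff : ℕ → ℕ → ℕ → ℕ
    powerCoeff zero    zero    zero    = 1
    powerCoeff zero    zero    (suc i) = 0
    powerCoeff zero    (suc n) i       = 0
    powerCoeff (suc k) zero    i       = 0
    powerCoeff (suc k) (suc n) zero    = powerCoeff (suc k) n 0 + powerCoeff (suc (suc k)) n 0
    powerCoeff (suc k) (suc n) (suc i) =
      powerCoeff k n i + (powerCoeff (suc k) n (suc i) + powerCoeff (suc k) n i)
                       + powerCoeff (suc (suc k)) n (suc i)

    -- The series u is divisible by x, so its k-th power has no monomial of degree below k in x.
    powerCoeff-low : ∀ k n i → i < k → powerCoeff k n i ≡ 0
    powerCoeff-low (suc k) zero    i       l = refl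
    powerCoeff-low (suc k) (suc n) zero    l
      rewrite powerCoeff-low (suc k) n 0 (s≤s z≤n)
            | powerCoeff-low (suc (suc k)) n 0 (s≤s z≤n) = refl
    powerCoeff-low (suc k) (suc n) (suc i) (s≤s l)
      rewrite powerCoeff-low k n i l
            | powerCoeff-low (suc k) n (suc i) (s≤s l)
            | powerCoeff-low (suc k) n i (ℕ.m≤n⇒m≤1+n l)
            | powerCoeff-low (suc (suc k)) n (suc i) (s≤s (ℕ.m≤n⇒m≤1+n l)) = refl

    -- The induction step of Lagrange inversion as arithmetic. In uᵏ⁺¹ = z uᵏ (x + u) (1 + u), the
    -- terms x uᵏ, uᵏ⁺¹, x uᵏ⁺¹ and uᵏ⁺² contribute b₁, b₂, b₃ and b₄; the pairs a, a′ and c, c′ are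
    -- neighbouring binomial coefficients, and the first two hypotheses are absorption. The factor n
    -- remains on both sides because the induction hypotheses carry it.
    lagrange-step : ∀ n j k a a′ c c′ b₁ b₂ b₃ b₄ →
      (j + suc k) * (a + a′) ≡ suc n * a → j * (c + c′) ≡ suc n * c′ →
      n * b₁ ≡ k * (a * c) → n * b₂ ≡ suc k * (a′ * c) →
      n * b₃ ≡ suc k * (a * c′) → n * b₄ ≡ suc (suc k) * (a′ * c′) →
      n * (suc n * (b₁ + (b₂ + b₃) + b₄)) ≡ n * (suc k * ((a + a′) * (c + c′)))
    lagrange-step n j k a a′ c c′ b₁ b₂ b₃ b₄ r r′ e₁ e₂ e₃ e₄ = ℕ.+-cancelʳ-≡ _ _ _ (begin
      n * (suc n * (b₁ + (b₂ + b₃) + b₄)) + suc n * (a * c)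
        ≡⟨ cong (_+ suc n * (a * c)) (spread n b₁ b₂ b₃ b₄) ⟩
      suc n * (n * b₁ + (n * b₂ + n * b₃) + n * b₄) + suc n * (a * c)
        ≡⟨ cong (λ t → suc n * t + suc n * (a * c))
            (cong₂ _+_ (cong₂ _+_ e₁ (cong₂ _+_ e₂ e₃)) e₄) ⟩
      suc n * (k * (a * c) + (suc k * (a′ * c) + suc k * (a * c′)) + suc (suc k) * (a′ * c′)) +
          suc n * (a * c)
        ≡⟨ collect n k a a′ c c′ ⟩
      n * (suc k * ((a + a′) * (c + c′))) + (suc k * ((a + a′) * (c + c′)) + suc n * (a′ * c′))
        ≡⟨ cong (_+_ (n * (suc k * ((a + a′) * (c + c′))))) key ⟩
      n * (suc k * ((a + a′) * (c + c′))) + suc n * (a * c) ∎)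
      where
      open ≡.≡-Reasoning
      spread : ∀ n b₁ b₂ b₃ b₄ → n * (suc n * (b₁ + (b₂ + b₃) + b₄)) ≡
               suc n * (n * b₁ + (n * b₂ + n * b₃) + n * b₄)
      spread = solve-∀
      collect : ∀ n k a a′ c c′ →
        suc n * (k * (a * c) + (suc k * (a′ * c) + suc k * (a * c′)) + suc (suc k) * (a′ * c′)) +
            suc n * (a * c)
        ≡ n * (suc k * ((a + a′) * (c + c′))) + (suc k * ((a + a′) * (c + c′)) + suc n * (a′ * c′))
      collect = solve-∀
      split : ∀ n j k a a′ c c′ →
        (suc k * ((a + a′) * (c + c′)) + suc n * (a′ * c′)) +
            (j * (c + c′) * (a + a′) + suc n * (a * c′))
        ≡ (j + suc k) * (a + a′) * (c + c′) + (suc n * c′ * (a + a′))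
      split = solve-∀
      merge : ∀ n a a′ c c′ → suc n * a * (c + c′) + suc n * c′ * (a + a′) ≡
              suc n * (a * c) + (suc n * c′ * (a + a′) + suc n * (a * c′))
      merge = solve-∀
      -- With A = a + a′ and C = c + c′, write (k + 1) A C as (j + k + 1) A C - j A C. Absorption
      -- turns this into (n + 1) (a C - c′ A) = (n + 1) (a c - a′ c′). Subtraction is replaced by
      -- cancellation of a common summand.
      key : suc k * ((a + a′) * (c + c′)) + suc n * (a′ * c′) ≡ suc n * (a * c)
      key = ℕ.+-cancelʳ-≡ _ _ _ (begin
        (suc k * ((a + a′) * (c + c′)) + suc n * (a′ * c′)) +
            (j * (c + c′) * (a + a′) + suc n * (a * c′))
          ≡⟨ split n j k a a′ c c′ ⟩
        (j + suc k) * (a + a′) * (c + c′) + suc n * c′ * (a + a′)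
          ≡⟨ cong (λ t → t * (c + c′) + suc n * c′ * (a + a′)) r ⟩
        suc n * a * (c + c′) + suc n * c′ * (a + a′)
          ≡⟨ merge n a a′ c c′ ⟩
        suc n * (a * c) + (suc n * c′ * (a + a′) + suc n * (a * c′))
          ≡⟨ cong (λ t → suc n * (a * c) + (t * (a + a′) + suc n * (a * c′))) r′ ⟨
        suc n * (a * c) + (j * (c + c′) * (a + a′) + suc n * (a * c′)) ∎)

    pascal : ∀ n k → n C suc k + n C k ≡ suc n C suc k
    pascal n k = ≡.trans (ℕ.+-comm (n C suc k) _) (nCk+nC[k+1]≡[n+1]C[k+1] n k)

    nC0≡1 : ∀ n → n C 0 ≡ 1
    nC0≡1 n = ≡.trans (nCk≡nC[n∸k] {0} {n} z≤n) (nCn≡1 n)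

    -- Lagrange inversion: n [zⁿ] uᵏ = k [uⁿ⁻ᵏ] ((x + u) (1 + u))ⁿ
    lagrange : ∀ n k j → n * powerCoeff k n (j + k) ≡ k * ((n C (j + k)) * (n C j))
    lagrange zero    zero    j       = refl
    lagrange zero    (suc k) j
      rewrite k>n⇒nCk≡0 {0} {j + suc k} (ℕ.≤-trans (s≤s z≤n) (ℕ.m≤n+m (suc k) j)) =
      ≡.sym (ℕ.*-zeroʳ (suc k))
    lagrange (suc n) zero    j       = ℕ.*-zeroʳ (suc n)
    -- At exponent 1 of z the induction is of no help: the statement for exponent 0 is multiplied by
    -- 0 and does not determine the coefficients.
    lagrange (suc zero) (suc zero) zero = refl
    lagrange (suc zero) (suc zero) (suc j)
      rewrite k>n⇒nCk≡0 {1} {suc j + 1} (s≤s (ℕ.m≤n+m 1 j)) | ℕ.+-comm j 1 = refl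
    lagrange (suc zero) (suc (suc k)) j
      rewrite k>n⇒nCk≡0 {1} {j + suc (suc k)} (ℕ.≤-trans (s≤s (s≤s z≤n)) (ℕ.m≤n+m (suc (suc k)) j))
            | ℕ.+-suc j (suc k) = ≡.sym (ℕ.*-zeroʳ (suc (suc k)))
    -- Here c′ would be C(n, -1) and is read as 0; accordingly b₃ and b₄ vanish, as their degree in
    -- x is too low.
    lagrange (suc n@(suc _)) (suc k) zero = ℕ.*-cancelˡ-≡ _ _ n (begin
      n * (suc n * powerCoeff (suc k) (suc n) (suc k))
        ≡⟨ lagrange-step n 0 k (n C k) (n C suc k) (n C 0) 0 _ _ _ _
             (≡.trans (cong (suc k *_) (nCk+nC[k+1]≡[n+1]C[k+1] n k)) (absorption n k))
             (≡.sym (ℕ.*-zeroʳ (suc n)))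
             (lagrange n k 0) (lagrange n (suc k) 0)
             (low (suc k) (n C k) (powerCoeff-low (suc k) n k ℕ.≤-refl))
             (low (suc (suc k)) (n C suc k) (powerCoeff-low (suc (suc k)) n (suc k) ℕ.≤-refl)) ⟩
      n * (suc k * ((n C k + n C suc k) * (n C 0 + 0)))
        ≡⟨ cong₂ (λ s t → n * (suc k * (s * t))) (nCk+nC[k+1]≡[n+1]C[k+1] n k)
             (≡.trans (ℕ.+-identityʳ _) (≡.trans (nC0≡1 n) (≡.sym (nC0≡1 (suc n))))) ⟩
      n * (suc k * ((suc n C suc k) * (suc n C 0))) ∎)
      where
      open ≡.≡-Reasoning
      low : ∀ k′ a {b} → b ≡ 0 → n * b ≡ k′ * (a * 0)
      low k′ a refl rewrite ℕ.*-zeroʳ a | ℕ.*-zeroʳ k′ = ℕ.*-zeroʳ n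
    lagrange (suc n@(suc _)) (suc k) (suc j) = ℕ.*-cancelˡ-≡ _ _ n (begin
      n * (suc n * powerCoeff (suc k) (suc n) (suc j + suc k))
        ≡⟨ lagrange-step n (suc j) k (n C i) (n C suc i) (n C suc j) (n C j) _ _ _ _
             (≡.trans (cong (suc i *_) (nCk+nC[k+1]≡[n+1]C[k+1] n i)) (absorption n i))
             (≡.trans (cong (suc j *_) (pascal n j)) (absorption n j))
             (≡.subst (λ t → n * powerCoeff k n t ≡ k * ((n C t) * (n C suc j)))
                 (≡.sym (ℕ.+-suc j k))
                (lagrange n k (suc j)))
             (lagrange n (suc k) (suc j))
             (lagrange n (suc k) j)
             (≡.subst (λ t → n * powerCoeff (suc (suc k)) n t ≡ suc (suc k) * ((n C t) * (n C j)))
                (ℕ.+-suc j (suc k)) (lagrange n (suc (suc k)) j)) ⟩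
      n * (suc k * ((n C i + n C suc i) * (n C suc j + n C j)))
        ≡⟨ cong₂ (λ s t → n * (suc k * (s * t))) (nCk+nC[k+1]≡[n+1]C[k+1] n i) (pascal n j) ⟩
      n * (suc k * ((suc n C suc i) * (suc n C suc j))) ∎)
      where
      open ≡.≡-Reasoning
      i = j + suc k

    u : Seq
    u zero    = []
    u (suc a) = fertₛ [] (suc a)

    Xₛ : Seq
    Xₛ zero    = X
    Xₛ (suc _) = []

    infixr 8 u^_
    u^_ : ℕ → Seq
    u^ zero    = 1ₛ
    u^ (suc k) = u ⋆ u^ k

    module _ where
      open import Relation.Binary.Reasoning.Setoid Poly.setoid

      increasing≋1+u : ∀ n → increasingₛ n ≋ (1ₛ +ₛ u) n
      increasing≋1+u zero    = ≋-sym (Poly.+-identityʳ (1ℚ ∷ []))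
      increasing≋1+u (suc n) = ≋-refl

      fert≋X+u : ∀ n → fertₛ [] n ≋ (Xₛ +ₛ u) n
      fert≋X+u zero    = ≋-sym (Poly.+-identityʳ X)
      fert≋X+u (suc n) = ≋-refl

      X⋆ : ∀ p n → (Xₛ ⋆ p) n ≋ X ⊗ p n
      X⋆ p zero    = ≋-refl
      X⋆ p (suc n) = ≋-trans
        (⊕-congˡ (X ⊗ p (suc n)) (≋-trans (⋆-cong tailX (λ _ → ≋-refl) n) (⋆-zeroˡ p n)))
        (Poly.+-identityʳ (X ⊗ p (suc n)))
        where
        tailX : ∀ i → Xₛ (suc i) ≋ 0ₛ i
        tailX i = ≋-refl

      -- The equation of u multiplied by p, with the four summands bracketed as in the recursion of
      -- `powerCoeff`.
      u⋆-suc : ∀ p n → (u ⋆ p) (suc n) ≋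
               (X ⊗ p n ⊕ ((u ⋆ p) n ⊕ X ⊗ (u ⋆ p) n)) ⊕ (u ⋆ (u ⋆ p)) n
      u⋆-suc p n = begin
        (tail u ⋆ p) n
          ≈⟨ ⋆-cong {tail u} (λ i → ≋-trans (fertₛ-[]-suc i) (⋆-cong increasing≋1+u fert≋X+u i))
                    (λ _ → ≋-refl) n ⟩
        (((1ₛ +ₛ u) ⋆ F) ⋆ p) n
          ≈⟨ ⋆-cong (⋆-distribʳ F 1ₛ u) (λ _ → ≋-refl) n ⟩
        (((1ₛ ⋆ F) +ₛ (u ⋆ F)) ⋆ p) n
          ≈⟨ ⋆-distribʳ p (1ₛ ⋆ F) (u ⋆ F) n ⟩
        ((1ₛ ⋆ F) ⋆ p) n ⊕ ((u ⋆ F) ⋆ p) n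
          ≈⟨ Poly.+-cong (⋆-cong (⋆-identityˡ F) (λ _ → ≋-refl) n)
                         (≋-trans (⋆-swapʳ u F p n) (⋆-comm (u ⋆ p) F n)) ⟩
        (F ⋆ p) n ⊕ (F ⋆ (u ⋆ p)) n
          ≈⟨ Poly.+-cong (⋆-distribʳ p Xₛ u n) (⋆-distribʳ (u ⋆ p) Xₛ u n) ⟩
        ((Xₛ ⋆ p) n ⊕ (u ⋆ p) n) ⊕ ((Xₛ ⋆ (u ⋆ p)) n ⊕ (u ⋆ (u ⋆ p)) n)
          ≈⟨ Poly.+-cong (⊕-congʳ ((u ⋆ p) n) (X⋆ p n))
                         (⊕-congʳ ((u ⋆ (u ⋆ p)) n) (X⋆ (u ⋆ p) n)) ⟩
        (X ⊗ p n ⊕ (u ⋆ p) n) ⊕ (X ⊗ (u ⋆ p) n ⊕ (u ⋆ (u ⋆ p)) n)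
          ≈⟨ Poly.+-assoc (X ⊗ p n ⊕ (u ⋆ p) n) (X ⊗ (u ⋆ p) n) ((u ⋆ (u ⋆ p)) n) ⟨
        ((X ⊗ p n ⊕ (u ⋆ p) n) ⊕ X ⊗ (u ⋆ p) n) ⊕ (u ⋆ (u ⋆ p)) n
          ≈⟨ ⊕-congʳ ((u ⋆ (u ⋆ p)) n) (Poly.+-assoc (X ⊗ p n) ((u ⋆ p) n) (X ⊗ (u ⋆ p) n)) ⟩
        (X ⊗ p n ⊕ ((u ⋆ p) n ⊕ X ⊗ (u ⋆ p) n)) ⊕ (u ⋆ (u ⋆ p)) n ∎
        where F = Xₛ +ₛ u

    abstract
      ι : ℕ → ℚ
      ι n = + n / 1

      ι-def : ∀ n → ι n ≡ + n / 1
      ι-def n = refl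

      ι-+ : ∀ m n → ι (m + n) ≡ ι m ℚ.+ ι n
      ι-+ m n = /1-+ (+ m) (+ n)

      ι-* : ∀ m n → ι (m * n) ≡ ι m ℚ.* ι n
      ι-* m n = ≡.trans (cong (_/ 1) (ℤ.pos-* m n)) (/1-* (+ m) (+ n))

      ι0≡0 : ι 0 ≡ 0ℚ
      ι0≡0 = refl

      ι1≡1 : ι 1 ≡ 1ℚ
      ι1≡1 = refl

      unit : ℕ → ℚ
      unit n = + 1 / suc n

      unit-def : ∀ n → unit n ≡ + 1 / suc n
      unit-def n = refl

      unit-inverse : ∀ n → unit n ℚ.* ι (suc n) ≡ 1ℚ
      unit-inverse n = 1/n*n≡1 (suc n)

    coeff-X⊗-zero : ∀ p → coeff (X ⊗ p) 0 ≡ 0ℚ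
    coeff-X⊗-zero p = ≡.trans (coeff-⊗ X p 0) (ℚ.*-zeroˡ (coeff p 0))

    coeff-X⊗-suc : ∀ p i → coeff (X ⊗ p) (suc i) ≡ coeff p i
    coeff-X⊗-suc p i = begin
      coeff (X ⊗ p) (suc i)
        ≡⟨ coeff-⊕ (map (0ℚ ℚ.*_) p) (0ℚ ∷ (1ℚ ∷ []) ⊗ p) (suc i) ⟩
      coeff (map (0ℚ ℚ.*_) p) (suc i) ℚ.+ coeff ((1ℚ ∷ []) ⊗ p) i
        ≡⟨ cong₂ ℚ._+_ (≡.trans (coeff-map 0ℚ p (suc i)) (ℚ.*-zeroˡ (coeff p (suc i))))
            (at (Poly.*-identityˡ p) i) ⟩
      0ℚ ℚ.+ coeff p i
        ≡⟨ ℚ.+-identityˡ _ ⟩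
      coeff p i ∎
      where open ≡.≡-Reasoning

    coeff-u^ : ∀ k n i → coeff ((u^ k) n) i ≡ ι (powerCoeff k n i)
    coeff-u^ zero    zero    zero    = ≡.sym ι1≡1
    coeff-u^ zero    zero    (suc i) = ≡.sym ι0≡0
    coeff-u^ zero    (suc n) i       = ≡.sym ι0≡0
    coeff-u^ (suc k) zero    i       = ≡.sym ι0≡0
    coeff-u^ (suc k) (suc n) i       = ≡.trans (at (u⋆-suc (u^ k) n) i)
        (≡.trans (expand i) (step i))
      where
      p q r : Poly
      p = (u^ k) n
      q = (u^ suc k) n
      r = (u^ suc (suc k)) n
      expand : ∀ i → coeff ((X ⊗ p ⊕ (q ⊕ X ⊗ q)) ⊕ r) i ≡
               (coeff (X ⊗ p) i ℚ.+ (coeff q i ℚ.+ coeff (X ⊗ q) i)) ℚ.+ coeff r i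
      expand i = ≡.trans (coeff-⊕ (X ⊗ p ⊕ (q ⊕ X ⊗ q)) r i) (cong (ℚ._+ coeff r i)
        (≡.trans (coeff-⊕ (X ⊗ p) (q ⊕ X ⊗ q) i)
            (cong (coeff (X ⊗ p) i ℚ.+_) (coeff-⊕ q (X ⊗ q) i))))
      step : ∀ i → (coeff (X ⊗ p) i ℚ.+ (coeff q i ℚ.+ coeff (X ⊗ q) i)) ℚ.+ coeff r i ≡
             ι (powerCoeff (suc k) (suc n) i)
      step zero = begin
        (coeff (X ⊗ p) 0 ℚ.+ (coeff q 0 ℚ.+ coeff (X ⊗ q) 0)) ℚ.+ coeff r 0
          ≡⟨ cong₂ ℚ._+_ (cong₂ ℚ._+_ (coeff-X⊗-zero p)
               (cong₂ ℚ._+_ (coeff-u^ (suc k) n 0) (coeff-X⊗-zero q)))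
                   (coeff-u^ (suc (suc k)) n 0) ⟩
        (0ℚ ℚ.+ (ι b₂ ℚ.+ 0ℚ)) ℚ.+ ι b₄
          ≡⟨ cong (ℚ._+ ι b₄) (≡.trans (ℚ.+-identityˡ (ι b₂ ℚ.+ 0ℚ)) (ℚ.+-identityʳ (ι b₂))) ⟩
        ι b₂ ℚ.+ ι b₄
          ≡⟨ ι-+ b₂ b₄ ⟨
        ι (b₂ + b₄) ∎
        where
        open ≡.≡-Reasoning
        b₂ = powerCoeff (suc k) n 0
        b₄ = powerCoeff (suc (suc k)) n 0
      step (suc i) = begin
        (coeff (X ⊗ p) (suc i) ℚ.+ (coeff q (suc i) ℚ.+ coeff (X ⊗ q) (suc i))) ℚ.+ coeff r (suc i)
          ≡⟨ cong₂ ℚ._+_ (cong₂ ℚ._+_ (≡.trans (coeff-X⊗-suc p i) (coeff-u^ k n i))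
               (cong₂ ℚ._+_ (coeff-u^ (suc k) n (suc i))
                            (≡.trans (coeff-X⊗-suc q i) (coeff-u^ (suc k) n i))))
               (coeff-u^ (suc (suc k)) n (suc i)) ⟩
        (ι b₁ ℚ.+ (ι b₂ ℚ.+ ι b₃)) ℚ.+ ι b₄
          ≡⟨ cong (λ t → (ι b₁ ℚ.+ t) ℚ.+ ι b₄) (ι-+ b₂ b₃) ⟨
        (ι b₁ ℚ.+ ι (b₂ + b₃)) ℚ.+ ι b₄
          ≡⟨ cong (ℚ._+ ι b₄) (ι-+ b₁ (b₂ + b₃)) ⟨
        ι (b₁ + (b₂ + b₃)) ℚ.+ ι b₄
          ≡⟨ ι-+ (b₁ + (b₂ + b₃)) b₄ ⟨
        ι (b₁ + (b₂ + b₃) + b₄) ∎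
        where
        open ≡.≡-Reasoning
        b₁ = powerCoeff k n i
        b₂ = powerCoeff (suc k) n (suc i)
        b₃ = powerCoeff (suc k) n i
        b₄ = powerCoeff (suc (suc k)) n (suc i)

    coeff-monomial-same : ∀ c i → coeff (monomial c i) i ≡ c
    coeff-monomial-same c zero    = refl
    coeff-monomial-same c (suc i) = coeff-monomial-same c i

    coeff-monomial-other : ∀ c i m → m ≢ i → coeff (monomial c i) m ≡ 0ℚ
    coeff-monomial-other c zero    zero    m≢i = contradiction refl m≢i
    coeff-monomial-other c zero    (suc m) m≢i = refl
    coeff-monomial-other c (suc i) zero    m≢i = refl
    coeff-monomial-other c (suc i) (suc m) m≢i = coeff-monomial-other c i m (m≢i ∘ cong suc)

    module _ (c : ℕ → ℚ) where

      P : List ℕ → Poly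
      P is = ∑ is λ i → monomial (c i) i

      coeff-∉ : ∀ {m} is → All (m ≢_) is → coeff (P is) m ≡ 0ℚ
      coeff-∉ []       []         = refl
      coeff-∉ {m} (i ∷ is) (m≢i ∷ m∉) = ≡.trans (coeff-⊕ (monomial (c i) i) (P is) m)
        (cong₂ ℚ._+_ (coeff-monomial-other (c i) i m m≢i) (coeff-∉ is m∉))

      coeff-∈ : ∀ {m} is → Unique is → m ∈ is → coeff (P is) m ≡ c m
      coeff-∈ {m} (i ∷ is) (i∉ ∷ _) (here refl) = ≡.trans (coeff-⊕ (monomial (c i) i) (P is) i)
        (≡.trans (cong₂ ℚ._+_ (coeff-monomial-same (c i) i) (coeff-∉ is i∉)) (ℚ.+-identityʳ (c i)))
      coeff-∈ {m} (i ∷ is) (i∉ ∷ un) (there m∈) = ≡.trans (coeff-⊕ (monomial (c i) i) (P is) m)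
        (≡.trans (cong₂ ℚ._+_
                   (coeff-monomial-other (c i) i m λ { refl → All.lookup i∉ m∈ refl })
                   (coeff-∈ is un m∈))
                 (ℚ.+-identityˡ (c m)))

    narayanaCoeff : ℕ → ℕ → ℚ
    narayanaCoeff n i = unit n ℚ.* ι (suc n C i) ℚ.* ι (suc n C (i ∸ 1))

    narayana-≋ : ∀ n → narayana (suc n) ≋ P (narayanaCoeff n) (map suc (upTo (suc n)))
    narayana-≋ n = ∑-cong (map suc (upTo (suc n))) λ {i} _ →
      ≋-reflexive (cong (λ c → monomial c i) (≡.sym
        (cong₂ ℚ._*_ (cong₂ ℚ._*_ (unit-def n) (ι-def (suc n C i))) (ι-def (suc n C (i ∸ 1))))))

    coeff-narayana-zero : ∀ n → coeff (narayana (suc n)) 0 ≡ 0ℚ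
    coeff-narayana-zero n = ≡.trans (at (narayana-≋ n) 0)
      (coeff-∉ (narayanaCoeff n) (map suc (upTo (suc n))) (All.map⁺ (All.tabulate λ _ ())))

    coeff-narayana-suc : ∀ n j → coeff (narayana (suc n)) (suc j) ≡ narayanaCoeff n (suc j)
    coeff-narayana-suc n j with j ℕ.<? suc n
    ... | yes j<n = ≡.trans (at (narayana-≋ n) (suc j))
      (coeff-∈ (narayanaCoeff n) (map suc (upTo (suc n)))
        (Unique.map⁺ ℕ.suc-injective (Unique.upTo⁺ (suc n))) (∈.∈-map⁺ suc (∈.∈-upTo⁺ j<n)))
    ... | no  j≮n = ≡.trans (at (narayana-≋ n) (suc j)) (≡.trans
      (coeff-∉ (narayanaCoeff n) (map suc (upTo (suc n))) (All.map⁺ (All.tabulate λ k∈ eq →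
        j≮n (≡.subst (_< suc n) (≡.sym (ℕ.suc-injective eq)) (∈.∈-upTo⁻ k∈)))))
      (≡.sym (≡.trans
        (cong (λ t → unit n ℚ.* t ℚ.* ι (suc n C j))
              (≡.trans (cong ι (k>n⇒nCk≡0 (s≤s (ℕ.≮⇒≥ j≮n)))) ι0≡0))
        (≡.trans (cong (ℚ._* ι (suc n C j)) (ℚ.*-zeroʳ (unit n))) (ℚ.*-zeroˡ (ι (suc n C j)))))))

  -- Lagrange inversion for the first power of u makes n + 1 times the coefficient a product of two
  -- binomial coefficients; division by n + 1 yields the Narayana number.
  fert-increasing : ∀ n → fertₛ [] (suc n) ≋ narayana (suc n)
  fert-increasing n = coeffwise λ i → ≡.trans (at u≋u¹ i)
      (≡.trans (coeff-u^ 1 (suc n) i) (compare i))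
    where
    u≋u¹ : u (suc n) ≋ (u^ 1) (suc n)
    u≋u¹ = ≋-sym (≋-trans (⋆-comm u 1ₛ (suc n)) (⋆-identityˡ u (suc n)))
    compare : ∀ i → ι (powerCoeff 1 (suc n) i) ≡ coeff (narayana (suc n)) i
    compare zero = ≡.trans (cong ι (powerCoeff-low 1 (suc n) 0 (s≤s z≤n)))
      (≡.trans ι0≡0 (≡.sym (coeff-narayana-zero n)))
    compare (suc j) = ≡.trans (begin
      ι b                                             ≡⟨ ℚ.*-identityˡ (ι b) ⟨
      1ℚ ℚ.* ι b                                      ≡⟨ cong (ℚ._* ι b) (unit-inverse n) ⟨
      unit n ℚ.* ι (suc n) ℚ.* ι b                    ≡⟨ ℚ.*-assoc (unit n) _ _ ⟩
      unit n ℚ.* (ι (suc n) ℚ.* ι b)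
        ≡⟨ cong (unit n ℚ.*_) (≡.trans (≡.sym (ι-* (suc n) b)) (cong ι eq)) ⟩
      unit n ℚ.* ι ((suc n C suc j) * (suc n C j))
        ≡⟨ cong (unit n ℚ.*_) (ι-* (suc n C suc j) (suc n C j)) ⟩
      unit n ℚ.* (ι (suc n C suc j) ℚ.* ι (suc n C j))
        ≡⟨ ℚ.*-assoc (unit n) _ _ ⟨
      unit n ℚ.* ι (suc n C suc j) ℚ.* ι (suc n C j)  ∎)
      (≡.sym (coeff-narayana-suc n j))
      where
      open ≡.≡-Reasoning
      b = powerCoeff 1 (suc n) (suc j)
      eq : suc n * b ≡ (suc n C suc j) * (suc n C j)
      eq = ≡.trans (≡.subst (λ t → suc n * powerCoeff 1 (suc n) t ≡ 1 * ((suc n C t) * (suc n C j)))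
                      (ℕ.+-comm j 1) (lagrange (suc n) 1 j))
                   (ℕ.*-identityˡ _)

-- The fibres of the stack-sorting map

module Preimages where

  open import Data.List.Membership.Propositional using (_∈_)

  open import Defs using (Poly; ∑)
  open Polynomial
  open Fertility

  splitConcat : (List ℕ → List ℕ → List (List ℕ)) → List ℕ → List (List ℕ)
  splitConcat f []      = f [] []
  splitConcat f (n ∷ w) = f [] (n ∷ w) ++ splitConcat (λ β α → f (n ∷ β) α) w

  ∑-splitConcat : ∀ f {g} h w → (∀ β α → β ++ α ≡ w → ∑ (f β α) h ≋ g β α) →
                  ∑ (splitConcat f w) h ≋ splitSum g w
  ∑-splitConcat f h []      e = e [] [] refl
  ∑-splitConcat f h (n ∷ w) e = ≋-trans (∑-++ (f [] (n ∷ w)) _ h) (Poly.+-cong (e [] (n ∷ w) refl)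
    (∑-splitConcat _ h w λ β α eq → e (n ∷ β) α (cong (n ∷_) eq)))

  ∈-splitConcat⁻ : ∀ f w {σ} → σ ∈ splitConcat f w → ∃[ β ] ∃[ α ] (β ++ α ≡ w × σ ∈ f β α)
  ∈-splitConcat⁻ f []      σ∈ = [] , [] , refl , σ∈
  ∈-splitConcat⁻ f (n ∷ w) σ∈ with ∈.∈-++⁻ (f [] (n ∷ w)) σ∈
  ... | inj₁ σ∈₁ = [] , n ∷ w , refl , σ∈₁
  ... | inj₂ σ∈₂ with β , α , refl , σ∈ ← ∈-splitConcat⁻ _ w σ∈₂ = n ∷ β , α , refl , σ∈

  ∈-splitConcat⁺ : ∀ f β α {σ} → σ ∈ f β α → σ ∈ splitConcat f (β ++ α)
  ∈-splitConcat⁺ f []      []      σ∈ = σ∈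
  ∈-splitConcat⁺ f []      (n ∷ α) σ∈ = ∈.∈-++⁺ˡ σ∈
  ∈-splitConcat⁺ f (n ∷ β) α       σ∈ = ∈.∈-++⁺ʳ (f [] (n ∷ β ++ α)) (∈-splitConcat⁺ _ β α σ∈)

  splitConcat-unique : ∀ f w → (∀ β α → β ++ α ≡ w → Unique (f β α)) →
    (∀ β α β′ α′ → β ++ α ≡ w → β′ ++ α′ ≡ w → ∀ {σ} → σ ∈ f β α → σ ∈ f β′ α′ → β ≡ β′) →
    Unique (splitConcat f w)
  splitConcat-unique f []      u d = u [] [] refl
  splitConcat-unique f (n ∷ w) u d = Unique.++⁺ (u [] (n ∷ w) refl)
    (splitConcat-unique _ w
      (λ β α eq → u (n ∷ β) α (cong (n ∷_) eq))
      (λ β α β′ α′ eq eq′ σ∈ σ∈′ → ∷-injectiveʳ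
        (d (n ∷ β) α (n ∷ β′) α′ (cong (n ∷_) eq) (cong (n ∷_) eq′) σ∈ σ∈′)))
    disjoint
    where
    disjoint : Disjoint (f [] (n ∷ w)) (splitConcat (λ β α → f (n ∷ β) α) w)
    disjoint (σ∈ , σ∈′) with β , α , eq , σ∈″ ← ∈-splitConcat⁻ _ w σ∈′ =
      contradiction (d [] (n ∷ w) (n ∷ β) α refl (cong (n ∷_) eq) σ∈ σ∈″) λ ()

  productWith-unique : ∀ {A B C : Set} (_∙_ : A → B → C) xs ys →
    (∀ {x x′ y y′} → x ∈ xs → x′ ∈ xs → x ∙ y ≡ x′ ∙ y′ → x ≡ x′ × y ≡ y′) →
    Unique xs → Unique ys → Unique (cartesianProductWith _∙_ xs ys)
  productWith-unique _∙_ []       ys inj ux        uy = []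
  productWith-unique _∙_ (x ∷ xs) ys inj (x∉ ∷ ux) uy = Unique.++⁺
    (Unique.map⁺ (λ eq → proj₂ (inj (here refl) (here refl) eq)) uy)
    (productWith-unique _∙_ xs ys (λ x∈ x′∈ → inj (there x∈) (there x′∈)) ux uy)
    disjoint
    where
    disjoint : Disjoint (map (x ∙_) ys) (cartesianProductWith _∙_ xs ys)
    disjoint (z∈ , z∈′)
      with y , _ , refl ← ∈.∈-map⁻ (x ∙_) z∈
      with x′ , y′ , x′∈ , _ , eq ← ∈.∈-cartesianProductWith⁻ _∙_ xs ys z∈′ =
      All.lookup x∉ x′∈ (proj₁ (inj (here refl) (there x′∈) eq))

  data MaxView : List ℕ → Set where
    []   : MaxView []
    node : ∀ L m R → All (_< m) L → All (_< m) R → MaxView (L ++ m ∷ R)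

  maxView : ∀ {w} → Unique w → MaxView w
  maxView {[]}    _        = []
  maxView {x ∷ w} (x∉ ∷ u) with maxView u
  ... | [] = node [] x [] [] []
  ... | node L m R L<m R<m with ℕ.<-cmp x m
  ...   | tri< x<m _ _ = node (x ∷ L) m R (x<m ∷ L<m) R<m
  ...   | tri≈ _ x≡m _ = contradiction x≡m (All.lookup x∉ (∈.∈-insert L))
  ...   | tri> _ _ m<x = node [] x (L ++ m ∷ R) []
          (All.++⁺ (All.map (λ l → ℕ.<-trans l m<x) L<m)
              (m<x ∷ All.map (λ l → ℕ.<-trans l m<x) R<m))

  unique-↭ : {v w : List ℕ} → v ↭ w → Unique v → Unique w
  unique-↭ = ↭ₛ.Unique-resp-↭ (≡.setoid ℕ) ∘ ↭.↭⇒↭ₛ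

  isPermutation-↭ : ∀ {v w} → v ↭ w → IsPermutation v → IsPermutation w
  isPermutation-↭ p (pos , u) = ↭.All-resp-↭ p pos , unique-↭ p u

  ++-unique⁻ : ∀ (v : List ℕ) {w} → Unique (v ++ w) → Unique v × Unique w
  ++-unique⁻ []      u        = [] , u
  ++-unique⁻ (x ∷ v) (x∉ ∷ u) = let uv , uw = ++-unique⁻ v u in All.++⁻ˡ v x∉ ∷ uv , uw

  stackSort-↭ : ∀ {σ} → Unique σ → stackSort σ ↭ σ
  stackSort-↭ {σ} = go (length σ) ℕ.≤-refl
    where
    go : ∀ d {σ} → length σ ≤ d → Unique σ → stackSort σ ↭ σ
    go d l u with maxView u
    go d       l u | [] = ↭.refl
    go zero    l u | node []      m R _ _ = contradiction l λ ()
    go zero    l u | node (_ ∷ _) m R _ _ = contradiction l λ ()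
    go (suc d) l u | node L m R L<m R<m
      with uL , _ ∷ uR ← ++-unique⁻ L u
      rewrite stackSort-split L R L<m R<m | length-++ L {m ∷ R} | ℕ.+-suc (length L) (length R) =
      ↭.++⁺ (go d (ℕ.≤-trans (ℕ.m≤m+n _ _) (ℕ.s≤s⁻¹ l)) uL)
            (↭-trans (↭.++⁺ʳ [ m ] (go d (ℕ.≤-trans (ℕ.m≤n+m _ (length L)) (ℕ.s≤s⁻¹ l)) uR))
                     (↭.++-comm R [ m ]))

  desBelow : List ℕ → ℕ
  desBelow []      = 0
  desBelow (x ∷ R) = suc (des (x ∷ R))

  -- The step up to the maximum n is never a descent, and the step down from it always is one, if
  -- there is such a step.
  des-++-∷ : ∀ L {n} R → All (_< n) L → All (_< n) R → des (L ++ n ∷ R) ≡ des L ℕ.+ desBelow R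
  des-++-∷ []          []      _         _         = refl
  des-++-∷ []      {n} (x ∷ R) _         (x<n ∷ _) rewrite dec-true (x ℕ.<? n) x<n = refl
  des-++-∷ (x ∷ []) {n} R      (x<n ∷ _) R<n
    rewrite dec-false (n ℕ.<? x) (ℕ.<-asym x<n) = des-++-∷ [] R [] R<n
  des-++-∷ (x ∷ y ∷ L) R       (_ ∷ L<n) R<n with does (y ℕ.<? x)
  ... | true  = cong suc (des-++-∷ (y ∷ L) R L<n R<n)
  ... | false = des-++-∷ (y ∷ L) R L<n R<n

  weight : List ℕ → Poly
  weight σ = monomial 1ℚ (suc (des σ))

  coeff-monomial-suc-⊗ : ∀ i p n → coeff (monomial 1ℚ (suc i) ⊗ p) (suc n) ≡ coeff
      (monomial 1ℚ i ⊗ p) n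
  coeff-monomial-suc-⊗ i p n = ≡.trans
    (coeff-⊕ (map (0ℚ ℚ.*_) p) (0ℚ ∷ monomial 1ℚ i ⊗ p) (suc n))
    (≡.trans (cong (ℚ._+ coeff (monomial 1ℚ i ⊗ p) n)
               (≡.trans (coeff-map 0ℚ p (suc n)) (ℚ.*-zeroˡ (coeff p (suc n)))))
             (ℚ.+-identityˡ _))

  monomial-⊗ : ∀ i j → monomial 1ℚ i ⊗ monomial 1ℚ j ≋ monomial 1ℚ (i ℕ.+ j)
  monomial-⊗ zero    j = Poly.*-identityˡ (monomial 1ℚ j)
  monomial-⊗ (suc i) j = coeffwise λ where
    zero    → ≡.trans (coeff-⊗ (monomial 1ℚ (suc i)) (monomial 1ℚ j) 0)
        (ℚ.*-zeroˡ (coeff (monomial 1ℚ j) 0))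
    (suc n) → ≡.trans (coeff-monomial-suc-⊗ i (monomial 1ℚ j) n) (at (monomial-⊗ i j) n)

  -- The exponent is des + 1, so the additional 1 of a nonempty R accounts for the descent after n.
  -- With R empty that descent is absent, and the factor is 1.
  weight-++-∷ : ∀ L {n} R → All (_< n) L → All (_< n) R →
                weight (L ++ n ∷ R) ≋ weight L ⊗ orOne weight R
  weight-++-∷ L {n} R L<n R<n rewrite des-++-∷ L R L<n R<n with R
  ... | []     rewrite ℕ.+-identityʳ (des L) = ≋-sym (Poly.*-identityʳ (weight L))
  ... | x ∷ R′ = ≋-sym (monomial-⊗ (suc (des L)) (suc (des (x ∷ R′))))

  -- Reads s(L n R) = s(L) s(R) n backwards: n is the head of the reversed image, and for each cut R
  -- ranges over the preimages of β and L over those of α.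
  preimages : ℕ → List ℕ → List (List ℕ)
  preimages zero    _       = [ [] ]
  preimages (suc d) []      = [ [] ]
  preimages (suc d) (n ∷ w) = if does (all? (ℕ._<? n) w)
    then splitConcat (λ β α → cartesianProductWith (λ L R → L ++ n ∷ R) (preimages d α)
        (preimages d β)) w
    else []

  private
    ++-bounds : ∀ (β α : List ℕ) {w d} → β ++ α ≡ w → length w ≤ d → length β ≤ d × length α ≤ d
    ++-bounds β α refl l rewrite length-++ β {α} =
      ℕ.≤-trans (ℕ.m≤m+n _ _) l , ℕ.≤-trans (ℕ.m≤n+m _ (length β)) l

  preimages-[] : ∀ d → preimages d [] ≡ [ [] ]
  preimages-[] zero    = refl
  preimages-[] (suc d) = refl

  preimages-↭ : ∀ d w → length w ≤ d → ∀ {σ} → σ ∈ preimages d w → σ ↭ w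
  preimages-↭ zero    []      l (here refl) = ↭.refl
  preimages-↭ (suc d) []      l (here refl) = ↭.refl
  preimages-↭ (suc d) (n ∷ w) (s≤s l) σ∈ with all? (ℕ._<? n) w
  ... | yes _
    with β , α , refl , σ∈′ ← ∈-splitConcat⁻ _ w σ∈
    with L , R , L∈ , R∈ , refl ← ∈.∈-cartesianProductWith⁻ _ (preimages d α) (preimages d β) σ∈′ =
    let β≤ , α≤ = ++-bounds β α refl l
    in ↭-trans (↭.shift n L R) (prep n (↭-trans (↭.++-comm L R)
         (↭.++⁺ (preimages-↭ d β β≤ R∈) (preimages-↭ d α α≤ L∈))))

  ∑-preimages : ∀ d w → length w ≤ d → ∑ (preimages d w) weight ≋ fertUpTo d w
  ∑-preimages zero    w       l = Poly.+-identityʳ X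
  ∑-preimages (suc d) []      l = Poly.+-identityʳ X
  ∑-preimages (suc d) (n ∷ w) (s≤s l) with all? (ℕ._<? n) w
  ... | no  _   = ≋-refl
  ... | yes w<n = ∑-splitConcat _ weight w term
    where
    orOne-∑ : ∀ β → length β ≤ d → ∑ (preimages d β) (orOne weight) ≋ orOne (fertUpTo d) β
    orOne-∑ []        β≤ rewrite preimages-[] d = Poly.+-identityʳ (1ℚ ∷ [])
    orOne-∑ β@(x ∷ _) β≤ = ≋-trans (∑-cong (preimages d β) nonempty) (∑-preimages d β β≤)
      where
      nonempty : ∀ {R} → R ∈ preimages d β → orOne weight R ≋ weight R
      nonempty {[]}    R∈ = contradiction (↭.↭-length (preimages-↭ d β β≤ R∈)) λ ()
      nonempty {_ ∷ _} R∈ = ≋-refl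
    term : ∀ β α → β ++ α ≡ w →
      ∑ (cartesianProductWith (λ L R → L ++ n ∷ R) (preimages d α) (preimages d β)) weight ≋
      orOne (fertUpTo d) β ⊗ fertUpTo d α
    term β α refl =
      let β≤ , α≤ = ++-bounds β α refl l
      in ≋-trans (∑-products _ (preimages d α) (preimages d β) {weight} {orOne weight}
           (λ {L} {R} L∈ R∈ → weight-++-∷ L R
             (↭.All-resp-↭ (↭-sym (preimages-↭ d α α≤ L∈)) (All.++⁻ʳ β w<n))
             (↭.All-resp-↭ (↭-sym (preimages-↭ d β β≤ R∈)) (All.++⁻ˡ β w<n))))
         (≋-trans (Poly.*-cong (∑-preimages d α α≤) (orOne-∑ β β≤))
                  (Poly.*-comm (fertUpTo d α) (orOne (fertUpTo d) β)))

  stackSort-preimages : ∀ d w → length w ≤ d → ∀ {σ} → σ ∈ preimages d w → stackSort σ ≡ reverse w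
  stackSort-preimages zero    []      l (here refl) = refl
  stackSort-preimages (suc d) []      l (here refl) = refl
  stackSort-preimages (suc d) (n ∷ w) (s≤s l) σ∈ with all? (ℕ._<? n) w
  ... | yes w<n
    with β , α , refl , σ∈′ ← ∈-splitConcat⁻ _ w σ∈
    with L , R , L∈ , R∈ , refl ← ∈.∈-cartesianProductWith⁻ _ (preimages d α) (preimages d β) σ∈′ =
    let β≤ , α≤ = ++-bounds β α refl l in begin
    stackSort (L ++ n ∷ R)
      ≡⟨ stackSort-split L R (↭.All-resp-↭ (↭-sym (preimages-↭ d α α≤ L∈)) (All.++⁻ʳ β w<n))
                             (↭.All-resp-↭ (↭-sym (preimages-↭ d β β≤ R∈)) (All.++⁻ˡ β w<n)) ⟩
    stackSort L ++ stackSort R ++ [ n ]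
      ≡⟨ cong₂ (λ v w → v ++ w ++ [ n ]) (stackSort-preimages d α α≤ L∈)
          (stackSort-preimages d β β≤ R∈) ⟩
    reverse α ++ reverse β ++ [ n ]
      ≡⟨ ++-assoc (reverse α) (reverse β) [ n ] ⟨
    (reverse α ++ reverse β) ++ [ n ]
      ≡⟨ cong (_++ [ n ]) (reverse-++ β α) ⟨
    reverse (β ++ α) ++ [ n ]
      ≡⟨ unfold-reverse n (β ++ α) ⟨
    reverse (n ∷ β ++ α) ∎
    where open ≡.≡-Reasoning

  -- Splitting σ at its maximum shows which cut it comes from: β and α are the reversed images of R
  -- and L.
  preimages-complete : ∀ d w → length w ≤ d → ∀ {σ} → Unique σ → stackSort σ ≡ reverse w →
                       σ ∈ preimages d w
  preimages-complete d w l {σ} u eq with maxView u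
  preimages-complete zero    []      l u eq | [] = here refl
  preimages-complete (suc d) []      l u eq | [] = here refl
  preimages-complete d       (n ∷ w) l u eq | [] =
    contradiction (≡.trans eq (unfold-reverse n w)) λ e → ∷ʳ≢[] (reverse w) (≡.sym e)
    where
    ∷ʳ≢[] : ∀ (v : List ℕ) → v ++ [ n ] ≢ []
    ∷ʳ≢[] []      ()
    ∷ʳ≢[] (_ ∷ _) ()
  preimages-complete d w l u eq | node L m R L<m R<m = subst (λ v → L ++ m ∷ R ∈ preimages d v)
    (≡.sym w≡) (go d (subst (λ v → length v ≤ d) w≡ l))
    where
    open ≡.≡-Reasoning
    β α : List ℕ
    β = reverse (stackSort R)
    α = reverse (stackSort L)
    w≡ : w ≡ m ∷ β ++ α
    w≡ = begin
      w                                                  ≡⟨ reverse-involutive w ⟨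
      reverse (reverse w)                                ≡⟨ cong reverse eq ⟨
      reverse (stackSort (L ++ m ∷ R))                   ≡⟨ cong reverse
          (stackSort-split L R L<m R<m) ⟩
      reverse (stackSort L ++ stackSort R ++ [ m ])      ≡⟨ reverse-++ (stackSort L) _ ⟩
      reverse (stackSort R ++ [ m ]) ++ α                ≡⟨ cong (_++ α)
          (reverse-++ (stackSort R) [ m ]) ⟩
      m ∷ β ++ α                                         ∎
    uL = proj₁ (++-unique⁻ L u)
    uR : Unique R
    uR with _ ∷ uR ← proj₂ (++-unique⁻ L u) = uR
    α↭L : α ↭ L
    α↭L = ↭-trans (↭.↭-reverse (stackSort L)) (stackSort-↭ uL)
    β↭R : β ↭ R
    β↭R = ↭-trans (↭.↭-reverse (stackSort R)) (stackSort-↭ uR)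
    below : All (_< m) (β ++ α)
    below = All.++⁺ (↭.All-resp-↭ (↭-sym β↭R) R<m) (↭.All-resp-↭ (↭-sym α↭L) L<m)
    go : ∀ d → length (m ∷ β ++ α) ≤ d → L ++ m ∷ R ∈ preimages d (m ∷ β ++ α)
    go (suc d) (s≤s l) rewrite dec-true (all? (ℕ._<? m) (β ++ α)) below =
      let β≤ , α≤ = ++-bounds β α refl l
      in ∈-splitConcat⁺ _ β α (∈.∈-cartesianProductWith⁺ _
           (preimages-complete d α α≤ uL (≡.sym (reverse-involutive (stackSort L))))
           (preimages-complete d β β≤ uR (≡.sym (reverse-involutive (stackSort R)))))

  private
    max-cancel : ∀ L L′ {n R R′} → All (_< n) L → All (_< n) L′ →
                 L ++ n ∷ R ≡ L′ ++ n ∷ R′ → L ≡ L′ × R ≡ R′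
    max-cancel []      []       _         _          eq = refl , ∷-injectiveʳ eq
    max-cancel []      (_ ∷ _)  _         (n<n ∷ _)  refl = contradiction n<n (ℕ.<-irrefl refl)
    max-cancel (_ ∷ _) []       (n<n ∷ _) _          refl = contradiction n<n (ℕ.<-irrefl refl)
    max-cancel (x ∷ L) (x′ ∷ L′) (_ ∷ L<n) (_ ∷ L′<n) eq
      with refl , eq′ ← ∷-injective eq
      with refl , R≡R′ ← max-cancel L L′ L<n L′<n eq′ = refl , R≡R′

  preimages-unique : ∀ d w → length w ≤ d → Unique (preimages d w)
  preimages-unique zero    w       l = [] ∷ []
  preimages-unique (suc d) []      l = [] ∷ []
  preimages-unique (suc d) (n ∷ w) (s≤s l) with all? (ℕ._<? n) w
  ... | no  _   = []
  ... | yes w<n = splitConcat-unique _ w unique separate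
    where
    L<n : ∀ β α → β ++ α ≡ w → ∀ {L} → L ∈ preimages d α → All (_< n) L
    L<n β α refl L∈ = ↭.All-resp-↭ (↭-sym (preimages-↭ d α (proj₂ (++-bounds β α refl l)) L∈))
                                   (All.++⁻ʳ β w<n)
    unique : ∀ β α → β ++ α ≡ w →
      Unique (cartesianProductWith (λ L R → L ++ n ∷ R) (preimages d α) (preimages d β))
    unique β α eq = let β≤ , α≤ = ++-bounds β α eq l in
      productWith-unique _ (preimages d α) (preimages d β)
        (λ {L} {L′} L∈ L′∈ → max-cancel L L′ (L<n β α eq L∈) (L<n β α eq L′∈))
        (preimages-unique d α α≤) (preimages-unique d β β≤)
    -- The cut can be recovered from σ: the maximum separates L from R, and β is the reversed image
    -- of R.
    separate : ∀ β α β′ α′ → β ++ α ≡ w → β′ ++ α′ ≡ w → ∀ {σ} →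
      σ ∈ cartesianProductWith (λ L R → L ++ n ∷ R) (preimages d α) (preimages d β) →
      σ ∈ cartesianProductWith (λ L R → L ++ n ∷ R) (preimages d α′) (preimages d β′) → β ≡ β′
    separate β α β′ α′ eq eq′ σ∈ σ∈′
      with L , R , L∈ , R∈ , refl ← ∈.∈-cartesianProductWith⁻ _ (preimages d α) (preimages d β) σ∈
      with L′ , R′ , L′∈ , R′∈ , same ← ∈.∈-cartesianProductWith⁻ _ (preimages d α′) (preimages d β′) σ∈′
      with refl , refl ← max-cancel L L′ (L<n β α eq L∈) (L<n β′ α′ eq′ L′∈) same =
      reverse-injective (≡.trans (≡.sym (stackSort-preimages d β (proj₁ (++-bounds β α eq l)) R∈))
                                 (stackSort-preimages d β′ (proj₁ (++-bounds β′ α′ eq′ l)) R′∈))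

  preimages-enumerates : ∀ w → IsPermutation w →
    preimages (length w) w Enumerates (λ σ → IsPermutation σ × stackSort σ ≡ reverse w)
  preimages-enumerates w perm = preimages-unique (length w) w ℕ.≤-refl , λ σ → mk⇔
    (λ σ∈ → isPermutation-↭ (↭-sym (preimages-↭ (length w) w ℕ.≤-refl σ∈)) perm ,
            stackSort-preimages (length w) w ℕ.≤-refl σ∈)
    (λ (permσ , eq) → preimages-complete (length w) w ℕ.≤-refl (proj₂ permσ) eq)

  ∑-fibre : ∀ w → IsPermutation w → ∀ {σs} →
    σs Enumerates (λ σ → IsPermutation σ × stackSort σ ≡ reverse w) → ∑ σs weight ≋ fert w
  ∑-fibre w perm σs-enum = ≋-trans
    (∑-enumerations weight σs-enum (preimages-enumerates w perm))
    (∑-preimages (length w) w ℕ.≤-refl)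

-- Translation between words and weighted trees

module Trees where

  open import Data.List.Membership.Propositional using (_∈_)
  open import Data.Nat using (_+_)

  open Polynomial
  open Series poly-semiring
  open Fertility
  open Narayana using (fert-increasing)
  open Preimages using ([]; node; maxView; ++-unique⁻)

  -- A binary nested family of intervals of the leaves, with weights: a leaf
  -- carries the positive weight suc t, an inner node the weight w ≥ 0, where
  -- w = 0 stands for an interval outside the building set.
  data Tree : ℕ → Set where
    leaf : ℕ → Tree 1
    node : ∀ {m n} → Tree m → Tree n → ℕ → Tree (m + n)

  -- treeₛ T a is the sum of the N_q over the lattice points q of the
  -- nestohedron of T with the weight of the root increased by a.
  treeₛ : ∀ {n} → Tree n → Seq
  treeₛ (leaf t)     a = narayana (suc t + a)
  treeₛ (node l r w) a = (treeₛ l ⋆ treeₛ r) (w + a)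

  -- Multiplication of the series by z to the power d.
  shiftBy : ℕ → Seq → Seq
  shiftBy zero    f = f
  shiftBy (suc d) f = shift (shiftBy d f)

  shiftBy-cancel : ∀ t d f a → shiftBy (t + d) f (t + a) ≡ shiftBy d f a
  shiftBy-cancel zero    d f a = refl
  shiftBy-cancel (suc t) d f a = shiftBy-cancel t d f a

  shift-cong : ∀ {f g : Seq} → (∀ n → f n ≋ g n) → ∀ n → shift f n ≋ shift g n
  shift-cong e zero    = ≋-refl
  shift-cong e (suc n) = e n

  shiftBy-⋆ : ∀ d f g n → (shiftBy d f ⋆ g) n ≋ shiftBy d (f ⋆ g) n
  shiftBy-⋆ zero    f g n       = ≋-refl
  shiftBy-⋆ (suc d) f g zero    = ≋-refl
  shiftBy-⋆ (suc d) f g (suc n) = ≋-trans (⋆-shiftˡ (shiftBy d f) g n) (shiftBy-⋆ d f g n)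

  shiftBy-cong : ∀ d {f g : Seq} → (∀ n → f n ≋ g n) → ∀ n → shiftBy d f n ≋ shiftBy d g n
  shiftBy-cong zero    e = e
  shiftBy-cong (suc d) e = shift-cong (shiftBy-cong d e)

  shiftBy-+ : ∀ c d f n → shiftBy c (shiftBy d f) n ≡ shiftBy (c + d) f n
  shiftBy-+ zero    d f n       = refl
  shiftBy-+ (suc c) d f zero    = refl
  shiftBy-+ (suc c) d f (suc n) = shiftBy-+ c d f n

  shiftBy-⋆-shiftBy : ∀ c d f g n → (shiftBy c f ⋆ shiftBy d g) n ≋ shiftBy (c + d) (f ⋆ g) n
  shiftBy-⋆-shiftBy c d f g n = ≋-trans (shiftBy-⋆ c f (shiftBy d g) n) (≋-trans
    (shiftBy-cong c (λ i → ≋-trans (⋆-comm f (shiftBy d g) i)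
      (≋-trans (shiftBy-⋆ d g f i) (shiftBy-cong d (⋆-comm g f) i))) n)
    (≋-reflexive (shiftBy-+ c d (f ⋆ g) n)))

  dominates-++ : ∀ {ms ns α} → Dominates ms (ns ++ α) → Dominates ns α → Dominates (ms ++ ns) α
  dominates-++                []      E = E
  dominates-++ {m ∷ ms} {ns} {α} (h ∷ D) E =
    subst (All (_< m)) (≡.sym (++-assoc ms ns α)) h ∷ dominates-++ D E

  -- A tower on top of `ms` is again a word of maxima over α, and only the total number of maxima
  -- counts.
  fertₛ-dominates : ∀ {ms α} → Dominates ms α → ∀ a → fertₛ (ms ++ α) a ≋ fertₛ α (length ms + a)
  fertₛ-dominates {ms} {α} D a = ≋-trans
    (≋-reflexive (cong fert (≡.sym (++-assoc t ms α))))
    (≋-trans (fert-dominates α (t ++ ms) (dominates-++ (tower-dominates (ms ++ α) a) D))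
             (≋-reflexive (cong (fertₛ α) len)))
    where
    t = tower (ms ++ α) a
    len : length (t ++ ms) ≡ length ms + a
    len = ≡.trans (length-++ t)
        (≡.trans (cong (_+ length ms) (length-tower (ms ++ α) a)) (ℕ.+-comm a _))

  -- In the reversed word the trailing maxima ms come first; next is the descent
  -- from the maximum M of the rest.
  data WordView : List ℕ → Set where
    increasing : ∀ {w} → Dominates w [] → WordView w
    descent    : ∀ {ms} b β M α₁ → Dominates ms (b ∷ β ++ M ∷ α₁) →
                 All (_< M) (b ∷ β) → All (_< M) α₁ → WordView (ms ++ b ∷ β ++ M ∷ α₁)

  wordView : ∀ {w} → Unique w → WordView w
  wordView {[]}    u = increasing []
  wordView {n ∷ w} (n∉ ∷ u) with all? (ℕ._<? n) w
  ... | yes w<n with wordView u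
  ...   | increasing D = increasing (subst (All (_< n)) (≡.sym (++-identityʳ w)) w<n ∷ D)
  ...   | descent b β M α₁ D β<M α₁<M = descent b β M α₁ (w<n ∷ D) β<M α₁<M
  wordView {n ∷ w} (n∉ ∷ u) | no w≮n with maxView u
  ... | [] = contradiction [] w≮n
  ... | node β M α₁ β<M α₁<M = descent n β M α₁ [] (n<M ∷ β<M) α₁<M
    where
    n<M : n < M
    n<M = ℕ.≰⇒> λ M≤n → w≮n (All.++⁺
      (All.map (λ l → ℕ.<-≤-trans l M≤n) β<M)
      (ℕ.≤∧≢⇒< M≤n (λ M≡n → All.lookup n∉ (∈.∈-insert β) (≡.sym M≡n)) ∷
       All.map (λ l → ℕ.<-≤-trans l M≤n) α₁<M))

  -- With fewer than `deficit` appended maxima F vanishes; from there on it follows the tree.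
  record WordTree (w : List ℕ) : Set where
    constructor wordTree
    field
      {size}  : ℕ
      tree    : Tree size
      deficit : ℕ
      fertₛ≋  : ∀ a → fertₛ w a ≋ shiftBy deficit (treeₛ tree) a

  open WordTree

  -- The descent from M costs one maximum on top of those missing from the two parts; this is the
  -- `suc` in the shift.
  descent-treeₛ : ∀ b β M α₁ → All (_< M) (b ∷ β) → (A : WordTree (M ∷ α₁)) (B : WordTree (b ∷ β)) →
    ∀ i → fertₛ (b ∷ β ++ M ∷ α₁) i ≋
          shiftBy (suc (deficit A + deficit B)) (treeₛ (tree A) ⋆ treeₛ (tree B)) i
  descent-treeₛ b β M α₁ β<M A B zero    = ≋-reflexive (fertₛ-++-zero M b β β<M α₁)
  descent-treeₛ b β M α₁ β<M A B (suc i) = ≋-trans (fertₛ-++ M b β β<M α₁ i)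
    (≋-trans (⋆-cong (fertₛ≋ A) (fertₛ≋ B) i)
             (shiftBy-⋆-shiftBy (deficit A) (deficit B) (treeₛ (tree A)) (treeₛ (tree B)) i))

  private
    join : ∀ ms b β M α₁ → Dominates ms (b ∷ β ++ M ∷ α₁) → All (_< M) (b ∷ β) →
           WordTree (M ∷ α₁) → WordTree (b ∷ β) → WordTree (ms ++ b ∷ β ++ M ∷ α₁)
    join ms b β M α₁ D β<M A B with ℕ.≤-total (suc (deficit A + deficit B)) (length ms)
    -- Enough maxima: `e` of them pay for the descent and the deficits, and the surplus is the
    -- weight of the root.
    ... | inj₁ e≤t = wordTree (node (tree A) (tree B) (t ℕ.∸ e)) 0 λ a →
      ≋-trans (fertₛ-dominates D a)
          (≋-trans (descent-treeₛ b β M α₁ β<M A B (t + a)) (≋-reflexive (begin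
      shiftBy e H (t + a)                  ≡⟨ cong (λ i → shiftBy e H (i + a)) (ℕ.m+[n∸m]≡n e≤t) ⟨
      shiftBy e H ((e + (t ℕ.∸ e)) + a)    ≡⟨ cong (shiftBy e H) (ℕ.+-assoc e (t ℕ.∸ e) a) ⟩
      shiftBy e H (e + (t ℕ.∸ e + a))
        ≡⟨ cong (λ i → shiftBy i H (e + (t ℕ.∸ e + a))) (ℕ.+-identityʳ e) ⟨
      shiftBy (e + 0) H (e + (t ℕ.∸ e + a)) ≡⟨ shiftBy-cancel e 0 H (t ℕ.∸ e + a) ⟩
      H (t ℕ.∸ e + a)                      ∎)))
      where
      open ≡.≡-Reasoning
      t = length ms
      e = suc (deficit A + deficit B)
      H = treeₛ (tree A) ⋆ treeₛ (tree B)
    -- Too few maxima: all are consumed, the root gets weight 0, and the unpaid rest is the deficit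
    -- of the whole word.
    ... | inj₂ t≤e = wordTree (node (tree A) (tree B) 0) (e ℕ.∸ t) λ a →
      ≋-trans (fertₛ-dominates D a)
          (≋-trans (descent-treeₛ b β M α₁ β<M A B (t + a)) (≋-reflexive (begin
      shiftBy e H (t + a)                  ≡⟨ cong (λ i → shiftBy i H (t + a)) (ℕ.m+[n∸m]≡n t≤e) ⟨
      shiftBy (t + (e ℕ.∸ t)) H (t + a)    ≡⟨ shiftBy-cancel t (e ℕ.∸ t) H a ⟩
      shiftBy (e ℕ.∸ t) H a                ∎)))
      where
      open ≡.≡-Reasoning
      t = length ms
      e = suc (deficit A + deficit B)
      H = treeₛ (tree A) ⋆ treeₛ (tree B)

  fertₛ-increasing : ∀ n w → Dominates (n ∷ w) [] → ∀ a →
                     fertₛ (n ∷ w) a ≋ narayana (suc (length w) + a)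
  fertₛ-increasing n w D a = ≋-trans
    (≋-reflexive (cong (λ v → fertₛ v a) (≡.sym (++-identityʳ (n ∷ w)))))
    (≋-trans (fertₛ-dominates D a) (fert-increasing (length w + a)))

  treeOfWord : ∀ w → w ≢ [] → Unique w → WordTree w
  treeOfWord w = go (length w) ℕ.≤-refl
    where
    go : ∀ d {w} → length w ≤ d → w ≢ [] → Unique w → WordTree w
    go d {w} l w≢[] u with wordView u
    go d {w} l w≢[] u | increasing D = single w w≢[] D
      where
      single : ∀ w → w ≢ [] → Dominates w [] → WordTree w
      single []      w≢[] D = contradiction refl w≢[]
      single (n ∷ w) w≢[] D = wordTree (leaf (length w)) 0 (fertₛ-increasing n w D)
    go zero    l w≢[] u | descent {[]}    b β M α₁ D β<M α₁<M = contradiction l λ ()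
    go zero    l w≢[] u | descent {_ ∷ _} b β M α₁ D β<M α₁<M = contradiction l λ ()
    go (suc d) l w≢[] u | descent {ms} b β M α₁ D β<M α₁<M =
      join ms b β M α₁ D β<M (go d α≤ (λ ()) uα) (go d β≤ (λ ()) uβ)
      where
      uρ = proj₂ (++-unique⁻ ms u)
      uβ = proj₁ (++-unique⁻ (b ∷ β) uρ)
      uα = proj₂ (++-unique⁻ (b ∷ β) uρ)
      ρ≤ : length (b ∷ β ++ M ∷ α₁) ≤ suc d
      ρ≤ = ℕ.≤-trans (ℕ.m≤n+m _ (length ms))
                     (ℕ.≤-trans (ℕ.≤-reflexive (≡.sym (length-++ ms))) l)
      len : length (b ∷ β ++ M ∷ α₁) ≡ length (b ∷ β) + length (M ∷ α₁)
      len = length-++ (b ∷ β)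
      α≤ : length (M ∷ α₁) ≤ d
      α≤ = ℕ.s≤s⁻¹ (ℕ.≤-trans (s≤s (ℕ.m≤n+m _ (length β)))
          (ℕ.≤-trans (ℕ.≤-reflexive (≡.sym len)) ρ≤))
      β≤ : length (b ∷ β) ≤ d
      β≤ = ℕ.s≤s⁻¹ (ℕ.≤-trans (ℕ.≤-trans (ℕ.m≤m+n _ (length α₁))
             (ℕ.≤-reflexive (≡.sym (ℕ.+-suc (length (b ∷ β)) (length α₁)))))
             (ℕ.≤-trans (ℕ.≤-reflexive (≡.sym len)) ρ≤))

  -- Letters are kept above `o` so that the word of a left subtree can be placed above all letters
  -- of the right one, which forces the descent between them. The series agrees with that of the
  -- tree without any shift.
  record TreeWord {n} (T : Tree n) (o : ℕ) : Set where
    field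
      max    : ℕ
      rest   : List ℕ
      rest<  : All (_< max) rest
      above  : All (o <_) (max ∷ rest)
      unique : Unique (max ∷ rest)
      fertₛ≋ : ∀ a → fertₛ (max ∷ rest) a ≋ treeₛ T a

  dominates-unique : ∀ {ms α} → Dominates ms α → Unique α → Unique (ms ++ α)
  dominates-unique []      u = u
  dominates-unique (h ∷ D) u = All.map (λ x<m m≡x → ℕ.<-irrefl (≡.sym m≡x) x<m) h ∷
      dominates-unique D u

  dominates-above : ∀ {o ms x α} → Dominates ms (x ∷ α) → o < x → All (o <_) ms
  dominates-above {ms = []}     []      o<x = []
  dominates-above {ms = m ∷ ms} (h ∷ D) o<x =
    ℕ.<-trans o<x (All.head (All.++⁻ʳ ms h)) ∷ dominates-above D o<x

  sup-upper : ∀ w → All (_≤ sup w) w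
  sup-upper w = All.map ℕ.s≤s⁻¹ (<-suc-sup w)

  wordOfTree : ∀ {n} (T : Tree n) o → TreeWord T o
  wordOfTree (leaf t) o = go t
    where
    α = suc o ∷ []
    ms : ℕ → List ℕ
    ms t = tower α t ++ α
    dom : ∀ t → Dominates (ms t) []
    dom t = dominates-++ (subst (Dominates (tower α t)) (≡.sym (++-identityʳ α))
        (tower-dominates α t))
                         ([] ∷ [])
    above : ∀ t → All (o <_) (ms t)
    above t = All.++⁺ (dominates-above (tower-dominates α t) ℕ.≤-refl) (ℕ.≤-refl ∷ [])
    uniq : ∀ t → Unique (ms t)
    uniq t = dominates-unique (tower-dominates α t) ([] ∷ [])
    len : ∀ t → length (ms t) ≡ suc t
    len t = ≡.trans (length-++ (tower α t))
        (≡.trans (cong (_+ 1) (length-tower α t)) (ℕ.+-comm t 1))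
    go : ∀ t → TreeWord (leaf t) o
    go t with ms t | dom t | above t | uniq t | len t
    ... | m ∷ w | D@(h ∷ _) | o< | u | l = record
      { max = m ; rest = w ; rest< = subst (All (_< m)) (++-identityʳ w) h ; above = o< ; unique = u
      ; fertₛ≋ = λ a → ≋-trans (fertₛ-increasing m w D a)
                               (≋-reflexive (cong (λ k → narayana (k + a)) l)) }
  wordOfTree (node l r w) o = record
    { max = suc (sup ρ′) ; rest = ρ′ ; rest< = <-suc-sup ρ′
    ; above = ℕ.<-trans (All.head (R.above)) (All.head (All.++⁻ʳ (tower ρ w) (<-suc-sup ρ′))) ∷
              All.++⁺ (dominates-above (tower-dominates ρ w) (All.head R.above)) o<ρ
    ; unique = dominates-unique (tower-dominates ρ (suc w)) uρ
    -- Of the w + 1 maxima, one pays for the descent between the two subtrees and w are left as the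
    -- root weight.
    ; fertₛ≋ = λ a → ≋-trans (fertₛ-dominates (tower-dominates ρ (suc w)) a)
        (≋-trans (≋-reflexive (cong (λ k → fertₛ ρ (k + a)) (length-tower ρ (suc w))))
        (≋-trans (fertₛ-++ L.max R.max R.rest β<M L.rest (w + a))
                 (⋆-cong L.fertₛ≋ R.fertₛ≋ (w + a)))) }
    where
    module R = TreeWord (wordOfTree r o)
    β = R.max ∷ R.rest
    module L = TreeWord (wordOfTree l (sup β ⊔ o))
    α = L.max ∷ L.rest
    ρ  = β ++ α
    ρ′ = tower ρ w ++ ρ
    β<α : ∀ {x} → sup β ⊔ o < x → All (_< x) β
    β<α lt = All.map (λ b≤ → ℕ.≤-<-trans (ℕ.≤-trans b≤ (ℕ.m≤m⊔n (sup β) o)) lt) (sup-upper β)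
    β<M : All (_< L.max) β
    β<M = β<α (All.head L.above)
    o<ρ : All (o <_) ρ
    o<ρ = All.++⁺ R.above (All.map (ℕ.≤-<-trans (ℕ.m≤n⊔m (sup β) o)) L.above)
    disjoint : Disjoint β α
    disjoint (x∈β , x∈α) = ℕ.<-irrefl refl (All.lookup (β<α (All.lookup L.above x∈α)) x∈β)
    uρ : Unique ρ
    uρ = Unique.++⁺ R.unique L.unique disjoint

  tree-size : ∀ {n} → Tree n → ∃[ k ] n ≡ suc k
  tree-size (leaf t) = 0 , refl
  tree-size (node {m} {n} l r w) with k , refl ← tree-size l = k + n , refl

-- Distributing the weights of a tree among its leaves

module LatticeLists where

  open import Data.List.Membership.Propositional using (_∈_)
  open import Data.Nat using (_+_)

  open import Defs using (Poly; ∑)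
  open Polynomial
  open Series poly-semiring
  open Trees using (Tree; leaf; node; treeₛ)
  open Preimages using (productWith-unique)
  open import Algebra.Properties.CommutativeSemigroup ℕ.+-commutativeSemigroup using () renaming (interchange to +-interchange)

  module _ {A B C : Set} (_∙_ : A → B → C) where

    -- The product `⋆` on the level of lists: all pairs taken from indices that add up to n.
    convolve : (ℕ → List A) → (ℕ → List B) → ℕ → List C
    convolve f g zero    = cartesianProductWith _∙_ (f 0) (g 0)
    convolve f g (suc n) = cartesianProductWith _∙_ (f 0) (g (suc n)) ++ convolve (f ∘ suc) g n

    ∑-convolve : ∀ f g {p : A → Poly} {q : B → Poly} (h : C → Poly) →
        (∀ x y → h (x ∙ y) ≋ p x ⊗ q y) →
                 ∀ n → ∑ (convolve f g n) h ≋ ((λ i → ∑ (f i) p) ⋆ (λ j → ∑ (g j) q)) n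
    ∑-convolve f g h e zero    = ∑-products _∙_ (f 0) (g 0) λ {x} {y} _ _ → e x y
    ∑-convolve f g h e (suc n) = ≋-trans
      (∑-++ (cartesianProductWith _∙_ (f 0) (g (suc n))) _ h)
      (Poly.+-cong (∑-products _∙_ (f 0) (g (suc n)) λ {x} {y} _ _ → e x y)
                   (∑-convolve (f ∘ suc) g h e n))

    ∈-convolve⁺ : ∀ f g i j {x y} → x ∈ f i → y ∈ g j → x ∙ y ∈ convolve f g (i + j)
    ∈-convolve⁺ f g zero    zero    x∈ y∈ = ∈.∈-cartesianProductWith⁺ _∙_ x∈ y∈
    ∈-convolve⁺ f g zero    (suc j) x∈ y∈ = ∈.∈-++⁺ˡ (∈.∈-cartesianProductWith⁺ _∙_ x∈ y∈)
    ∈-convolve⁺ f g (suc i) j       x∈ y∈ =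
      ∈.∈-++⁺ʳ (cartesianProductWith _∙_ (f 0) (g (suc (i + j))))
          (∈-convolve⁺ (f ∘ suc) g i j x∈ y∈)

    ∈-convolve⁻ : ∀ f g n {z} → z ∈ convolve f g n →
      ∃[ i ] ∃[ j ] ∃[ x ] ∃[ y ] (i + j ≡ n × x ∈ f i × y ∈ g j × z ≡ x ∙ y)
    ∈-convolve⁻ f g zero    z∈ =
      let x , y , x∈ , y∈ , eq = ∈.∈-cartesianProductWith⁻ _∙_ (f 0) (g 0) z∈
      in 0 , 0 , x , y , refl , x∈ , y∈ , eq
    ∈-convolve⁻ f g (suc n) z∈ with ∈.∈-++⁻ (cartesianProductWith _∙_ (f 0) (g (suc n))) z∈
    ... | inj₁ z∈′ =
      let x , y , x∈ , y∈ , eq = ∈.∈-cartesianProductWith⁻ _∙_ (f 0) (g (suc n)) z∈′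
      in 0 , suc n , x , y , refl , x∈ , y∈ , eq
    ... | inj₂ z∈′ =
      let i , j , x , y , i+j≡n , rest = ∈-convolve⁻ (f ∘ suc) g n z∈′
      in suc i , j , x , y , cong suc i+j≡n , rest

    convolve-unique : (∀ {x x′ y y′} → x ∙ y ≡ x′ ∙ y′ → x ≡ x′ × y ≡ y′) → ∀ f g →
      (∀ i → Unique (f i)) → (∀ j → Unique (g j)) →
      (∀ {i i′ x} → x ∈ f i → x ∈ f i′ → i ≡ i′) → ∀ n → Unique (convolve f g n)
    convolve-unique inj f g uf ug d zero    =
      productWith-unique _∙_ (f 0) (g 0) (λ _ _ → inj) (uf 0) (ug 0)
    convolve-unique inj f g uf ug d (suc n) = Unique.++⁺
      (productWith-unique _∙_ (f 0) (g (suc n)) (λ _ _ → inj) (uf 0) (ug (suc n)))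
      (convolve-unique inj (f ∘ suc) g (uf ∘ suc) ug (λ x∈ x∈′ → ℕ.suc-injective (d x∈ x∈′)) n)
      disjoint
      where
      disjoint : Disjoint (cartesianProductWith _∙_ (f 0) (g (suc n))) (convolve (f ∘ suc) g n)
      disjoint (z∈ , z∈′)
        with x , y , x∈ , _ , refl ← ∈.∈-cartesianProductWith⁻ _∙_ (f 0) (g (suc n)) z∈
        with i , j , x′ , y′ , _ , x′∈ , _ , eq ← ∈-convolve⁻ (f ∘ suc) g n z∈′
        with refl ← proj₁ (inj eq) = contradiction (d x∈ x′∈) λ ()

  -- The parameter `a` is the excess received from the ancestors. Together with w it is divided
  -- between the subtrees in every possible way, and a leaf puts its share into its coordinate.
  points : ∀ {n} → Tree n → ℕ → List (Vec ℤ n)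
  points (leaf t)     a = [ + (suc t + a) ∷ [] ]
  points (node l r w) a = convolve Vec._++_ (points l) (points r) (w + a)

  narayanaᵛ-++ : ∀ {m n} (u : Vec ℤ m) (v : Vec ℤ n) →
                 narayanaᵛ (u Vec.++ v) ≋ narayanaᵛ u ⊗ narayanaᵛ v
  narayanaᵛ-++ []      v = ≋-sym (Poly.*-identityˡ (narayanaᵛ v))
  narayanaᵛ-++ (i ∷ u) v = ≋-trans (⊗-congˡ (narayana ℤ.∣ i ∣) (narayanaᵛ-++ u v))
    (≋-sym (Poly.*-assoc (narayana ℤ.∣ i ∣) (narayanaᵛ u) (narayanaᵛ v)))

  ∑-points : ∀ {n} (T : Tree n) a → ∑ (points T a) narayanaᵛ ≋ treeₛ T a
  ∑-points (leaf t)     a = ≋-trans (Poly.+-identityʳ _) (Poly.*-identityʳ (narayana (suc t + a)))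
  ∑-points (node l r w) a = ≋-trans
    (∑-convolve Vec._++_ (points l) (points r) narayanaᵛ narayanaᵛ-++ (w + a))
    (⋆-cong (∑-points l) (∑-points r) (w + a))

  ∣_∣ᵗ : ∀ {n} → Tree n → ℕ
  ∣ leaf t ∣ᵗ     = suc t
  ∣ node l r w ∣ᵗ = (∣ l ∣ᵗ + ∣ r ∣ᵗ) + w

  total : ∀ {n} → Vec ℤ n → ℤ
  total []      = + 0
  total (i ∷ q) = i ℤ.+ total q

  total-++ : ∀ {m n} (u : Vec ℤ m) (v : Vec ℤ n) → total (u Vec.++ v) ≡ total u ℤ.+ total v
  total-++ []      v = ≡.sym (ℤ.+-identityˡ _)
  total-++ (i ∷ u) v = ≡.trans (cong (λ j → i ℤ.+ j) (total-++ u v)) (≡.sym (ℤ.+-assoc i _ _))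

  regroup : ∀ (l r w a i j : ℕ) → i + j ≡ w + a → (l + i) + (r + j) ≡ ((l + r) + w) + a
  regroup l r w a i j eq = begin
    (l + i) + (r + j)     ≡⟨ +-interchange l i r j ⟩
    (l + r) + (i + j)     ≡⟨ cong (λ k → (l + r) + k) eq ⟩
    (l + r) + (w + a)     ≡⟨ ℕ.+-assoc (l + r) w a ⟨
    ((l + r) + w) + a     ∎
    where open ≡.≡-Reasoning

  total-points : ∀ {n} (T : Tree n) a {q} → q ∈ points T a → total q ≡ + (∣ T ∣ᵗ + a)
  total-points (leaf t)     a (here refl) = ℤ.+-identityʳ _
  total-points (node l r w) a q∈
    with i , j , u , v , eq , u∈ , v∈ , refl ← ∈-convolve⁻ Vec._++_ (points l) (points r) (w + a) q∈ =
    ≡.trans (total-++ u v) (≡.trans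
      (cong₂ ℤ._+_ (total-points l i u∈) (total-points r j v∈))
      (cong +_ (regroup ∣ l ∣ᵗ ∣ r ∣ᵗ w a i j eq)))

  -- The coordinate total of the left half determines the share given to the left subtree, so no
  -- point arises from two distributions.
  points-unique : ∀ {n} (T : Tree n) a → Unique (points T a)
  points-unique (leaf t)     a = [] ∷ []
  points-unique (node l r w) a = convolve-unique Vec._++_ (λ {x} {x′} → Vec.++-injective x x′)
    (points l) (points r) (points-unique l) (points-unique r)
    (λ {i} {i′} x∈ x∈′ → ℕ.+-cancelˡ-≡ ∣ l ∣ᵗ i i′
       (ℤ.+-injective (≡.trans (≡.sym (total-points l i x∈)) (total-points l i′ x∈′))))
    (w + a)

  -- One inequality per node. The equation for the whole tree is stated separately, because below
  -- the root only the inequality survives.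
  Above : ∀ {n} → Tree n → Vec ℤ n → Set
  Above T@(leaf _)             q = + ∣ T ∣ᵗ ℤ.≤ total q
  Above T@(node {m} {n} l r w) q = + ∣ T ∣ᵗ ℤ.≤ total q ×
    Σ[ u ∈ Vec ℤ m ] Σ[ v ∈ Vec ℤ n ] (q ≡ u Vec.++ v × Above l u × Above r v)

  private
    above-excess : ∀ {m i} → + m ℤ.≤ i → ∃[ k ] i ≡ + (m + k)
    above-excess {m} {+ n} (+≤+ m≤n) = n ℕ.∸ m , cong +_ (≡.sym (ℕ.m+[n∸m]≡n m≤n))

  above-total : ∀ {n} (T : Tree n) {q} → Above T q → + ∣ T ∣ᵗ ℤ.≤ total q
  above-total (leaf _)     h       = h
  above-total (node _ _ _) (h , _) = h

  -- The slack in the inequalities of the two subtrees gives their shares i and j; the equation for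
  -- the total forces i + j = w + a.
  above⇒points : ∀ {n} (T : Tree n) a {q} → Above T q → total q ≡ + (∣ T ∣ᵗ + a) → q ∈ points T a
  above⇒points (leaf t) a {i ∷ []} _ eq = here (cong (_∷ []) (≡.trans (≡.sym (ℤ.+-identityʳ i)) eq))
  above⇒points (node l r w) a (_ , u , v , refl , hl , hr) eq
    with i , eqᵢ ← above-excess (above-total l hl)
    with j , eqⱼ ← above-excess (above-total r hr) =
    subst (λ k → u Vec.++ v ∈ convolve Vec._++_ (points l) (points r) k) i+j≡w+a
      (∈-convolve⁺ Vec._++_ (points l) (points r) i j
        (above⇒points l i hl eqᵢ) (above⇒points r j hr eqⱼ))
    where
    i+j≡w+a : i + j ≡ w + a
    i+j≡w+a = ℕ.+-cancelˡ-≡ (∣ l ∣ᵗ + ∣ r ∣ᵗ) (i + j) (w + a) (begin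
      (∣ l ∣ᵗ + ∣ r ∣ᵗ) + (i + j)     ≡⟨ +-interchange ∣ l ∣ᵗ i ∣ r ∣ᵗ j ⟨
      (∣ l ∣ᵗ + i) + (∣ r ∣ᵗ + j)
        ≡⟨ ℤ.+-injective (≡.trans (≡.sym (cong₂ ℤ._+_ eqᵢ eqⱼ))
            (≡.trans (≡.sym (total-++ u v)) eq)) ⟩
      ((∣ l ∣ᵗ + ∣ r ∣ᵗ) + w) + a     ≡⟨ ℕ.+-assoc (∣ l ∣ᵗ + ∣ r ∣ᵗ) w a ⟩
      (∣ l ∣ᵗ + ∣ r ∣ᵗ) + (w + a)     ∎)
      where open ≡.≡-Reasoning

-- Arithmetic and order of the Cauchy reals

module Reals where

  open import Data.Rational.Solver using (module +-*-Solver)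

  open Integers

  private
    module _ where
      open +-*-Solver

      halves : ∀ ε → ½ ℚ.* ε ℚ.+ ½ ℚ.* ε ≡ ε
      halves = solve 1 (λ ε → con ½ :* ε :+ con ½ :* ε := ε) refl

      +-minus : ∀ a a′ b b′ → (a ℚ.+ b) ℚ.- (a′ ℚ.+ b′) ≡ (a ℚ.- a′) ℚ.+ (b ℚ.- b′)
      +-minus = solve 4 (λ a a′ b b′ → (a :+ b) :- (a′ :+ b′) := (a :- a′) :+ (b :- b′)) refl

      *-minus : ∀ a a′ b b′ → a ℚ.* b ℚ.- a′ ℚ.* b′ ≡ a ℚ.* (b ℚ.- b′) ℚ.+ b′ ℚ.* (a ℚ.- a′)
      *-minus = solve 4 (λ a a′ b b′ → a :* b :- a′ :* b′ := a :* (b :- b′) :+ b′ :* (a :- a′)) refl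

      minus-trans : ∀ a b c → a ℚ.- c ≡ (a ℚ.- b) ℚ.+ (b ℚ.- c)
      minus-trans = solve 3 (λ a b c → a :- c := (a :- b) :+ (b :- c)) refl

      minus-swap : ∀ a b → b ℚ.- a ≡ ℚ.- (a ℚ.- b)
      minus-swap = solve 2 (λ a b → b :- a := :- (a :- b)) refl

      minus-neg : ∀ a b → (ℚ.- a) ℚ.- (ℚ.- b) ≡ ℚ.- (a ℚ.- b)
      minus-neg = solve 2 (λ a b → (:- a) :- (:- b) := :- (a :- b)) refl

      minus-zero : ∀ a → a ℚ.- 0ℚ ≡ a
      minus-zero = solve 1 (λ a → a :- con 0ℚ := a) refl

      split-ε : ∀ a b ε → (a ℚ.+ ½ ℚ.* ε) ℚ.+ (b ℚ.+ ½ ℚ.* ε) ≡ (a ℚ.+ b) ℚ.+ ε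
      split-ε = solve 3 (λ a b ε → (a :+ con ½ :* ε) :+ (b :+ con ½ :* ε) := (a :+ b) :+ ε) refl

      move-to-right : ∀ a b ε → (b ℚ.- a) ℚ.+ ε ℚ.+ a ≡ b ℚ.+ ε
      move-to-right = solve 3 (λ a b ε → (b :- a) :+ ε :+ a := b :+ ε) refl

      move-to-left : ∀ a b ε → (b ℚ.+ ε) ℚ.- a ≡ (b ℚ.- a) ℚ.+ ε
      move-to-left = solve 3 (λ a b ε → (b :+ ε) :- a := (b :- a) :+ ε) refl

      *-distrib-minus : ∀ a b c → a ℚ.* (c ℚ.- b) ≡ a ℚ.* c ℚ.- a ℚ.* b
      *-distrib-minus = solve 3 (λ a b c → a :* (c :- b) := a :* c :- a :* b) refl

      minus-cancelʳ : ∀ a b c → (b ℚ.+ c) ℚ.- (a ℚ.+ c) ≡ b ℚ.- a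
      minus-cancelʳ = solve 3 (λ a b c → (b :+ c) :- (a :+ c) := b :- a) refl

    0<½* : ∀ {ε} → 0ℚ ℚ.< ε → 0ℚ ℚ.< ½ ℚ.* ε
    0<½* {ε} 0<ε = subst (ℚ._< ½ ℚ.* ε) (ℚ.*-zeroʳ ½) (ℚ.*-monoʳ-<-pos ½ 0<ε)

    0<* : ∀ {a b} → 0ℚ ℚ.< a → 0ℚ ℚ.< b → 0ℚ ℚ.< a ℚ.* b
    0<* {a} {b} 0<a 0<b =
      subst (ℚ._< a ℚ.* b) (ℚ.*-zeroʳ a) (ℚ.*-monoʳ-<-pos a {{ℚ.positive 0<a}} 0<b)

    0<1 : 0ℚ ℚ.< 1ℚ
    0<1 = ℚ.positive⁻¹ 1ℚ

  Eventually : (ℕ → Set) → Set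
  Eventually P = ∃[ N ] (∀ n → N ℕ.≤ n → P n)

  both : ∀ {P Q R : ℕ → Set} → (∀ n → P n → Q n → R n) → Eventually P → Eventually Q → Eventually R
  both f (M , p) (N , q) = M ⊔ N , λ n l →
    f n (p n (ℕ.m⊔n≤o⇒m≤o M N l)) (q n (ℕ.m⊔n≤o⇒n≤o M N l))

  eventually-map : ∀ {P Q : ℕ → Set} → (∀ n → P n → Q n) → Eventually P → Eventually Q
  eventually-map f (N , p) = N , λ n l → f n (p n l)

  -- Equality and order of reals both speak of the sequence of differences. The laws are proved for
  -- a single sequence that is null, or nonnegative up to every ε.
  Null NonNeg : (ℕ → ℚ) → Set
  Null   f = ∀ ε → 0ℚ ℚ.< ε → Eventually λ n → ℚ.∣ f n ∣ ℚ.< ε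
  NonNeg f = ∀ ε → 0ℚ ℚ.< ε → Eventually λ n → 0ℚ ℚ.< f n ℚ.+ ε

  Bounded : (ℕ → ℚ) → Set
  Bounded f = ∃[ B ] (0ℚ ℚ.< B × Eventually λ n → ℚ.∣ f n ∣ ℚ.≤ B)

  null-cong : ∀ {f g} → (∀ n → f n ≡ g n) → Null f → Null g
  null-cong e p ε 0<ε = eventually-map (λ n → subst (λ a → ℚ.∣ a ∣ ℚ.< ε) (e n)) (p ε 0<ε)

  null-zero : Null λ _ → 0ℚ
  null-zero ε 0<ε = 0 , λ _ _ → 0<ε

  null-neg : ∀ {f} → Null f → Null (ℚ.-_ ∘ f)
  null-neg {f} p ε 0<ε =
    eventually-map (λ n → subst (ℚ._< ε) (≡.sym (ℚ.∣-p∣≡∣p∣ (f n)))) (p ε 0<ε)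

  null-+ : ∀ {f g} → Null f → Null g → Null λ n → f n ℚ.+ g n
  null-+ {f} {g} p q ε 0<ε = both
    (λ n a b → ℚ.≤-<-trans (ℚ.∣p+q∣≤∣p∣+∣q∣ (f n) (g n))
        (subst (_ ℚ.<_) (halves ε) (ℚ.+-mono-< a b)))
    (p (½ ℚ.* ε) (0<½* 0<ε)) (q (½ ℚ.* ε) (0<½* 0<ε))

  divide : ∀ {B ε} → 0ℚ ℚ.< B → 0ℚ ℚ.< ε → ∃[ δ ] (0ℚ ℚ.< δ × B ℚ.* δ ≡ ε)
  divide {B} {ε} 0<B 0<ε = 1/B ℚ.* ε , 0<* (ℚ.positive⁻¹ 1/B {{ℚ.1/pos⇒pos B}}) 0<ε ,
    ≡.trans (≡.sym (ℚ.*-assoc B 1/B ε))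
            (≡.trans (cong (ℚ._* ε) (ℚ.*-inverseʳ B)) (ℚ.*-identityˡ ε))
    where
    instance
      B-pos = ℚ.positive 0<B
      B-nonZero = ℚ.pos⇒nonZero B
    1/B = ℚ.1/ B

  null-* : ∀ {f g} → Bounded f → Null g → Null λ n → f n ℚ.* g n
  null-* {f} {g} (B , 0<B , b) q ε 0<ε with δ , 0<δ , Bδ≡ε ← divide 0<B 0<ε = both
    (λ n fn gn → ℚ.≤-<-trans
      (ℚ.≤-trans (ℚ.≤-reflexive (ℚ.∣p*q∣≡∣p∣*∣q∣ (f n) (g n)))
                 (ℚ.*-monoʳ-≤-nonNeg ℚ.∣ g n ∣ {{ℚ.nonNegative (ℚ.0≤∣p∣ (g n))}} fn))
      (subst (B ℚ.* ℚ.∣ g n ∣ ℚ.<_) Bδ≡ε (ℚ.*-monoʳ-<-pos B {{ℚ.positive 0<B}} gn)))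
    b (q δ 0<δ)

  bounded : ∀ x → Bounded (seq x)
  bounded x with N , p ← cauchy x 1ℚ 0<1 = B , 0<B , N , bound
    where
    open +-*-Solver
    open ℚ.≤-Reasoning
    B = ℚ.∣ seq x N ∣ ℚ.+ 1ℚ
    0<B : 0ℚ ℚ.< B
    0<B = ℚ.<-≤-trans 0<1 (subst (ℚ._≤ B) (ℚ.+-identityˡ 1ℚ) (ℚ.+-monoˡ-≤ 1ℚ (ℚ.0≤∣p∣ (seq x N))))
    bound : ∀ n → N ℕ.≤ n → ℚ.∣ seq x n ∣ ℚ.≤ B
    bound n N≤n = begin
      ℚ.∣ seq x n ∣
        ≡⟨ cong ℚ.∣_∣ (solve 2 (λ a b → a := b :+ (a :- b)) refl (seq x n) (seq x N)) ⟩
      ℚ.∣ seq x N ℚ.+ (seq x n ℚ.- seq x N) ∣       ≤⟨ ℚ.∣p+q∣≤∣p∣+∣q∣ (seq x N) _ ⟩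
      ℚ.∣ seq x N ∣ ℚ.+ ℚ.∣ seq x n ℚ.- seq x N ∣
        ≤⟨ ℚ.+-monoʳ-≤ ℚ.∣ seq x N ∣ (ℚ.<⇒≤ (p n N N≤n ℕ.≤-refl)) ⟩
      B                                             ∎

  nonNeg-cong : ∀ {f g} → (∀ n → f n ≡ g n) → NonNeg f → NonNeg g
  nonNeg-cong e p ε 0<ε = eventually-map (λ n → subst (λ a → 0ℚ ℚ.< a ℚ.+ ε) (e n)) (p ε 0<ε)

  nonNeg-+ : ∀ {f g} → NonNeg f → NonNeg g → NonNeg λ n → f n ℚ.+ g n
  nonNeg-+ {f} {g} p q ε 0<ε = both
    (λ n a b → subst (0ℚ ℚ.<_) (split-ε (f n) (g n) ε) (ℚ.+-mono-< a b))
    (p (½ ℚ.* ε) (0<½* 0<ε)) (q (½ ℚ.* ε) (0<½* 0<ε))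

  p≤∣p∣ : ∀ p → p ℚ.≤ ℚ.∣ p ∣
  p≤∣p∣ p with ℚ.≤-total 0ℚ p
  ... | inj₁ 0≤p = ℚ.≤-reflexive (≡.sym (ℚ.0≤p⇒∣p∣≡p 0≤p))
  ... | inj₂ p≤0 = ℚ.≤-trans p≤0 (ℚ.0≤∣p∣ p)

  ∣a∣<ε⇒0<a+ε : ∀ {a ε} → ℚ.∣ a ∣ ℚ.< ε → 0ℚ ℚ.< a ℚ.+ ε
  ∣a∣<ε⇒0<a+ε {a} {ε} lt = ℚ.≤-<-trans
    (subst (ℚ._≤ a ℚ.+ ℚ.∣ a ∣) (ℚ.+-inverseʳ a)
      (ℚ.+-monoʳ-≤ a (subst (ℚ.- a ℚ.≤_) (ℚ.∣-p∣≡∣p∣ a) (p≤∣p∣ (ℚ.- a)))))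
    (ℚ.+-monoʳ-< a lt)

  null⇒nonNeg : ∀ {f} → Null f → NonNeg f
  null⇒nonNeg p ε 0<ε = eventually-map (λ n → ∣a∣<ε⇒0<a+ε) (p ε 0<ε)

  nonNeg-antisym : ∀ {f} → NonNeg f → NonNeg (ℚ.-_ ∘ f) → Null f
  nonNeg-antisym {f} p q ε 0<ε = both lemma (p ε 0<ε) (q ε 0<ε)
    where
    open +-*-Solver
    lemma : ∀ n → 0ℚ ℚ.< f n ℚ.+ ε → 0ℚ ℚ.< ℚ.- f n ℚ.+ ε → ℚ.∣ f n ∣ ℚ.< ε
    lemma n a b with ℚ.∣p∣≡p∨∣p∣≡-p (f n)
    ... | inj₁ e rewrite e = subst₂ ℚ._<_ (ℚ.+-identityˡ (f n))
      (solve 2 (λ a ε → (:- a :+ ε) :+ a := ε) refl (f n) ε) (ℚ.+-monoˡ-< (f n) b)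
    ... | inj₂ e rewrite e = subst₂ ℚ._<_ (ℚ.+-identityˡ (ℚ.- f n))
      (solve 2 (λ a ε → (a :+ ε) :+ (:- a) := ε) refl (f n) ε) (ℚ.+-monoˡ-< (ℚ.- f n) a)

  private
    negative-small : ∀ {a ε} → a ℚ.< 0ℚ → 0ℚ ℚ.< a ℚ.+ ε → ℚ.∣ a ∣ ℚ.< ε
    negative-small {a} {ε} a<0 0<a+ε with ℚ.∣p∣≡p∨∣p∣≡-p a
    ... | inj₁ e = contradiction (ℚ.≤-<-trans (ℚ.0≤∣p∣ a) (subst (ℚ._< 0ℚ) (≡.sym e) a<0))
        (ℚ.<-irrefl refl)
    ... | inj₂ e = subst₂ ℚ._<_ (≡.trans (ℚ.+-identityˡ (ℚ.- a)) (≡.sym e))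
      (solve 2 (λ a ε → (a :+ ε) :+ (:- a) := ε) refl a ε) (ℚ.+-monoˡ-< (ℚ.- a) 0<a+ε)
      where open +-*-Solver

    product-small : ∀ {a b B ε δ} → 0ℚ ℚ.< B → B ℚ.* δ ≡ ε → ℚ.∣ b ∣ ℚ.≤ B → ℚ.∣ a ∣ ℚ.< δ →
                    0ℚ ℚ.< b ℚ.* a ℚ.+ ε
    product-small {a} {b} {B} 0<B Bδ≡ε b≤B a<δ = ∣a∣<ε⇒0<a+ε (ℚ.≤-<-trans
      (ℚ.≤-trans (ℚ.≤-reflexive (ℚ.∣p*q∣≡∣p∣*∣q∣ b a))
                 (ℚ.*-monoʳ-≤-nonNeg ℚ.∣ a ∣ {{ℚ.nonNegative (ℚ.0≤∣p∣ a)}} b≤B))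
      (subst (B ℚ.* ℚ.∣ a ∣ ℚ.<_) Bδ≡ε (ℚ.*-monoʳ-<-pos B {{ℚ.positive 0<B}} a<δ)))

    0≤* : ∀ {a b} → 0ℚ ℚ.≤ a → 0ℚ ℚ.≤ b → 0ℚ ℚ.≤ a ℚ.* b
    0≤* {a} {b} 0≤a 0≤b = subst (ℚ._≤ a ℚ.* b) (ℚ.*-zeroʳ a)
      (ℚ.*-monoˡ-≤-nonNeg a {{ℚ.nonNegative 0≤a}} 0≤b)

  -- A factor that is negative at index n is tiny there, so the bound on the other factor keeps the
  -- product above -ε.
  nonNeg-* : ∀ {f g} → Bounded f → Bounded g → NonNeg f → NonNeg g → NonNeg λ n → f n ℚ.* g n
  nonNeg-* {f} {g} (A , 0<A , a) (B , 0<B , b) p q ε 0<ε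
    with δ , 0<δ , Bδ≡ε ← divide 0<B 0<ε
    with η , 0<η , Aη≡ε ← divide 0<A 0<ε =
    both (λ n (fn , gn) (fn′ , gn′) → lemma n fn gn fn′ gn′)
         (both (λ _ → _,_) a b) (both (λ _ → _,_) (p δ 0<δ) (q η 0<η))
    where
    lemma : ∀ n → ℚ.∣ f n ∣ ℚ.≤ A → ℚ.∣ g n ∣ ℚ.≤ B →
            0ℚ ℚ.< f n ℚ.+ δ → 0ℚ ℚ.< g n ℚ.+ η → 0ℚ ℚ.< f n ℚ.* g n ℚ.+ ε
    lemma n fn gn fn′ gn′ with f n ℚ.<? 0ℚ | g n ℚ.<? 0ℚ
    ... | yes f<0 | _       = subst (λ t → 0ℚ ℚ.< t ℚ.+ ε) (ℚ.*-comm (g n) (f n))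
      (product-small 0<B Bδ≡ε gn (negative-small f<0 fn′))
    ... | no  f≮0 | yes g<0 = product-small 0<A Aη≡ε fn (negative-small g<0 gn′)
    ... | no  f≮0 | no  g≮0 = ℚ.≤-<-trans (0≤* (ℚ.≮⇒≥ f≮0) (ℚ.≮⇒≥ g≮0))
      (subst (ℚ._< f n ℚ.* g n ℚ.+ ε) (ℚ.+-identityʳ _) (ℚ.+-monoʳ-< (f n ℚ.* g n) 0<ε))

  -- The relations of Defs, wrapped so that their arguments can be inferred

  infix 4 _≃_ _≼_

  record _≃_ (x y : ℝ) : Set where
    constructor ≈⇒≃
    field ≃⇒≈ : x D.≈ y

  record _≼_ (x y : ℝ) : Set where
    constructor nonNeg
    field difference : NonNeg λ n → seq y n ℚ.- seq x n

  open _≃_ public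
  open _≼_ public

  record Positive (x : ℝ) : Set where
    constructor positive
    field 0< : D.0ℝ D.< x

  open Positive public

  pointwise : ∀ {x y} → (∀ n → seq x n ≡ seq y n) → x ≃ y
  pointwise {x} {y} e = ≈⇒≃ (null-cong
    (λ n → ≡.sym (≡.trans (cong (ℚ._- seq y n) (e n)) (ℚ.+-inverseʳ (seq y n)))) null-zero)

  ≃-isEquivalence : IsEquivalence _≃_
  ≃-isEquivalence = record
    { refl  = pointwise λ _ → refl
    ; sym   = λ {x} {y} (≈⇒≃ e) → ≈⇒≃
        (null-cong (λ n → ≡.sym (minus-swap (seq x n) (seq y n))) (null-neg e))
    ; trans = λ {x} {y} {z} (≈⇒≃ e) (≈⇒≃ e′) → ≈⇒≃ (null-cong
        (λ n → ≡.sym (minus-trans (seq x n) (seq y n) (seq z n))) (null-+ e e′))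
    }

  -- The field operations are kept abstract: their Cauchy moduli are large
  -- terms, which unification would otherwise unfold and compare.

  infixl 6 _+_ _-_
  infixl 7 _*_
  infix  8 -_

  abstract
    _+_ _*_ : ℝ → ℝ → ℝ
    _+_ = D._+_
    _*_ = D._*_

    -_ : ℝ → ℝ
    -_ = D.-_

    fromℚ : ℚ → ℝ
    fromℚ = D.fromℚ

    +-def : ∀ x y → x + y ≃ x D.+ y
    +-def x y = pointwise λ _ → refl

    *-def : ∀ x y → x * y ≃ x D.* y
    *-def x y = pointwise λ _ → refl

    neg-def : ∀ x → - x ≃ D.- x
    neg-def x = pointwise λ _ → refl

    fromℚ-def : ∀ q → fromℚ q ≃ D.fromℚ q
    fromℚ-def q = pointwise λ _ → refl

  fromℤ : ℤ → ℝ
  fromℤ i = fromℚ (i / 1)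

  0ℝ 1ℝ : ℝ
  0ℝ = fromℚ 0ℚ
  1ℝ = fromℚ 1ℚ

  _-_ : ℝ → ℝ → ℝ
  x - y = x + (- y)

  abstract
      +-cong : ∀ {x x′ y y′} → x ≃ x′ → y ≃ y′ → x + y ≃ x′ + y′
      +-cong {x} {x′} {y} {y′} (≈⇒≃ e) (≈⇒≃ e′) = ≈⇒≃ (null-cong
        (λ n → ≡.sym (+-minus (seq x n) (seq x′ n) (seq y n) (seq y′ n))) (null-+ e e′))

      *-cong : ∀ {x x′ y y′} → x ≃ x′ → y ≃ y′ → x * y ≃ x′ * y′
      *-cong {x} {x′} {y} {y′} (≈⇒≃ e) (≈⇒≃ e′) = ≈⇒≃ (null-cong
        (λ n → ≡.sym (*-minus (seq x n) (seq x′ n) (seq y n) (seq y′ n)))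
        (null-+ (null-* (bounded x) e′) (null-* (bounded y′) e)))

      -‿cong : ∀ {x x′} → x ≃ x′ → - x ≃ - x′
      -‿cong {x} {x′} (≈⇒≃ e) = ≈⇒≃ (null-cong
        (λ n → ≡.sym (minus-neg (seq x n) (seq x′ n))) (null-neg e))

      +-assoc : ∀ x y z → (x + y) + z ≃ x + (y + z)
      +-assoc x y z = pointwise λ n → ℚ.+-assoc (seq x n) (seq y n) (seq z n)

      +-comm : ∀ x y → x + y ≃ y + x
      +-comm x y = pointwise λ n → ℚ.+-comm (seq x n) (seq y n)

      +-identityˡ : ∀ x → 0ℝ + x ≃ x
      +-identityˡ x = pointwise λ n → ℚ.+-identityˡ (seq x n)

      +-identityʳ : ∀ x → x + 0ℝ ≃ x
      +-identityʳ x = pointwise λ n → ℚ.+-identityʳ (seq x n)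

      +-inverseˡ : ∀ x → (- x) + x ≃ 0ℝ
      +-inverseˡ x = pointwise λ n → ℚ.+-inverseˡ (seq x n)

      +-inverseʳ : ∀ x → x + (- x) ≃ 0ℝ
      +-inverseʳ x = pointwise λ n → ℚ.+-inverseʳ (seq x n)

      *-assoc : ∀ x y z → (x * y) * z ≃ x * (y * z)
      *-assoc x y z = pointwise λ n → ℚ.*-assoc (seq x n) (seq y n) (seq z n)

      *-comm : ∀ x y → x * y ≃ y * x
      *-comm x y = pointwise λ n → ℚ.*-comm (seq x n) (seq y n)

      *-identityˡ : ∀ x → 1ℝ * x ≃ x
      *-identityˡ x = pointwise λ n → ℚ.*-identityˡ (seq x n)

      *-identityʳ : ∀ x → x * 1ℝ ≃ x
      *-identityʳ x = pointwise λ n → ℚ.*-identityʳ (seq x n)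

      distribˡ : ∀ x y z → x * (y + z) ≃ x * y + x * z
      distribˡ x y z = pointwise λ n → ℚ.*-distribˡ-+ (seq x n) (seq y n) (seq z n)

      distribʳ : ∀ x y z → (y + z) * x ≃ y * x + z * x
      distribʳ x y z = pointwise λ n → ℚ.*-distribʳ-+ (seq x n) (seq y n) (seq z n)

  ℝ-ring : CommutativeRing 0ℓ 0ℓ
  ℝ-ring = record
    { Carrier = ℝ ; _≈_ = _≃_ ; _+_ = _+_ ; _*_ = _*_ ; -_ = -_ ; 0# = 0ℝ ; 1# = 1ℝ
    ; isCommutativeRing = record
      { isRing = record
        { +-isAbelianGroup = record
          { isGroup = record
            { isMonoid = record
              { isSemigroup = record
                { isMagma = record { isEquivalence = ≃-isEquivalence ; ∙-cong = +-cong }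
                ; assoc = +-assoc }
              ; identity = +-identityˡ , +-identityʳ }
            ; inverse = +-inverseˡ , +-inverseʳ
            ; ⁻¹-cong = -‿cong }
          ; comm = +-comm }
        ; *-cong = *-cong
        ; *-assoc = *-assoc
        ; *-identity = *-identityˡ , *-identityʳ
        ; distrib = distribˡ , distribʳ }
      ; *-comm = *-comm } }

  module R where
    open CommutativeRing ℝ-ring public
      hiding (Carrier; _≈_; _+_; _*_; -_; 0#; 1#; _-_)
    open import Algebra.Properties.Ring (CommutativeRing.ring ℝ-ring) public
      using (-‿distribˡ-*; -‿involutive; -0#≈0#)
    open import Algebra.Properties.CommutativeSemigroup (CommutativeRing.+-commutativeSemigroup ℝ-ring) public
      using () renaming (interchange to +-interchange; x∙yz≈y∙xz to +-swapˡ)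

  ≼-respʳ-≃ : ∀ {x y y′} → y ≃ y′ → x ≼ y → x ≼ y′
  ≼-respʳ-≃ {x} {y} {y′} (≈⇒≃ e) (nonNeg p) = nonNeg (nonNeg-cong
    (λ n → lemma (seq x n) (seq y n) (seq y′ n))
        (nonNeg-+ {λ n → seq y n ℚ.- seq x n} {λ n → ℚ.- (seq y n ℚ.- seq y′ n)} p
        (null⇒nonNeg (null-neg e))))
    where
    open +-*-Solver
    lemma : ∀ a b b′ → (b ℚ.- a) ℚ.+ (ℚ.- (b ℚ.- b′)) ≡ b′ ℚ.- a
    lemma = solve 3 (λ a b b′ → (b :- a) :+ (:- (b :- b′)) := b′ :- a) refl

  ≼-respˡ-≃ : ∀ {x x′ y} → x ≃ x′ → x ≼ y → x′ ≼ y
  ≼-respˡ-≃ {x} {x′} {y} (≈⇒≃ e) (nonNeg p) = nonNeg (nonNeg-cong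
    (λ n → lemma (seq x n) (seq x′ n) (seq y n))
        (nonNeg-+ {λ n → seq y n ℚ.- seq x n} {λ n → seq x n ℚ.- seq x′ n} p (null⇒nonNeg e)))
    where
    open +-*-Solver
    lemma : ∀ a a′ b → (b ℚ.- a) ℚ.+ (a ℚ.- a′) ≡ b ℚ.- a′
    lemma = solve 3 (λ a a′ b → (b :- a) :+ (a :- a′) := b :- a′) refl

  ≼-reflexive : ∀ {x y} → x ≃ y → x ≼ y
  ≼-reflexive {x} {y} (≈⇒≃ e) = nonNeg (nonNeg-cong
    (λ n → ≡.sym (minus-swap (seq x n) (seq y n))) (null⇒nonNeg (null-neg e)))

  ≼-refl : ∀ {x} → x ≼ x
  ≼-refl = ≼-reflexive (IsEquivalence.refl ≃-isEquivalence)

  ≼-trans : ∀ {x y z} → x ≼ y → y ≼ z → x ≼ z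
  ≼-trans {x} {y} {z} (nonNeg p) (nonNeg q) = nonNeg (nonNeg-cong
    (λ n → ≡.sym (minus-trans (seq z n) (seq y n) (seq x n)))
        (nonNeg-+ {λ n → seq z n ℚ.- seq y n} {λ n → seq y n ℚ.- seq x n} q p))

  ≼-antisym : ∀ {x y} → x ≼ y → y ≼ x → x ≃ y
  ≼-antisym {x} {y} (nonNeg p) (nonNeg q) = ≈⇒≃ (nonNeg-antisym q
    (nonNeg-cong (λ n → minus-swap (seq x n) (seq y n)) p))

  abstract
    +-mono-≼ : ∀ {x x′ y y′} → x ≼ x′ → y ≼ y′ → x + y ≼ x′ + y′
    +-mono-≼ {x} {x′} {y} {y′} (nonNeg p) (nonNeg q) = nonNeg (nonNeg-cong
      (λ n → ≡.sym (+-minus (seq x′ n) (seq x n) (seq y′ n) (seq y n)))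
          (nonNeg-+ {λ n → seq x′ n ℚ.- seq x n} {λ n → seq y′ n ℚ.- seq y n} p q))

  ≤⇒≼ : ∀ {x y} → x D.≤ y → x ≼ y
  ≤⇒≼ {x} {y} p = nonNeg λ ε 0<ε → eventually-map (λ n lt → subst₂ ℚ._<_
    (ℚ.+-inverseʳ (seq x n)) (move-to-left (seq x n) (seq y n) ε) (ℚ.+-monoˡ-< (ℚ.- seq x n) lt))
        (p ε 0<ε)

  ≼⇒≤ : ∀ {x y} → x ≼ y → x D.≤ y
  ≼⇒≤ {x} {y} (nonNeg p) ε 0<ε = eventually-map (λ n lt → subst₂ ℚ._<_
    (ℚ.+-identityˡ (seq x n)) (move-to-right (seq x n) (seq y n) ε) (ℚ.+-monoˡ-< (seq x n) lt))
        (p ε 0<ε)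

  abstract
    0≼⇒NonNeg : ∀ {x} → 0ℝ ≼ x → NonNeg (seq x)
    0≼⇒NonNeg {x} (nonNeg p) = nonNeg-cong (λ n → minus-zero (seq x n)) p

    NonNeg⇒0≼ : ∀ {x} → NonNeg (seq x) → 0ℝ ≼ x
    NonNeg⇒0≼ {x} p = nonNeg (nonNeg-cong (λ n → ≡.sym (minus-zero (seq x n))) p)

    0≼-* : ∀ {x y} → 0ℝ ≼ x → 0ℝ ≼ y → 0ℝ ≼ x * y
    0≼-* {x} {y} p q = NonNeg⇒0≼ {x * y}
      (nonNeg-* {seq x} {seq y} (bounded x) (bounded y) (0≼⇒NonNeg {x} p) (0≼⇒NonNeg {y} q))

    0≼⇒≼ : ∀ {x y} → 0ℝ ≼ y - x → x ≼ y
    0≼⇒≼ {x} {y} p = nonNeg (0≼⇒NonNeg {y - x} p)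

    ≼⇒0≼ : ∀ {x y} → x ≼ y → 0ℝ ≼ y - x
    ≼⇒0≼ {x} {y} (nonNeg p) = NonNeg⇒0≼ {y - x} p

    *-monoˡ-≼ : ∀ {x y z} → 0ℝ ≼ x → y ≼ z → x * y ≼ x * z
    *-monoˡ-≼ {x} {y} {z} p q = 0≼⇒≼ {x * y} {x * z} (≼-respʳ-≃ {0ℝ} {x * (z - y)} {x * z - x * y}
      (pointwise λ n → *-distrib-minus (seq x n) (seq y n) (seq z n))
      (0≼-* {x} {z - y} p (≼⇒0≼ {y} {z} q)))

    +-cancelʳ-≼ : ∀ {x y} z → x + z ≼ y + z → x ≼ y
    +-cancelʳ-≼ {x} {y} z p = 0≼⇒≼ {x} {y} (≼-respʳ-≃ {0ℝ} {(y + z) - (x + z)} {y - x}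
      (pointwise λ n → minus-cancelʳ (seq x n) (seq y n) (seq z n))
      (≼⇒0≼ {x + z} {y + z} p))

  abstract
    positive⇒≼ : ∀ {x} → Positive x → 0ℝ ≼ x
    positive⇒≼ {x} (positive (α , 0<α , N , p)) = NonNeg⇒0≼ {x} λ ε 0<ε → N , λ n l →
      ℚ.<-trans (ℚ.<-trans (subst (0ℚ ℚ.<_) (≡.sym (ℚ.+-identityˡ α)) 0<α) (p n l))
        (subst (ℚ._< seq x n ℚ.+ ε) (ℚ.+-identityʳ _) (ℚ.+-monoʳ-< (seq x n) 0<ε))

    -- If some term of y were at least ε, the product there would be at least α ε, where α bounds x
    -- from below. Only rationals are compared.
    *-cancel-≼0 : ∀ {x y} → Positive x → x * y ≼ 0ℝ → y ≼ 0ℝ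
    *-cancel-≼0 {x} {y} (positive (α , 0<α , M , p)) (nonNeg h) = nonNeg λ ε 0<ε →
      both (λ n a b → lemma ε 0<ε n a b) (M , p) (h (α ℚ.* ε) (0<* 0<α 0<ε))
      where
      open +-*-Solver
      lemma : ∀ ε → 0ℚ ℚ.< ε → ∀ n → 0ℚ ℚ.+ α ℚ.< seq x n →
              0ℚ ℚ.< (0ℚ ℚ.- seq x n ℚ.* seq y n) ℚ.+ α ℚ.* ε → 0ℚ ℚ.< (0ℚ ℚ.- seq y n) ℚ.+ ε
      lemma ε 0<ε n α<x h with seq y n ℚ.<? ε
      ... | yes y<ε = subst₂ ℚ._<_ (ℚ.+-inverseʳ (seq y n))
        (solve 2 (λ y ε → ε :- y := (con 0ℚ :- y) :+ ε) refl (seq y n) ε)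
        (ℚ.+-monoˡ-< (ℚ.- seq y n) y<ε)
      ... | no  y≮ε = contradiction (ℚ.<-≤-trans xy<αε (ℚ.≤-trans
          (ℚ.*-monoˡ-≤-nonNeg α {{ℚ.nonNegative (ℚ.<⇒≤ 0<α)}} ε≤y)
          (ℚ.*-monoʳ-≤-nonNeg (seq y n) {{ℚ.nonNegative (ℚ.≤-trans (ℚ.<⇒≤ 0<ε) ε≤y)}}
            (ℚ.<⇒≤ (subst (ℚ._< seq x n) (ℚ.+-identityˡ α) α<x)))))
        (ℚ.<-irrefl refl)
        where
        ε≤y : ε ℚ.≤ seq y n
        ε≤y = ℚ.≮⇒≥ y≮ε
        xy<αε : seq x n ℚ.* seq y n ℚ.< α ℚ.* ε
        xy<αε = subst₂ ℚ._<_ (ℚ.+-identityˡ _)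
          (solve 2 (λ p q → ((con 0ℚ :- p) :+ q) :+ p := q) refl (seq x n ℚ.* seq y n) (α ℚ.* ε))
          (ℚ.+-monoˡ-< (seq x n ℚ.* seq y n) h)

    positive-resp-≃ : ∀ {x y} → x ≃ y → Positive x → Positive y
    positive-resp-≃ {x} {y} (≈⇒≃ e) (positive (α , 0<α , p)) = positive $ ½ ℚ.* α , 0<½* 0<α ,
        both lemma p (e (½ ℚ.* α) (0<½* 0<α))
      where
      open +-*-Solver
      lemma : ∀ n → 0ℚ ℚ.+ α ℚ.< seq x n → ℚ.∣ seq x n ℚ.- seq y n ∣ ℚ.< ½ ℚ.* α →
          0ℚ ℚ.+ ½ ℚ.* α ℚ.< seq y n
      lemma n a d = subst₂ ℚ._<_
        (solve 2 (λ x α → (con 0ℚ :+ α) :+ x :- (x :+ con ½ :* α) := con 0ℚ :+ con ½ :* α) refl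
            (seq x n) α)
        (solve 3 (λ x y α → x :+ (y :+ con ½ :* α) :- (x :+ con ½ :* α) := y) refl (seq x n)
            (seq y n) α)
        (ℚ.+-monoˡ-< (ℚ.- (seq x n ℚ.+ ½ ℚ.* α)) (ℚ.+-mono-< a x<))
        where
        x< : seq x n ℚ.< seq y n ℚ.+ ½ ℚ.* α
        x< = subst (ℚ._< _)
          (solve 2 (λ x y → (x :- y) :+ y := x) refl (seq x n) (seq y n))
          (subst ((seq x n ℚ.- seq y n) ℚ.+ seq y n ℚ.<_) (ℚ.+-comm (½ ℚ.* α) (seq y n))
            (ℚ.+-monoˡ-< (seq y n) (ℚ.≤-<-trans (p≤∣p∣ _) d)))

    -- Let α be a lower bound of the sum and take a term of x accurate to α/4. If it reaches α/2,
    -- then x stays above α/4; otherwise x stays below 3α/4 and y above α/4.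
    +-positive : ∀ {x y} → Positive (x + y) → Positive x ⊎ Positive y
    +-positive {x} {y} (positive (α , 0<α , M , p)) with cauchy x (½ ℚ.* (½ ℚ.* α))
        (0<½* (0<½* 0<α))
    ... | K , c with ½ ℚ.* α ℚ.≤? seq x K
    ...   | yes large = inj₁ (positive
        (¼α , 0<½* (0<½* 0<α) , K , λ n l → lemma n (c K n ℕ.≤-refl l)))
      where
      open +-*-Solver
      ¼α : ℚ
      ¼α = ½ ℚ.* (½ ℚ.* α)
      lemma : ∀ n → ℚ.∣ seq x K ℚ.- seq x n ∣ ℚ.< ¼α → 0ℚ ℚ.+ ¼α ℚ.< seq x n
      lemma n d = subst₂ ℚ._<_
        (solve 3 (λ x α xK → (xK :- x) :+ con ½ :* α :- (xK :- x :+ con ½ :* (con ½ :* α)) := con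
            0ℚ :+ con ½ :* (con ½ :* α)) refl (seq x n) α (seq x K))
        (solve 3 (λ x α xK → con ½ :* (con ½ :* α) :+ xK :- (xK :- x :+ con ½ :* (con ½ :* α)) :=
            x) refl (seq x n) α (seq x K))
        (ℚ.+-monoˡ-< (ℚ.- (seq x K ℚ.- seq x n ℚ.+ ¼α))
            (ℚ.+-mono-<-≤ (ℚ.≤-<-trans (p≤∣p∣ _) d) large))
    ...   | no  small = inj₂ (positive
        (¼α , 0<½* (0<½* 0<α) , both lemma (M , p) (K , λ n l → c n K l ℕ.≤-refl)))
      where
      open +-*-Solver
      ¼α : ℚ
      ¼α = ½ ℚ.* (½ ℚ.* α)
      lemma : ∀ n → 0ℚ ℚ.+ α ℚ.< seq x n ℚ.+ seq y n → ℚ.∣ seq x n ℚ.- seq x K ∣ ℚ.< ¼α →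
              0ℚ ℚ.+ ¼α ℚ.< seq y n
      lemma n a d = subst₂ ℚ._<_
        (solve 3 (λ x α xK → ((con 0ℚ :+ α) :+ (x :- xK)) :+ xK :-
            (x :+ con ½ :* α :+ con ½ :* (con ½ :* α)) := con 0ℚ :+ con ½ :* (con ½ :* α)) refl
            (seq x n) α (seq x K))
        (solve 3 (λ x y α → ((x :+ y) :+ con ½ :* (con ½ :* α)) :+ con ½ :* α :-
            (x :+ con ½ :* α :+ con ½ :* (con ½ :* α)) := y) refl (seq x n) (seq y n) α)
        (ℚ.+-monoˡ-< (ℚ.- (seq x n ℚ.+ ½ ℚ.* α ℚ.+ ¼α))
          (ℚ.+-mono-< (ℚ.+-mono-< a (ℚ.≤-<-trans (p≤∣p∣ _) d)) (ℚ.≰⇒> small)))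

  abstract
    fromℚ-* : ∀ p q → fromℚ (p ℚ.* q) ≃ fromℚ p * fromℚ q
    fromℚ-* p q = pointwise λ _ → refl

    fromℤ-+ : ∀ i j → fromℤ (i ℤ.+ j) ≃ fromℤ i + fromℤ j
    fromℤ-+ i j = pointwise λ _ → /1-+ i j

    fromℤ-neg : ∀ i → fromℤ (ℤ.- i) ≃ - fromℤ i
    fromℤ-neg i = pointwise λ _ → /1-neg i

    fromℚ-mono : ∀ {p q} → p ℚ.≤ q → fromℚ p ≼ fromℚ q
    fromℚ-mono {p} {q} p≤q = 0≼⇒≼ {fromℚ p} {fromℚ q}
        (NonNeg⇒0≼ {fromℚ q - fromℚ p} λ ε 0<ε → 0 , λ _ _ → ℚ.<-≤-trans 0<ε
      (subst (ℚ._≤ (q ℚ.- p) ℚ.+ ε) (ℚ.+-identityˡ ε) (ℚ.+-monoˡ-≤ ε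
        (subst (ℚ._≤ q ℚ.- p) (ℚ.+-inverseʳ p) (ℚ.+-monoˡ-≤ (ℚ.- p) p≤q)))))

    fromℚ-cancel : ∀ {p q} → fromℚ p ≼ fromℚ q → p ℚ.≤ q
    fromℚ-cancel {p} {q} (nonNeg h) with p ℚ.≤? q
    ... | yes p≤q = p≤q
    ... | no  p≰q with N , k ← h (p ℚ.- q) (subst (ℚ._< p ℚ.- q) (ℚ.+-inverseʳ q) (ℚ.+-monoˡ-< (ℚ.- q) (ℚ.≰⇒> p≰q)))
      = contradiction (subst (0ℚ ℚ.<_) (lemma p q) (k N ℕ.≤-refl)) (ℚ.<-irrefl refl)
      where
      open +-*-Solver
      lemma : ∀ p q → (q ℚ.- p) ℚ.+ (p ℚ.- q) ≡ 0ℚ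
      lemma = solve 2 (λ p q → (q :- p) :+ (p :- q) := con 0ℚ) refl

    fromℤ-mono : ∀ {i j} → i ℤ.≤ j → fromℤ i ≼ fromℤ j
    fromℤ-mono i≤j = fromℚ-mono (/1-mono-≤ i≤j)

    fromℤ-cancel : ∀ {i j} → fromℤ i ≼ fromℤ j → i ℤ.≤ j
    fromℤ-cancel h = /1-cancel-≤ (fromℚ-cancel h)

  D-+ : ∀ x y {x′ y′} → x ≃ x′ → y ≃ y′ → x D.+ y ≃ x′ + y′
  D-+ x y p q = R.trans (R.sym (+-def x y)) (R.+-cong p q)

  D-* : ∀ x y {x′ y′} → x ≃ x′ → y ≃ y′ → x D.* y ≃ x′ * y′
  D-* x y p q = R.trans (R.sym (*-def x y)) (R.*-cong p q)

  D-0ℝ : D.0ℝ ≃ 0ℝ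
  D-0ℝ = R.sym (fromℚ-def 0ℚ)

  D-1ℝ : D.1ℝ ≃ 1ℝ
  D-1ℝ = R.sym (fromℚ-def 1ℚ)

  D-fromℤ : ∀ i → D.fromℤ i ≃ fromℤ i
  D-fromℤ i = R.sym (fromℚ-def (i / 1))

  +-≼-0 : ∀ {x y} → 0ℝ ≼ x → 0ℝ ≼ y → 0ℝ ≼ x + y
  +-≼-0 p q = ≼-respˡ-≃ (R.+-identityˡ 0ℝ) (+-mono-≼ p q)

  ¬1≼0 : ¬ 1ℝ ≼ 0ℝ
  ¬1≼0 h = ℚ.<-irrefl refl (ℚ.<-≤-trans (ℚ.positive⁻¹ 1ℚ) (fromℚ-cancel h))

  positive⇒⋠0 : ∀ {x} → Positive x → ¬ x ≼ 0ℝ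
  positive⇒⋠0 {x} p x≼0 = ¬1≼0 (*-cancel-≼0 p (≼-respˡ-≃ (R.sym (R.*-identityʳ x)) x≼0))

  ¬positive-0 : ¬ Positive 0ℝ
  ¬positive-0 p = positive⇒⋠0 p ≼-refl

-- Real-rootedness depends only on the coefficients

module RealRoots where

  open import Defs using (Poly)
  open Polynomial using (_≋_; at; coeff; IsZero-resp-≋)
  open Reals

  private
    record _≃ᶜ_ (z w : ℝ × ℝ) : Set where
      constructor _,_
      field
        re≃ : proj₁ z ≃ proj₁ w
        im≃ : proj₂ z ≃ proj₂ w

    ≃ᶜ-trans : ∀ {z w v} → z ≃ᶜ w → w ≃ᶜ v → z ≃ᶜ v
    ≃ᶜ-trans (p , q) (p′ , q′) = R.trans p p′ , R.trans q q′

    ≃ᶜ-sym : ∀ {z w} → z ≃ᶜ w → w ≃ᶜ z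
    ≃ᶜ-sym (p , q) = R.sym p , R.sym q

    module _ (x y : ℝ) where

      horner : ℚ → ℝ × ℝ → ℝ × ℝ
      horner a (u , v) = fromℚ a + (x * u - y * v) , 0ℝ + (x * v + y * u)

      -- Evaluation by real and imaginary parts with the abstract real operations, so that the ring
      -- laws apply.
      ev : Poly → ℝ × ℝ
      ev []      = 0ℝ , 0ℝ
      ev (a ∷ p) = horner a (ev p)

      horner-cong : ∀ a {w w′} → w ≃ᶜ w′ → horner a w ≃ᶜ horner a w′
      horner-cong a (p , q) =
        R.+-congˡ (R.+-cong (R.*-congˡ p) (R.-‿cong (R.*-congˡ q))) ,
        R.+-congˡ (R.+-cong (R.*-congˡ q) (R.*-congˡ p))

      horner-zero : ∀ {w} → w ≃ᶜ (0ℝ , 0ℝ) → horner 0ℚ w ≃ᶜ (0ℝ , 0ℝ)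
      horner-zero e = ≃ᶜ-trans (horner-cong 0ℚ e)
        (R.trans (R.+-identityˡ _)
            (R.trans (R.+-cong (R.zeroʳ x) (R.-‿cong (R.zeroʳ y))) (R.-‿inverseʳ 0ℝ)) ,
         R.trans (R.+-identityˡ _) (R.trans (R.+-cong (R.zeroʳ x) (R.zeroʳ y)) (R.+-identityˡ 0ℝ)))

      ev-zero : ∀ p → (∀ n → coeff p n ≡ 0ℚ) → ev p ≃ᶜ (0ℝ , 0ℝ)
      ev-zero []      z = R.refl , R.refl
      ev-zero (a ∷ p) z with refl ← z 0 = horner-zero (ev-zero p (z ∘ suc))

      ev-cong : ∀ p q → (∀ n → coeff p n ≡ coeff q n) → ev p ≃ᶜ ev q
      ev-cong []      q       e = ≃ᶜ-sym (ev-zero q (≡.sym ∘ e))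
      ev-cong (a ∷ p) []      e = ev-zero (a ∷ p) e
      ev-cong (a ∷ p) (b ∷ q) e with refl ← e 0 = horner-cong a (ev-cong p q (e ∘ suc))

    re-+ : ∀ z w → re (z +ᶜ w) ≃ re z + re w
    re-+ z w = R.sym (+-def (re z) (re w))

    im-+ : ∀ z w → im (z +ᶜ w) ≃ im z + im w
    im-+ z w = R.sym (+-def (im z) (im w))

    minus-def : ∀ x y → x D.- y ≃ x - y
    minus-def x y = R.trans (R.sym (+-def x (D.- y))) (R.+-congˡ (R.sym (neg-def y)))

    re-* : ∀ z w → re (z *ᶜ w) ≃ re z * re w - im z * im w
    re-* z w = R.trans (minus-def (re z D.* re w) (im z D.* im w))
      (R.+-cong (R.sym (*-def (re z) (re w))) (R.-‿cong (R.sym (*-def (im z) (im w)))))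

    im-* : ∀ z w → im (z *ᶜ w) ≃ re z * im w + im z * re w
    im-* z w = R.trans (R.sym (+-def (re z D.* im w) (im z D.* re w)))
      (R.+-cong (R.sym (*-def (re z) (im w))) (R.sym (*-def (im z) (re w))))

    eval-∷ : ∀ a p z → eval (a ∷ p) z ≡ fromℝ (D.fromℚ a) +ᶜ z *ᶜ eval p z
    eval-∷ a p z = refl

    parts : ℂ → ℝ × ℝ
    parts z = re z , im z

    parts-horner : ∀ z r w → parts (r +ᶜ z *ᶜ w) ≃ᶜ
      (re r + (re z * re w - im z * im w) , im r + (re z * im w + im z * re w))
    parts-horner z r w =
      R.trans {re (r +ᶜ z *ᶜ w)} {re r + re (z *ᶜ w)} (re-+ r (z *ᶜ w)) (R.+-congˡ (re-* z w)) ,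
      R.trans {im (r +ᶜ z *ᶜ w)} {im r + im (z *ᶜ w)} (im-+ r (z *ᶜ w)) (R.+-congˡ (im-* z w))

    parts-fromℝ : ∀ x y a w →
        (D.fromℚ a + (x * proj₁ w - y * proj₂ w) , D.0ℝ + (x * proj₂ w + y * proj₁ w)) ≃ᶜ
                  horner x y a w
    parts-fromℝ x y a w = R.+-congʳ (R.sym (fromℚ-def a)) , R.+-congʳ (R.sym (fromℚ-def 0ℚ))

    eval≃ev : ∀ z p → parts (eval p z) ≃ᶜ ev (re z) (im z) p
    eval≃ev z []      = R.sym (fromℚ-def 0ℚ) , R.sym (fromℚ-def 0ℚ)
    eval≃ev z (a ∷ p) = ≡.subst (λ e → parts e ≃ᶜ ev (re z) (im z) (a ∷ p)) (≡.sym (eval-∷ a p z))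
      (≃ᶜ-trans {parts (fromℝ (D.fromℚ a) +ᶜ z *ᶜ eval p z)}
        (parts-horner z (fromℝ (D.fromℚ a)) (eval p z))
        (≃ᶜ-trans (parts-fromℝ (re z) (im z) a (parts (eval p z)))
                  (horner-cong (re z) (im z) a (eval≃ev z p))))

    0-parts : ∀ {w} → w ≈ᶜ D.0ᶜ → parts w ≃ᶜ parts D.0ᶜ
    0-parts (e , e′) = ≈⇒≃ e , ≈⇒≃ e′

    parts-0 : ∀ {w} → parts w ≃ᶜ parts D.0ᶜ → w ≈ᶜ D.0ᶜ
    parts-0 (≈⇒≃ e , ≈⇒≃ e′) = e , e′

  -- Trailing zeros only add z · 0 to the Horner scheme, so p and q take equal values and a root of
  -- q is a root of p.
  OnlyRealRoots-resp-≋ : ∀ {p q} → p ≋ q → OnlyRealRoots p → OnlyRealRoots q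
  OnlyRealRoots-resp-≋         e (inj₁ zero-p) = inj₁ (IsZero-resp-≋ e zero-p)
  OnlyRealRoots-resp-≋ {p} {q} e (inj₂ real)   = inj₂ λ z root → real z (parts-0 {eval p z}
    (≃ᶜ-trans {parts (eval p z)} {parts (eval q z)} {parts D.0ᶜ}
      (≃ᶜ-trans {parts (eval p z)} {ev (re z) (im z) p} {parts (eval q z)} (eval≃ev z p)
        (≃ᶜ-trans {ev (re z) (im z) p} {ev (re z) (im z) q} {parts (eval q z)}
          (ev-cong (re z) (im z) p q (at e)) (≃ᶜ-sym {parts (eval q z)} (eval≃ev z q))))
      (0-parts {eval q z} root)))

-- Finite sums and linear functionals

module Sums where

  open import Data.Fin using (join)

  open Reals
  open import Algebra.Properties.Semiring.Sum (CommutativeRing.semiring ℝ-ring) public using (sum-cong-≋; ∑-distrib-+; ∑-comm; *-distribˡ-sum; *-distribʳ-sum) renaming (sum to ∑)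

  ∑-mono : ∀ {n} {f g : Vector ℝ n} → (∀ i → f i ≼ g i) → ∑ f ≼ ∑ g
  ∑-mono {zero}  h = ≼-refl
  ∑-mono {suc n} h = +-mono-≼ (h zero) (∑-mono (h ∘ suc))

  ∑-zero : ∀ {n} {f : Vector ℝ n} → (∀ i → f i ≃ 0ℝ) → ∑ f ≃ 0ℝ
  ∑-zero {zero}  h = R.refl
  ∑-zero {suc n} h = R.trans (R.+-cong (h zero) (∑-zero (h ∘ suc))) (R.+-identityˡ 0ℝ)

  ∑-nonneg : ∀ {n} {f : Vector ℝ n} → (∀ i → 0ℝ ≼ f i) → 0ℝ ≼ ∑ f
  ∑-nonneg {zero}  h = ≼-refl
  ∑-nonneg {suc n} h = +-≼-0 (h zero) (∑-nonneg (h ∘ suc))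

  ∑-term-≼ : ∀ {n} {f : Vector ℝ n} → (∀ i → 0ℝ ≼ f i) → ∀ i → f i ≼ ∑ f
  ∑-term-≼ h zero    = ≼-respˡ-≃ (R.+-identityʳ _) (+-mono-≼ ≼-refl (∑-nonneg (h ∘ suc)))
  ∑-term-≼ h (suc i) = ≼-respˡ-≃ (R.+-identityˡ _) (+-mono-≼ (h zero) (∑-term-≼ (h ∘ suc) i))

  ∑-split : ∀ m {n} (f : Vector ℝ (m ℕ.+ n)) → ∑ f ≃ ∑ (λ i → f (i ↑ˡ n)) + ∑ (λ j → f (m ↑ʳ j))
  ∑-split zero    f = R.sym (R.+-identityˡ _)
  ∑-split (suc m) f = R.trans (R.+-congˡ (∑-split m (f ∘ suc))) (R.sym (R.+-assoc _ _ _))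

  ∑-single : ∀ {n} (f : Vector ℝ n) i → (∀ j → j ≢ i → f j ≃ 0ℝ) → ∑ f ≃ f i
  ∑-single f zero    h = R.trans (R.+-congˡ (∑-zero λ j → h (suc j) λ ())) (R.+-identityʳ _)
  ∑-single f (suc i) h = R.trans
    (R.+-cong (h zero λ ()) (∑-single (f ∘ suc) i λ j j≢i → h (suc j) λ { refl → j≢i refl }))
    (R.+-identityˡ _)

  -- `+-positive` picks a side at each summand, so an index is found without deciding the sign of a
  -- real number.
  ∑-positive : ∀ {n} (f : Vector ℝ n) → Positive (∑ f) → ∃[ i ] Positive (f i)
  ∑-positive {zero}  f p = contradiction p ¬positive-0
  ∑-positive {suc n} f p with +-positive p
  ... | inj₁ p₀ = zero , p₀
  ... | inj₂ p₊ with i , pᵢ ← ∑-positive (f ∘ suc) p₊ = suc i , pᵢ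

  private
    -- One induction serves sums of reals and, read coordinate by coordinate, sums of points.
    foldr-∑ : ∀ {A : Set} (_•_ : A → A → A) (z : A) (_~_ : A → ℝ → Set) → z ~ 0ℝ →
              (∀ a b {x y} → a ~ x → b ~ y → (a • b) ~ (x + y)) →
              ∀ {n} (f : Vector A n) {g} → (∀ i → f i ~ g i) → foldrᵛ _•_ z f ~ ∑ g
    foldr-∑ _•_ z _~_ z~0 •~+ {zero}  f h = z~0
    foldr-∑ _•_ z _~_ z~0 •~+ {suc n} f h =
      •~+ (f zero) _ (h zero) (foldr-∑ _•_ z _~_ z~0 •~+ (f ∘ suc) (h ∘ suc))

  ∑ᵛ≃∑ : ∀ {n} (f : Vector ℝ n) {g} → (∀ i → f i ≃ g i) → D.∑ᵛ f ≃ ∑ g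
  ∑ᵛ≃∑ f = foldr-∑ D._+_ D.0ℝ _≃_ D-0ℝ D-+ f

  ∑ᵖ≃∑ : ∀ {m n} (p : Vector (D.Point n) m) i → D.∑ᵖ p i ≃ ∑ (λ j → p j i)
  ∑ᵖ≃∑ p i = foldr-∑ D._+ᵖ_ D.0ᵖ (λ u x → u i ≃ x) D-0ℝ (λ u v → D-+ (u i) (v i)) p (λ _ → R.refl)

  infix 7 _∙_
  _∙_ : ∀ {n} → Vector ℝ n → Vector ℝ n → ℝ
  u ∙ v = ∑ λ i → u i * v i

  ∙-def : ∀ {n} (u v : Vector ℝ n) → u D.∙ v ≃ u ∙ v
  ∙-def u v = ∑ᵛ≃∑ (λ i → u i D.* v i) λ i → D-* (u i) (v i) R.refl R.refl

  ∙-+ : ∀ {n} (u v w : Vector ℝ n) → u ∙ (λ i → v i + w i) ≃ u ∙ v + u ∙ w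
  ∙-+ u v w = R.trans (sum-cong-≋ λ i → R.distribˡ (u i) (v i) (w i))
    (∑-distrib-+ (λ i → u i * v i) (λ i → u i * w i))

  ∙-cong : ∀ {n} (u : Vector ℝ n) {v w} → (∀ i → v i ≃ w i) → u ∙ v ≃ u ∙ w
  ∙-cong u h = sum-cong-≋ λ i → R.*-congˡ (h i)

  unit : ∀ {n} → Fin n → Vector ℝ n
  unit i j = if does (i ≟ j) then 1ℝ else 0ℝ

  unit-same : ∀ {n} (i : Fin n) → unit i i ≃ 1ℝ
  unit-same i rewrite dec-true (i ≟ i) refl = R.refl

  unit-other : ∀ {n} (i j : Fin n) → i ≢ j → unit i j ≃ 0ℝ
  unit-other i j i≢j rewrite dec-false (i ≟ j) i≢j = R.refl

  basis≃unit : ∀ {n} (i j : Fin n) → D.basis i j ≃ unit i j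
  basis≃unit i j with does (i ≟ j)
  ... | true  = D-1ℝ
  ... | false = D-0ℝ

  0≼1 : 0ℝ ≼ 1ℝ
  0≼1 = fromℚ-mono (ℚ.<⇒≤ (ℚ.positive⁻¹ 1ℚ))

  unit-nonneg : ∀ {n} (i j : Fin n) → 0ℝ ≼ unit i j
  unit-nonneg i j with does (i ≟ j)
  ... | true  = 0≼1
  ... | false = ≼-refl

  ∑-unit : ∀ {n} (i : Fin n) → ∑ (unit i) ≃ 1ℝ
  ∑-unit i = R.trans (∑-single (unit i) i (λ j j≢i → unit-other i j (j≢i ∘ ≡.sym))) (unit-same i)

  ∙-unit : ∀ {n} (u : Vector ℝ n) i → u ∙ unit i ≃ u i
  ∙-unit u i = R.trans
    (∑-single (λ j → u j * unit i j) i λ j j≢i → R.trans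
        (R.*-congˡ (unit-other i j (j≢i ∘ ≡.sym))) (R.zeroʳ (u j)))
    (R.trans (R.*-congˡ (unit-same i)) (R.*-identityʳ (u i)))

  elim-+ : ∀ m {n} (P : Fin (m ℕ.+ n) → Set) → (∀ i → P (i ↑ˡ n)) → (∀ j → P (m ↑ʳ j)) → ∀ k → P k
  elim-+ m {n} P l r k with splitAt m k in eq
  ... | inj₁ i = ≡.subst P (≡.trans (≡.sym (cong (join m n) eq)) (join-splitAt m n k)) (l i)
  ... | inj₂ j = ≡.subst P (≡.trans (≡.sym (cong (join m n) eq)) (join-splitAt m n k)) (r j)

  ++ᶠ-↑ˡ : ∀ {m n} (u : Vector ℝ m) (v : Vector ℝ n) i → (u ++ᶠ v) (i ↑ˡ n) ≡ u i
  ++ᶠ-↑ˡ {m} {n} u v i rewrite splitAt-↑ˡ m i n = refl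

  ++ᶠ-↑ʳ : ∀ {m n} (u : Vector ℝ m) (v : Vector ℝ n) j → (u ++ᶠ v) (m ↑ʳ j) ≡ v j
  ++ᶠ-↑ʳ {m} {n} u v j rewrite splitAt-↑ʳ m n j = refl

-- Subsets of a concatenated index set

module Subsets where

  open import Data.Fin.Subset using (_∈_)

  module _ {m n : ℕ} (J : Subset m) (K : Subset n) where

    ∈-++⁺ˡ : ∀ {i} → i ∈ J → i ↑ˡ n ∈ J Vec.++ K
    ∈-++⁺ˡ {i} i∈J = lookup⇒[]= (i ↑ˡ n) (J Vec.++ K) (trans (lookup-++ˡ J K i) ([]=⇒lookup i∈J))

    ∈-++⁻ˡ : ∀ {i} → i ↑ˡ n ∈ J Vec.++ K → i ∈ J
    ∈-++⁻ˡ {i} i∈ = lookup⇒[]= i J (trans (sym (lookup-++ˡ J K i)) ([]=⇒lookup i∈))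

    ∈-++⁺ʳ : ∀ {j} → j ∈ K → m ↑ʳ j ∈ J Vec.++ K
    ∈-++⁺ʳ {j} j∈K = lookup⇒[]= (m ↑ʳ j) (J Vec.++ K) (trans (lookup-++ʳ J K j) ([]=⇒lookup j∈K))

    ∈-++⁻ʳ : ∀ {j} → m ↑ʳ j ∈ J Vec.++ K → j ∈ K
    ∈-++⁻ʳ {j} j∈ = lookup⇒[]= j K (trans (sym (lookup-++ʳ J K j)) ([]=⇒lookup j∈))

  extendˡ : ∀ {m} n → Subset m → Subset (m ℕ.+ n)
  extendˡ n J = J Vec.++ ⊥ {n}

  extendʳ : ∀ m {n} → Subset n → Subset (m ℕ.+ n)
  extendʳ m K = ⊥ {m} Vec.++ K

  left : ∀ {A : Set} m {n} → Vec A (m ℕ.+ n) → Vec A m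
  left ℕ.zero    J       = []
  left (ℕ.suc m) (x ∷ J) = x ∷ left m J

  right : ∀ {A : Set} m {n} → Vec A (m ℕ.+ n) → Vec A n
  right ℕ.zero    J       = J
  right (ℕ.suc m) (x ∷ J) = right m J

  left-++ : ∀ {A : Set} {m n} (J : Vec A m) (K : Vec A n) → left m (J Vec.++ K) ≡ J
  left-++ []      K = refl
  left-++ (x ∷ J) K = cong (x ∷_) (left-++ J K)

  right-++ : ∀ {A : Set} {m n} (J : Vec A m) (K : Vec A n) → right m (J Vec.++ K) ≡ K
  right-++ []      K = refl
  right-++ (x ∷ J) K = right-++ J K

  left-++-right : ∀ {A : Set} m {n} (J : Vec A (m ℕ.+ n)) → left m J Vec.++ right m J ≡ J
  left-++-right ℕ.zero    J       = refl
  left-++-right (ℕ.suc m) (x ∷ J) = cong (x ∷_) (left-++-right m J)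

  ⊤-++-⊤ : ∀ m {n} → ⊤ {m} Vec.++ ⊤ {n} ≡ ⊤
  ⊤-++-⊤ ℕ.zero    = refl
  ⊤-++-⊤ (ℕ.suc m) = cong (true ∷_) (⊤-++-⊤ m)

  extendˡ-nonempty : ∀ {m} n {J : Subset m} → Nonempty J → Nonempty (extendˡ n J)
  extendˡ-nonempty n {J} (i , i∈J) = i ↑ˡ n , ∈-++⁺ˡ J ⊥ i∈J

  extendʳ-nonempty : ∀ m {n} {K : Subset n} → Nonempty K → Nonempty (extendʳ m K)
  extendʳ-nonempty m {n} {K} (j , j∈K) = m ↑ʳ j , ∈-++⁺ʳ (⊥ {m}) K j∈K

  ⊥-empty : ∀ {n} → ¬ Nonempty (⊥ {n})
  ⊥-empty (i , i∈⊥) = ∉⊥ i∈⊥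

-- Minkowski sums of simplices in coordinates

module Weights where

  open import Data.Fin.Subset using (_∈_; _∉_)

  open Integers using (1/n*n≡1)
  open Reals
  open Sums
  open Subsets

  fromℕ : ℕ → ℝ
  fromℕ k = fromℤ (+ k)

  0≼fromℕ : ∀ k → 0ℝ ≼ fromℕ k
  0≼fromℕ k = fromℤ-mono {+ 0} {+ k} (ℤ.+≤+ ℕ.z≤n)

  reciprocal : ∀ t → ∃[ z ] (0ℝ ≼ z × fromℕ (suc t) * z ≃ 1ℝ)
  reciprocal t = fromℚ q , fromℚ-mono (ℚ.nonNegative⁻¹ q {{ℚ.normalize-nonNeg 1 (suc t)}}) ,
    R.trans (R.*-comm (fromℕ (suc t)) (fromℚ q))
      (R.trans (R.sym (fromℚ-* q (+ suc t / 1))) (R.reflexive (cong fromℚ (1/n*n≡1 (suc t)))))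
    where q = + 1 / suc t

  -- The points of y Δ_J in coordinates
  record IsWeight {n} (J : Subset n) (y : ℝ) (v : Vector ℝ n) : Set where
    field
      nonneg  : ∀ i → 0ℝ ≼ v i
      support : ∀ {i} → i ∉ J → v i ≃ 0ℝ
      total   : ∑ v ≃ y

  open IsWeight

  ·ᵖ-def : ∀ {n} r (v : D.Point n) i → (r D.·ᵖ v) i ≃ r * v i
  ·ᵖ-def r v i = D-* r (v i) R.refl R.refl

  +ᵖ-def : ∀ {n} (u v : D.Point n) i → (u D.+ᵖ v) i ≃ u i + v i
  +ᵖ-def u v i = D-+ (u i) (v i) R.refl R.refl

  ≈ᵖ⇒≃ : ∀ {n} (u v : D.Point n) → u ≈ᵖ v → ∀ i → u i ≃ v i
  ≈ᵖ⇒≃ u v h i = ≈⇒≃ {u i} {v i} (h i)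

  ≃⇒≈ᵖ : ∀ {n} (u v : D.Point n) → (∀ i → u i ≃ v i) → u ≈ᵖ v
  ≃⇒≈ᵖ u v h i = ≃⇒≈ {u i} {v i} (h i)

  Δ⇒weight : ∀ {n} {J : Subset n} {p} → Δ J p → IsWeight J 1ℝ p
  Δ⇒weight {n} {J} {p} (m , c , P , c≥0 , c≡1 , P∈ , p≡) = record
    { nonneg  = λ i → ≼-respʳ-≃ (R.sym (p≃ i)) (∑-nonneg λ j → 0≼-* (0≼c j) (unit-nonneg (k j) i))
    ; support = λ {i} i∉J → R.trans (p≃ i) (∑-zero λ j →
        R.trans (R.*-congˡ (unit-other (k j) i λ { refl → i∉J (k∈ j) })) (R.zeroʳ (c j)))
    ; total   = begin
        ∑ p                                    ≈⟨ sum-cong-≋ p≃ ⟩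
        ∑ (λ i → ∑ λ j → c j * unit (k j) i)   ≈⟨ ∑-comm (λ i j → c j * unit (k j) i) ⟩
        ∑ (λ j → ∑ λ i → c j * unit (k j) i)
          ≈⟨ sum-cong-≋ (λ j → R.sym (*-distribˡ-sum (c j) (unit (k j)))) ⟩
        ∑ (λ j → c j * ∑ (unit (k j)))
          ≈⟨ sum-cong-≋ (λ j → R.trans (R.*-congˡ (∑-unit (k j))) (R.*-identityʳ (c j))) ⟩
        ∑ c                                    ≈⟨ ∑ᵛ≃∑ c (λ _ → R.refl) ⟨
        D.∑ᵛ c                                 ≈⟨ ≈⇒≃ c≡1 ⟩
        D.1ℝ                                   ≈⟨ D-1ℝ ⟩
        1ℝ                                     ∎ }
    where
    open import Relation.Binary.Reasoning.Setoid R.setoid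
    k : Fin m → Fin n
    k j = proj₁ (P∈ j)
    k∈ : ∀ j → k j ∈ J
    k∈ j = proj₁ (proj₂ (P∈ j))
    0≼c : ∀ j → 0ℝ ≼ c j
    0≼c j = ≼-respˡ-≃ D-0ℝ (≤⇒≼ {D.0ℝ} {c j} (c≥0 j))
    p≃ : ∀ i → p i ≃ ∑ λ j → c j * unit (k j) i
    p≃ i = R.trans (≈ᵖ⇒≃ p (D.∑ᵖ λ j → c j D.·ᵖ P j) p≡ i) (R.trans (∑ᵖ≃∑ (λ j → c j D.·ᵖ P j) i)
      (sum-cong-≋ λ j → R.trans (·ᵖ-def (c j) (P j) i)
        (R.*-congˡ (R.trans (≈ᵖ⇒≃ (P j) (D.basis (k j)) (proj₂ (proj₂ (P∈ j))) i)
            (basis≃unit (k j) i)))))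

  weight⇒Δ : ∀ {n} {J : Subset n} {p} → Nonempty J → IsWeight J 1ℝ p → Δ J p
  weight⇒Δ {n} {J} {p} (j₀ , j₀∈J) w = n , p , (λ j → D.basis (k j)) ,
    (λ j → ≼⇒≤ (≼-respˡ-≃ (R.sym D-0ℝ) (nonneg w j))) ,
    ≃⇒≈ (R.trans (∑ᵛ≃∑ p (λ _ → R.refl)) (R.trans (total w) (R.sym D-1ℝ))) ,
    (λ j → k j , k∈ j , ≃⇒≈ᵖ (D.basis (k j)) (D.basis (k j)) λ i → R.refl) ,
    ≃⇒≈ᵖ p (D.∑ᵖ λ j → p j D.·ᵖ D.basis (k j))
        (λ i → R.sym (R.trans (∑ᵖ≃∑ (λ j → p j D.·ᵖ D.basis (k j)) i) (R.trans
      (sum-cong-≋ λ j → R.trans (·ᵖ-def (p j) (D.basis (k j)) i) (term i j))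
      (R.trans (∑-single (λ j → p j * unit j i) i λ j j≢i →
                 R.trans (R.*-congˡ (unit-other j i j≢i)) (R.zeroʳ (p j)))
               (R.trans (R.*-congˡ (unit-same i)) (R.*-identityʳ (p i)))))))
    where
    -- The coordinates of p serve as coefficients of the n basis vectors. Indices outside J have
    -- coefficient 0 and are sent to `j₀`, so that every vertex used belongs to J.
    k : Fin n → Fin n
    k j with j ∈? J
    ... | yes _ = j
    ... | no  _ = j₀
    k∈ : ∀ j → k j ∈ J
    k∈ j with j ∈? J
    ... | yes j∈J = j∈J
    ... | no  _   = j₀∈J
    term : ∀ i j → p j * D.basis (k j) i ≃ p j * unit j i
    term i j with j ∈? J
    ... | yes _   = R.*-congˡ (basis≃unit j i)
    ... | no  j∉J = R.trans (zero-left (D.basis j₀ i)) (R.sym (zero-left (unit j i)))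
      where
      zero-left : ∀ x → p j * x ≃ 0ℝ
      zero-left x = R.trans (R.*-congʳ (support w j∉J)) (R.zeroˡ x)

  scaled⇒weight : ∀ {n} {J : Subset n} {y y′ v} → y ≃ y′ → 0ℝ ≼ y′ → (y ·ˢ Δ J) v → IsWeight J y′ v
  scaled⇒weight {J = J} {y} {y′} {v} y≃y′ 0≼y′ (s , s∈Δ , v≡) = record
    { nonneg  = λ i → ≼-respʳ-≃ (R.sym (v≃ i)) (0≼-* 0≼y′ (nonneg w i))
    ; support = λ {i} i∉J → R.trans (v≃ i) (R.trans (R.*-congˡ (support w i∉J)) (R.zeroʳ y′))
    ; total   = R.trans (sum-cong-≋ v≃) (R.trans (R.sym (*-distribˡ-sum y′ s))
                  (R.trans (R.*-congˡ (total w)) (R.*-identityʳ y′))) }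
    where
    w = Δ⇒weight s∈Δ
    v≃ : ∀ i → v i ≃ y′ * s i
    v≃ i = R.trans (≈ᵖ⇒≃ v (y D.·ᵖ s) v≡ i) (R.trans (·ᵖ-def y s i) (R.*-congʳ y≃y′))

  -- Membership in a dilate asks for a point of the undilated simplex, obtained by dividing by the
  -- weight; a weight of the form `suc t` has an explicit reciprocal.
  weight⇒scaled : ∀ {n} {J : Subset n} {y v} t → Nonempty J → y ≃ fromℕ (suc t) →
                  IsWeight J (fromℕ (suc t)) v → (y ·ˢ Δ J) v
  weight⇒scaled {J = J} {y} {v} t J≠∅ y≃ w = s , weight⇒Δ J≠∅ (record
      { nonneg  = λ i → 0≼-* 0≼z (nonneg w i)
      ; support = λ i∉J → R.trans (R.*-congˡ (support w i∉J)) (R.zeroʳ z)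
      ; total   = R.trans (R.sym (*-distribˡ-sum z v)) (R.trans (R.*-congˡ (total w))
                    (R.trans (R.*-comm z _) Yz≃1)) }) ,
    ≃⇒≈ᵖ v (y D.·ᵖ s) (λ i → R.sym (R.trans (·ᵖ-def y s i) (R.trans (R.*-congʳ y≃)
      (R.trans (R.sym (R.*-assoc (fromℕ (suc t)) z (v i)))
          (R.trans (R.*-congʳ Yz≃1) (R.*-identityˡ (v i)))))))
    where
    z = proj₁ (reciprocal t)
    0≼z = proj₁ (proj₂ (reciprocal t))
    Yz≃1 = proj₂ (proj₂ (reciprocal t))
    s = λ i → z * v i

  -- Minkowski sums of simplices with weights Y, in coordinates
  Sum : ∀ {n} → List (Subset n) → (Subset n → ℕ) → Vector ℝ n → Set
  Sum []       Y x = ∀ i → x i ≃ 0ℝ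
  Sum (J ∷ Js) Y x = ∃[ v ] ∃[ r ]
      (IsWeight J (fromℕ (Y J)) v × Sum Js Y r × (∀ i → x i ≃ v i + r i))

  -- The fold that defines ⟦_⟧, with the list exposed so that induction on it is possible.
  minkowski : ∀ {n} → (Subset n → ℝ) → List (Subset n) → PointSet n
  minkowski y Js = foldr _⊞_ (λ x → x ≈ᵖ 0ᵖ) (map (λ I → y I ·ˢ Δ I) Js)

  minkowski⇒Sum : ∀ {n} (Js : List (Subset n)) {y Y x} → (∀ {J} → J ∈.∈ Js → y J ≃ fromℕ (Y J)) →
                  minkowski y Js x → Sum Js Y x
  minkowski⇒Sum []       {x = x} e x≡0 i = R.trans (≈ᵖ⇒≃ x 0ᵖ x≡0 i) D-0ℝ
  minkowski⇒Sum (J ∷ Js) {Y = Y} {x} e (s , t , s∈ , t∈ , x≡) =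
    s , t , scaled⇒weight (e (here refl)) (0≼fromℕ (Y J)) s∈ , minkowski⇒Sum Js (e ∘ there) t∈ ,
    λ i → R.trans (≈ᵖ⇒≃ x (s D.+ᵖ t) x≡ i) (+ᵖ-def s t i)

  Sum⇒minkowski : ∀ {n} (Js : List (Subset n)) {y Y x} →
    (∀ {J} → J ∈.∈ Js → Nonempty J × ∃[ t ] Y J ≡ suc t × y J ≃ fromℕ (Y J)) →
    Sum Js Y x → minkowski y Js x
  Sum⇒minkowski []       {x = x} h x≃0 = ≃⇒≈ᵖ x 0ᵖ λ i → R.trans (x≃0 i) (R.sym D-0ℝ)
  Sum⇒minkowski (J ∷ Js) {y} {x = x} h (v , r , w , rs , x≃) =
    let J≠∅ , t , Y≡ , y≃ = h (here refl) in v , r ,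
    weight⇒scaled {y = y J} t J≠∅ (subst (λ k → y J ≃ fromℕ k) Y≡ y≃)
        (subst (λ k → IsWeight J (fromℕ k) v) Y≡ w) ,
    Sum⇒minkowski Js (h ∘ there) rs ,
    ≃⇒≈ᵖ x (v D.+ᵖ r) (λ i → R.trans (x≃ i) (R.sym (+ᵖ-def v r i)))

  module _ {n : ℕ} where

    Sum-resp-≃ : ∀ (Js : List (Subset n)) {Y x x′} → (∀ i → x i ≃ x′ i) → Sum Js Y x → Sum Js Y x′
    Sum-resp-≃ []       e h                    = λ i → R.trans (R.sym (e i)) (h i)
    Sum-resp-≃ (J ∷ Js) e (v , r , w , rs , h) = v , r , w , rs , λ i → R.trans (R.sym (e i)) (h i)

    Sum-cong : ∀ (Js : List (Subset n)) {Y Y′ x} → (∀ {J} → J ∈.∈ Js → Y J ≡ Y′ J) → Sum Js Y x →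
        Sum Js Y′ x
    Sum-cong []       e h = h
    Sum-cong (J ∷ Js) e (v , r , w , rs , h) =
      v , r , subst (λ k → IsWeight J (fromℕ k) v) (e (here refl)) w , Sum-cong Js
          (e ∘ there) rs , h

    Sum-↭ : ∀ {Js Ks : List (Subset n)} {Y x} → Js ↭ Ks → Sum Js Y x → Sum Ks Y x
    Sum-↭ ↭.refl h = h
    Sum-↭ (↭.prep J p) (v , r , w , rs , h) = v , r , w , Sum-↭ p rs , h
    Sum-↭ (↭.swap J K p) (v , r , w , (v′ , r′ , w′ , rs , h′) , h) =
      v′ , (λ i → v i + r′ i) , w′ , (v , r′ , w , Sum-↭ p rs , λ i → R.refl) ,
      λ i → R.trans (h i) (R.trans (R.+-congˡ (h′ i)) (R.+-swapˡ (v i) (v′ i) (r′ i)))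
    Sum-↭ (↭.trans p q) h = Sum-↭ q (Sum-↭ p h)

    Sum-++⁺ : ∀ (Js : List (Subset n)) {Ks Y a b} → Sum Js Y a → Sum Ks Y b → Sum (Js ++ Ks) Y
        (λ i → a i + b i)
    Sum-++⁺ []       {Ks} {b = b} h s = Sum-resp-≃ Ks
      (λ i → R.sym (R.trans (R.+-congʳ (h i)) (R.+-identityˡ (b i)))) s
    Sum-++⁺ (J ∷ Js) {b = b} (v , r , w , rs , h) s = v , (λ i → r i + b i) , w , Sum-++⁺ Js rs s ,
      λ i → R.trans (R.+-congʳ (h i)) (R.+-assoc (v i) (r i) (b i))

    Sum-++⁻ : ∀ (Js : List (Subset n)) {Ks Y x} → Sum (Js ++ Ks) Y x →
              ∃[ a ] ∃[ b ] (Sum Js Y a × Sum Ks Y b × (∀ i → x i ≃ a i + b i))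
    Sum-++⁻ []       {x = x} s = (λ _ → 0ℝ) , x , (λ _ → R.refl) , s , λ i → R.sym
        (R.+-identityˡ (x i))
    Sum-++⁻ (J ∷ Js) (v , r , w , rs , h) with a , b , as , bs , e ← Sum-++⁻ Js rs =
      (λ i → v i + a i) , b , (v , a , w , as , λ _ → R.refl) , bs ,
      λ i → R.trans (h i) (R.trans (R.+-congˡ (e i)) (R.sym (R.+-assoc (v i) (a i) (b i))))

  zeros : ∀ {n} → Vector ℝ n
  zeros _ = 0ℝ

  ∑-zeros : ∀ n → ∑ (zeros {n}) ≃ 0ℝ
  ∑-zeros n = ∑-zero {n} λ _ → R.refl

  ∑-++ : ∀ {m n} (u : Vector ℝ m) (v : Vector ℝ n) → ∑ (u ++ᶠ v) ≃ ∑ u + ∑ v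
  ∑-++ {m} u v = R.trans (∑-split m (u ++ᶠ v))
    (R.+-cong (sum-cong-≋ λ i → R.reflexive (++ᶠ-↑ˡ u v i))
        (sum-cong-≋ λ j → R.reflexive (++ᶠ-↑ʳ u v j)))

  module _ {m n : ℕ} where

    weight-extendˡ⁺ : ∀ {J : Subset m} {y v} → IsWeight J y v → IsWeight (extendˡ n J) y
        (v ++ᶠ zeros {n})
    weight-extendˡ⁺ {J} {y} {v} w = record
      { nonneg  = elim-+ m (λ k → 0ℝ ≼ (v ++ᶠ zeros) k)
          (λ i → ≼-respʳ-≃ (R.reflexive (≡.sym (++ᶠ-↑ˡ v zeros i))) (nonneg w i))
          (λ j → ≼-reflexive (R.reflexive (≡.sym (++ᶠ-↑ʳ v zeros j))))
      ; support = λ {k} → elim-+ m (λ k → k ∉ extendˡ n J → (v ++ᶠ zeros) k ≃ 0ℝ)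
          (λ i i∉ → R.trans (R.reflexive (++ᶠ-↑ˡ v zeros i)) (support w (i∉ ∘ ∈-++⁺ˡ J ⊥)))
          (λ j _ → R.reflexive (++ᶠ-↑ʳ v zeros j)) k
      ; total   = R.trans (∑-++ v zeros)
          (R.trans (R.+-congˡ (∑-zeros n)) (R.trans (R.+-identityʳ _) (total w))) }

    weight-extendˡ⁻ : ∀ {J : Subset m} {y v} → IsWeight (extendˡ n J) y v →
                      IsWeight J y (λ i → v (i ↑ˡ n)) × (∀ j → v (m ↑ʳ j) ≃ 0ℝ)
    weight-extendˡ⁻ {J} {y} {v} w = record
      { nonneg  = λ i → nonneg w (i ↑ˡ n)
      ; support = λ i∉ → support w (i∉ ∘ ∈-++⁻ˡ J ⊥)
      ; total   = R.trans (R.sym (R.trans (R.+-congˡ (∑-zero vanish)) (R.+-identityʳ _)))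
                          (R.trans (R.sym (∑-split m v)) (total w)) } , vanish
      where
      vanish : ∀ j → v (m ↑ʳ j) ≃ 0ℝ
      vanish j = support w (∉⊥ ∘ ∈-++⁻ʳ J ⊥)

    weight-extendʳ⁺ : ∀ {K : Subset n} {y v} → IsWeight K y v → IsWeight (extendʳ m K) y
        (zeros {m} ++ᶠ v)
    weight-extendʳ⁺ {K} {y} {v} w = record
      { nonneg  = elim-+ m (λ k → 0ℝ ≼ (zeros {m} ++ᶠ v) k)
          (λ i → ≼-reflexive (R.reflexive (≡.sym (++ᶠ-↑ˡ (zeros {m}) v i))))
          (λ j → ≼-respʳ-≃ (R.reflexive (≡.sym (++ᶠ-↑ʳ (zeros {m}) v j))) (nonneg w j))
      ; support = λ {k} → elim-+ m (λ k → k ∉ extendʳ m K → (zeros {m} ++ᶠ v) k ≃ 0ℝ)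
          (λ i _ → R.reflexive (++ᶠ-↑ˡ (zeros {m}) v i))
          (λ j j∉ → R.trans (R.reflexive (++ᶠ-↑ʳ (zeros {m}) v j))
              (support w (j∉ ∘ ∈-++⁺ʳ (⊥ {m}) K))) k
      ; total   = R.trans (∑-++ (zeros {m}) v)
          (R.trans (R.+-congʳ (∑-zeros m)) (R.trans (R.+-identityˡ _) (total w))) }

    weight-extendʳ⁻ : ∀ {K : Subset n} {y v} → IsWeight (extendʳ m K) y v →
                      (∀ i → v (i ↑ˡ n) ≃ 0ℝ) × IsWeight K y (λ j → v (m ↑ʳ j))
    weight-extendʳ⁻ {K} {y} {v} w = vanish , record
      { nonneg  = λ j → nonneg w (m ↑ʳ j)
      ; support = λ j∉ → support w (j∉ ∘ ∈-++⁻ʳ (⊥ {m}) K)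
      ; total   = R.trans (R.sym (R.trans (R.+-congʳ (∑-zero vanish)) (R.+-identityˡ _)))
                          (R.trans (R.sym (∑-split m v)) (total w)) }
      where
      vanish : ∀ i → v (i ↑ˡ n) ≃ 0ℝ
      vanish i = support w (∉⊥ ∘ ∈-++⁻ˡ (⊥ {m}) K)

    Sum-extendˡ⁺ : ∀ Js {Y x} → Sum Js (Y ∘ extendˡ n) x → Sum (map (extendˡ n) Js) Y (x ++ᶠ zeros)
    Sum-extendˡ⁺ []       {x = x} h = elim-+ m _
      (λ i → R.trans (R.reflexive (++ᶠ-↑ˡ x zeros i)) (h i)) (λ j → R.reflexive (++ᶠ-↑ʳ x zeros j))
    Sum-extendˡ⁺ (J ∷ Js) {x = x} (v , r , w , rs , h) =
      v ++ᶠ zeros , r ++ᶠ zeros , weight-extendˡ⁺ w , Sum-extendˡ⁺ Js rs , elim-+ m _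
        (λ i → R.trans (R.reflexive (++ᶠ-↑ˡ x zeros i)) (R.trans (h i)
          (R.sym (R.+-cong (R.reflexive (++ᶠ-↑ˡ v zeros i)) (R.reflexive (++ᶠ-↑ˡ r zeros i))))))
        (λ j → R.trans (R.reflexive (++ᶠ-↑ʳ x zeros j)) (R.trans (R.sym (R.+-identityˡ 0ℝ))
          (R.sym (R.+-cong (R.reflexive (++ᶠ-↑ʳ v zeros j)) (R.reflexive (++ᶠ-↑ʳ r zeros j))))))

    Sum-extendˡ⁻ : ∀ Js {Y x} → Sum (map (extendˡ n) Js) Y x →
                   Sum Js (Y ∘ extendˡ n) (λ i → x (i ↑ˡ n)) × (∀ j → x (m ↑ʳ j) ≃ 0ℝ)
    Sum-extendˡ⁻ []       h = (λ i → h (i ↑ˡ n)) , λ j → h (m ↑ʳ j)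
    Sum-extendˡ⁻ (J ∷ Js) (v , r , w , rs , h) =
      let w′ , v0 = weight-extendˡ⁻ w ; rs′ , r0 = Sum-extendˡ⁻ Js rs
      in (_ , _ , w′ , rs′ , λ i → h (i ↑ˡ n)) ,
         λ j → R.trans (h (m ↑ʳ j)) (R.trans (R.+-cong (v0 j) (r0 j)) (R.+-identityˡ 0ℝ))

    Sum-extendʳ⁺ : ∀ Ks {Y x} → Sum Ks (Y ∘ extendʳ m) x → Sum (map (extendʳ m) Ks) Y
        (zeros {m} ++ᶠ x)
    Sum-extendʳ⁺ []       {x = x} h = elim-+ m _
      (λ i → R.reflexive (++ᶠ-↑ˡ (zeros {m}) x i))
          (λ j → R.trans (R.reflexive (++ᶠ-↑ʳ (zeros {m}) x j)) (h j))
    Sum-extendʳ⁺ (K ∷ Ks) {x = x} (v , r , w , rs , h) =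
      zeros {m} ++ᶠ v , zeros {m} ++ᶠ r , weight-extendʳ⁺ w , Sum-extendʳ⁺ Ks rs , elim-+ m _
        (λ i → R.trans (R.reflexive (++ᶠ-↑ˡ (zeros {m}) x i)) (R.trans (R.sym (R.+-identityˡ 0ℝ))
          (R.sym (R.+-cong (R.reflexive (++ᶠ-↑ˡ (zeros {m}) v i))
              (R.reflexive (++ᶠ-↑ˡ (zeros {m}) r i))))))
        (λ j → R.trans (R.reflexive (++ᶠ-↑ʳ (zeros {m}) x j)) (R.trans (h j)
          (R.sym (R.+-cong (R.reflexive (++ᶠ-↑ʳ (zeros {m}) v j))
              (R.reflexive (++ᶠ-↑ʳ (zeros {m}) r j))))))

    Sum-extendʳ⁻ : ∀ Ks {Y x} → Sum (map (extendʳ m) Ks) Y x →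
                   (∀ i → x (i ↑ˡ n) ≃ 0ℝ) × Sum Ks (Y ∘ extendʳ m) (λ j → x (m ↑ʳ j))
    Sum-extendʳ⁻ []       h = (λ i → h (i ↑ˡ n)) , λ j → h (m ↑ʳ j)
    Sum-extendʳ⁻ (K ∷ Ks) (v , r , w , rs , h) =
      let v0 , w′ = weight-extendʳ⁻ w ; r0 , rs′ = Sum-extendʳ⁻ Ks rs
      in (λ i → R.trans (h (i ↑ˡ n)) (R.trans (R.+-cong (v0 i) (r0 i)) (R.+-identityˡ 0ℝ))) ,
         (_ , _ , w′ , rs′ , λ j → h (m ↑ʳ j))

-- The nestohedron of a tree and its lattice points

module TreePolytope where

  open import Data.List.Membership.Propositional using (_∈_)
  open import Data.Nat using (_+_)

  open LatticeLists using (points; ∣_∣ᵗ; total; Above; above⇒points; ∈-convolve⁻)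
  open Reals renaming (_+_ to _+ʳ_)
  open Subsets
  open Sums
  open Trees using (Tree; leaf; node; tree-size)
  open Weights

  root : ∀ {n} → ℕ → List (Subset n)
  root zero    = []
  root (suc w) = [ ⊤ ]

  buildingList : ∀ {n} → Tree n → List (Subset n)
  buildingList (leaf t)             = [ ⊤ ]
  buildingList (node {m} {n} l r w) =
    map (extendˡ n) (buildingList l) ++ map (extendʳ m) (buildingList r) ++ root w

  -- The halves that a member of the building list meets tell its origin: both for the root, exactly
  -- one for a member coming from a subtree.
  weightOf : ∀ {n} → Tree n → Subset n → ℕ
  weightOf (leaf t)             J = suc t
  weightOf (node {m} {n} l r w) J = if does (nonempty? (right m J))
    then (if does (nonempty? (left m J)) then w else weightOf r (right m J))
    else weightOf l (left m J)

  data InBuildingList {m n} (l : Tree m) (r : Tree n) (w : ℕ) : Subset (m + n) → Set where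
    inˡ  : ∀ {J} → J ∈ buildingList l → InBuildingList l r w (extendˡ n J)
    inʳ  : ∀ {K} → K ∈ buildingList r → InBuildingList l r w (extendʳ m K)
    in⊤  : w ≢ 0 → InBuildingList l r w ⊤

  inBuildingList : ∀ {m n} (l : Tree m) (r : Tree n) w {J} →
                   J ∈ buildingList (node l r w) → InBuildingList l r w J
  inBuildingList {m} {n} l r w J∈ with ∈.∈-++⁻ (map (extendˡ n) (buildingList l)) J∈
  ... | inj₁ J∈ˡ with _ , J′∈ , refl ← ∈.∈-map⁻ (extendˡ n) J∈ˡ = inˡ J′∈
  ... | inj₂ J∈ʳ with ∈.∈-++⁻ (map (extendʳ m) (buildingList r)) J∈ʳ
  ...   | inj₁ J∈ʳ′ with _ , K∈ , refl ← ∈.∈-map⁻ (extendʳ m) J∈ʳ′ = inʳ K∈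
  inBuildingList l r (suc w) J∈ | inj₂ _ | inj₂ (here refl) = in⊤ λ ()

  buildingList-∈ : ∀ {m n} (l : Tree m) (r : Tree n) w {J} →
                   InBuildingList l r w J → J ∈ buildingList (node l r w)
  buildingList-∈ {m} {n} l r w (inˡ J∈) = ∈.∈-++⁺ˡ (∈.∈-map⁺ (extendˡ n) J∈)
  buildingList-∈ {m} {n} l r w (inʳ K∈) =
    ∈.∈-++⁺ʳ (map (extendˡ n) (buildingList l)) (∈.∈-++⁺ˡ (∈.∈-map⁺ (extendʳ m) K∈))
  buildingList-∈ l r zero    (in⊤ w≢0) = contradiction refl w≢0
  buildingList-∈ {m} {n} l r (suc w) (in⊤ w≢0) = ∈.∈-++⁺ʳ (map (extendˡ n) (buildingList l))
    (∈.∈-++⁺ʳ (map (extendʳ m) (buildingList r)) (here refl))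

  ⊤-nonempty : ∀ {n} → Tree n → Nonempty (⊤ {n})
  ⊤-nonempty T with _ , refl ← tree-size T = zero , ∈⊤

  buildingList-nonempty : ∀ {n} (T : Tree n) {J} → J ∈ buildingList T → Nonempty J
  buildingList-nonempty (leaf t)     (here refl) = zero , ∈⊤
  buildingList-nonempty (node {m} {n} l r w) J∈ with inBuildingList l r w J∈
  ... | inˡ J∈ˡ = extendˡ-nonempty n (buildingList-nonempty l J∈ˡ)
  ... | inʳ K∈ʳ = extendʳ-nonempty m (buildingList-nonempty r K∈ʳ)
  ... | in⊤ _  = ⊤-nonempty (node l r w)

  module _ {m n} (l : Tree m) (r : Tree n) (w : ℕ) where

    weightOf-extendˡ : ∀ J → weightOf (node l r w) (extendˡ n J) ≡ weightOf l J
    weightOf-extendˡ J rewrite left-++ J (⊥ {n}) | right-++ J (⊥ {n})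
      | dec-false (nonempty? (⊥ {n})) ⊥-empty = refl

    weightOf-extendʳ : ∀ K → Nonempty K → weightOf (node l r w) (extendʳ m K) ≡ weightOf r K
    weightOf-extendʳ K K≠∅ rewrite left-++ (⊥ {m}) K | right-++ (⊥ {m}) K
      | dec-true (nonempty? K) K≠∅ | dec-false (nonempty? (⊥ {m})) ⊥-empty = refl

    weightOf-⊤ : weightOf (node l r w) ⊤ ≡ w
    weightOf-⊤ rewrite ≡.sym (⊤-++-⊤ m {n}) | left-++ (⊤ {m}) (⊤ {n}) | right-++ (⊤ {m}) (⊤ {n})
      | dec-true (nonempty? (⊤ {n})) (⊤-nonempty r) | dec-true (nonempty? (⊤ {m}))
          (⊤-nonempty l) = refl

  weightOf-positive : ∀ {n} (T : Tree n) {J} → J ∈ buildingList T → ∃[ t ] weightOf T J ≡ suc t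
  weightOf-positive (leaf t)     J∈ = t , refl
  weightOf-positive (node l r w) J∈ with inBuildingList l r w J∈
  ... | inˡ {J} J∈ˡ rewrite weightOf-extendˡ l r w J = weightOf-positive l J∈ˡ
  ... | inʳ {K} K∈ʳ rewrite weightOf-extendʳ l r w K (buildingList-nonempty r K∈ʳ) =
      weightOf-positive r K∈ʳ
  ... | in⊤ w≢0 rewrite weightOf-⊤ l r w = ℕ.pred w , ≡.sym (ℕ.suc-pred w {{ℕ.≢-nonZero w≢0}})

  InPolytope : ∀ {n} → Tree n → Vector ℝ n → Set
  InPolytope T = Sum (buildingList T) (weightOf T)

  -- The vector `e` is the contribution of the root, a point of w Δ over all leaves. For w = 0 it is
  -- the zero vector, so roots inside and outside the building set are treated alike.
  record Split {m n} (l : Tree m) (r : Tree n) (w : ℕ) (x : Vector ℝ (m + n)) : Set where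
    field
      s : Vector ℝ m
      t : Vector ℝ n
      e : Vector ℝ (m + n)
      s∈ : InPolytope l s
      t∈ : InPolytope r t
      e-nonneg : ∀ k → 0ℝ ≼ e k
      e-total : ∑ e ≃ fromℕ w
      ≃ˡ : ∀ i → x (i ↑ˡ n) ≃ s i +ʳ e (i ↑ˡ n)
      ≃ʳ : ∀ j → x (m ↑ʳ j) ≃ t j +ʳ e (m ↑ʳ j)

  module _ {m n} (l : Tree m) (r : Tree n) (w : ℕ) where

    private
      T = node l r w

    polytope⇒split : ∀ {x} → InPolytope T x → Split l r w x
    polytope⇒split {x} h = record
      { s = λ i → a (i ↑ˡ n) ; t = λ j → b (m ↑ʳ j) ; e = e
      ; s∈ = Sum-cong (buildingList l) (λ {J} _ → weightOf-extendˡ l r w J) (proj₁ a∈)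
      ; t∈ = Sum-cong (buildingList r)
          (λ {K} K∈ → weightOf-extendʳ l r w K (buildingList-nonempty r K∈)) (proj₂ b∈)
      ; e-nonneg = proj₁ (root-e w e (proj₁ weightOf-root) e∈)
      ; e-total = proj₂ (root-e w e (proj₁ weightOf-root) e∈)
      ; ≃ˡ = λ i → R.trans (x≃ (i ↑ˡ n)) (R.+-congˡ (R.trans (c≃ (i ↑ˡ n))
          (R.trans (R.+-congʳ (proj₁ b∈ i)) (R.+-identityˡ _))))
      ; ≃ʳ = λ j → R.trans (x≃ (m ↑ʳ j)) (R.trans (R.+-congʳ (proj₂ a∈ j))
          (R.trans (R.+-identityˡ _) (c≃ (m ↑ʳ j)))) }
      where
      weightOf-root : (weightOf T ⊤ ≡ w) × (w ≡ w)
      weightOf-root = weightOf-⊤ l r w , refl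
      abc = Sum-++⁻ (map (extendˡ n) (buildingList l)) h
      a = proj₁ abc
      c = proj₁ (proj₂ abc)
      a∈ = Sum-extendˡ⁻ (buildingList l) (proj₁ (proj₂ (proj₂ abc)))
      x≃ = proj₂ (proj₂ (proj₂ (proj₂ abc)))
      bc = Sum-++⁻ (map (extendʳ m) (buildingList r)) (proj₁ (proj₂ (proj₂ (proj₂ abc))))
      b = proj₁ bc
      e = proj₁ (proj₂ bc)
      b∈ = Sum-extendʳ⁻ (buildingList r) (proj₁ (proj₂ (proj₂ bc)))
      e∈ = proj₁ (proj₂ (proj₂ (proj₂ bc)))
      c≃ = proj₂ (proj₂ (proj₂ (proj₂ bc)))
      root-e : ∀ {Y : Subset (m + n) → ℕ} w e → Y ⊤ ≡ w → Sum (root w) Y e →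
               (∀ k → 0ℝ ≼ e k) × ∑ e ≃ fromℕ w
      root-e zero    e Y≡ e≃0 = (λ k → ≼-reflexive (R.sym (e≃0 k))) , ∑-zero e≃0
      root-e (suc w) e Y≡ (v , z , v-weight , z≃0 , e≃) =
        (λ k → ≼-respʳ-≃ (R.sym (e≃v k)) (IsWeight.nonneg v-weight k)) ,
        R.trans (sum-cong-≋ e≃v) (R.trans (IsWeight.total v-weight) (R.reflexive (cong fromℕ Y≡)))
        where
        e≃v : ∀ k → e k ≃ v k
        e≃v k = R.trans (e≃ k) (R.trans (R.+-congˡ (z≃0 k)) (R.+-identityʳ (v k)))

    split⇒polytope : ∀ {x} → Split l r w x → InPolytope T x
    split⇒polytope {x} S = Sum-resp-≃ (buildingList T) x≃
      (Sum-++⁺ (map (extendˡ n) (buildingList l))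
        (Sum-extendˡ⁺ (buildingList l)
            (Sum-cong (buildingList l) (λ {J} _ → ≡.sym (weightOf-extendˡ l r w J)) s∈))
        (Sum-++⁺ (map (extendʳ m) (buildingList r))
          (Sum-extendʳ⁺ (buildingList r) (Sum-cong (buildingList r)
            (λ {K} K∈ → ≡.sym (weightOf-extendʳ l r w K (buildingList-nonempty r K∈))) t∈))
          (root-sum w (weightOf-⊤ l r w) e-total)))
      where
      open Split S
      root-sum : ∀ {Y : Subset (m + n) → ℕ} w → Y ⊤ ≡ w → ∑ e ≃ fromℕ w → Sum (root w) Y e
      -- Each coordinate lies between 0 and the sum, which is 0.
      root-sum zero    Y≡ ∑≃ k = ≼-antisym (≼-respʳ-≃ ∑≃ (∑-term-≼ e-nonneg k)) (e-nonneg k)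
      root-sum (suc w) Y≡ ∑≃ = e , zeros , record
        { nonneg = e-nonneg ; support = λ k∉ → contradiction ∈⊤ k∉
        ; total = R.trans ∑≃ (R.reflexive (cong fromℕ (≡.sym Y≡))) } ,
        (λ _ → R.refl) , λ k → R.sym (R.+-identityʳ (e k))
      x≃ : ∀ k → (s ++ᶠ zeros) k +ʳ ((zeros {m} ++ᶠ t) k +ʳ e k) ≃ x k
      x≃ = elim-+ m _
        (λ i → R.trans (R.+-cong (R.reflexive (++ᶠ-↑ˡ s zeros i))
                 (R.trans (R.+-congʳ (R.reflexive (++ᶠ-↑ˡ (zeros {m}) t i))) (R.+-identityˡ _)))
               (R.sym (≃ˡ i)))
        (λ j → R.trans (R.+-cong (R.reflexive (++ᶠ-↑ʳ s zeros j))
                 (R.+-congʳ (R.reflexive (++ᶠ-↑ʳ (zeros {m}) t j))))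
               (R.trans (R.+-identityˡ _) (R.sym (≃ʳ j))))

  fromℕ-+ : ∀ a b → fromℕ (a + b) ≃ fromℕ a +ʳ fromℕ b
  fromℕ-+ a b = fromℤ-+ (+ a) (+ b)

  polytope-total : ∀ {n} (T : Tree n) {x} → InPolytope T x → ∑ x ≃ fromℕ ∣ T ∣ᵗ
  polytope-total (leaf t) {x} (v , z , w , z≃0 , x≃) = R.trans
    (sum-cong-≋ λ i → R.trans (x≃ i) (R.trans (R.+-congˡ (z≃0 i)) (R.+-identityʳ (v i))))
        (IsWeight.total w)
  polytope-total (node {m} {n} l r w) {x} h = begin
    ∑ x                                                  ≈⟨ ∑-split m x ⟩
    ∑ (λ i → x (i ↑ˡ n)) +ʳ ∑ (λ j → x (m ↑ʳ j))
      ≈⟨ R.+-cong (R.trans (sum-cong-≋ ≃ˡ) (∑-distrib-+ s eˡ))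
          (R.trans (sum-cong-≋ ≃ʳ) (∑-distrib-+ t eʳ)) ⟩
    (∑ s +ʳ ∑ eˡ) +ʳ (∑ t +ʳ ∑ eʳ)                       ≈⟨ R.+-interchange (∑ s) (∑ eˡ) (∑ t)
        (∑ eʳ) ⟩
    (∑ s +ʳ ∑ t) +ʳ (∑ eˡ +ʳ ∑ eʳ)
      ≈⟨ R.+-cong (R.+-cong (polytope-total l s∈) (polytope-total r t∈))
                  (R.trans (R.sym (∑-split m e)) e-total) ⟩
    (fromℕ ∣ l ∣ᵗ +ʳ fromℕ ∣ r ∣ᵗ) +ʳ fromℕ w            ≈⟨ R.+-congʳ (fromℕ-+ ∣ l ∣ᵗ ∣ r ∣ᵗ) ⟨
    fromℕ (∣ l ∣ᵗ + ∣ r ∣ᵗ) +ʳ fromℕ w                   ≈⟨ fromℕ-+ (∣ l ∣ᵗ + ∣ r ∣ᵗ) w ⟨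
    fromℕ ((∣ l ∣ᵗ + ∣ r ∣ᵗ) + w)                        ∎
    where
    open import Relation.Binary.Reasoning.Setoid R.setoid
    open Split (polytope⇒split l r w h)
    eˡ = λ i → e (i ↑ˡ n)
    eʳ = λ j → e (m ↑ʳ j)

  integral : ∀ {n} → Vec ℤ n → Vector ℝ n
  integral q i = fromℤ (lookup q i)

  total-integral : ∀ {n} (q : Vec ℤ n) → fromℤ (total q) ≃ ∑ (integral q)
  total-integral []      = R.refl
  total-integral (i ∷ q) = R.trans (fromℤ-+ i (total q)) (R.+-congˡ (total-integral q))

  -- The nonnegative `e` collects what the ancestors of a node contribute to the leaves below it;
  -- carrying it along lets the claim descend to the subtrees. The real inequality becomes one of
  -- integers by `fromℤ-cancel`.
  polytope⇒above : ∀ {n} (T : Tree n) q {s} {e : Vector ℝ n} → InPolytope T s → (∀ i → 0ℝ ≼ e i) →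
                   (∀ i → integral q i ≃ s i +ʳ e i) → Above T q
  polytope⇒above T q {s} {e} s∈ 0≼e q≃ = go T q s∈ 0≼e q≃ (fromℤ-cancel (≼-respʳ-≃ (R.sym total≃)
    (≼-respˡ-≃ (R.+-identityʳ _) (+-mono-≼ ≼-refl (∑-nonneg 0≼e)))))
    where
    total≃ : fromℤ (total q) ≃ fromℕ ∣ T ∣ᵗ +ʳ ∑ e
    total≃ = R.trans (total-integral q) (R.trans (sum-cong-≋ q≃)
      (R.trans (∑-distrib-+ s e) (R.+-congʳ (polytope-total T s∈))))
    go : ∀ {n} (T : Tree n) q {s} {e : Vector ℝ n} → InPolytope T s → (∀ i → 0ℝ ≼ e i) →
         (∀ i → integral q i ≃ s i +ʳ e i) → + ∣ T ∣ᵗ ℤ.≤ total q → Above T q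
    go (leaf t)     q s∈ 0≼e q≃ ≤total = ≤total
    go (node {m} {n} l r w) q {s} {e} s∈ 0≼e q≃ ≤total =
      ≤total , left m q , right m q , ≡.sym (left-++-right m q) ,
      polytope⇒above l (left m q) S.s∈ (λ i → +-≼-0 (S.e-nonneg (i ↑ˡ n)) (0≼e (i ↑ˡ n))) (λ i →
        R.trans (R.reflexive (cong fromℤ (≡.sym (≡.trans
          (cong (λ p → lookup p (i ↑ˡ n)) (≡.sym (left-++-right m q)))
              (lookup-++ˡ (left m q) (right m q) i)))))
        (R.trans (q≃ (i ↑ˡ n)) (R.trans (R.+-congʳ (S.≃ˡ i)) (R.+-assoc _ _ _)))) ,
      polytope⇒above r (right m q) S.t∈ (λ j → +-≼-0 (S.e-nonneg (m ↑ʳ j)) (0≼e (m ↑ʳ j))) (λ j →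
        R.trans (R.reflexive (cong fromℤ (≡.sym (≡.trans
          (cong (λ p → lookup p (m ↑ʳ j)) (≡.sym (left-++-right m q)))
              (lookup-++ʳ (left m q) (right m q) j)))))
        (R.trans (q≃ (m ↑ʳ j)) (R.trans (R.+-congʳ (S.≃ʳ j)) (R.+-assoc _ _ _))))
      where module S = Split (polytope⇒split l r w s∈)

  polytope⇒points : ∀ {n} (T : Tree n) q → InPolytope T (integral q) → q ∈ points T 0
  polytope⇒points T q q∈ = above⇒points T 0
    (polytope⇒above T q {e = zeros} q∈ (λ _ → ≼-refl) (λ i → R.sym (R.+-identityʳ (integral q i))))
    (ℤ.≤-antisym (fromℤ-cancel (≼-reflexive total≃)) (fromℤ-cancel (≼-reflexive (R.sym total≃))))
    where
    total≃ : fromℤ (total q) ≃ fromℕ (∣ T ∣ᵗ + 0)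
    total≃ = R.trans (total-integral q) (R.trans (polytope-total T q∈)
      (R.reflexive (cong fromℕ (≡.sym (ℕ.+-identityʳ ∣ T ∣ᵗ)))))

  private
    -- Greedy from the left: coordinates go to the first vector until w is used up, and the rest
    -- goes to the second.
    distribute : ∀ {n} (e : Vec ℕ n) w a → Vec.sum e ≡ w + a → Σ[ e′ ∈ Vec ℕ n ] Σ[ e″ ∈ Vec ℕ n ]
      ((∀ i → lookup e i ≡ lookup e′ i + lookup e″ i) × Vec.sum e′ ≡ w × Vec.sum e″ ≡ a)
    distribute []      w a eq = [] , [] , (λ ()) , ≡.sym (ℕ.m+n≡0⇒m≡0 w (≡.sym eq)) , ≡.sym
        (ℕ.m+n≡0⇒n≡0 w (≡.sym eq))
    distribute (x ∷ e) w a eq with ℕ.≤-total x w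
    ... | inj₁ x≤w =
      let e′ , e″ , e≡ , s′ , s″ = distribute e (w ℕ.∸ x) a (ℕ.+-cancelˡ-≡ x _ _ (≡.trans eq
            (≡.trans (cong (_+ a) (≡.sym (ℕ.m+[n∸m]≡n x≤w))) (ℕ.+-assoc x (w ℕ.∸ x) a))))
      in x ∷ e′ , 0 ∷ e″ , (λ { zero → ≡.sym (ℕ.+-identityʳ x) ; (suc i) → e≡ i }) ,
         ≡.trans (cong (_+_ x) s′) (ℕ.m+[n∸m]≡n x≤w) , s″
    ... | inj₂ w≤x =
      let e′ , e″ , e≡ , s′ , s″ = distribute e 0 (Vec.sum e) refl
      in w ∷ e′ , (x ℕ.∸ w) ∷ e″ , (λ { zero → ≡.sym (ℕ.m+[n∸m]≡n w≤x) ; (suc i) → e≡ i }) ,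
         ≡.trans (cong (_+_ w) s′) (ℕ.+-identityʳ w) ,
         ≡.trans (cong (_+_ (x ℕ.∸ w)) s″) (ℕ.+-cancelˡ-≡ w _ _ (≡.trans
           (≡.sym (ℕ.+-assoc w (x ℕ.∸ w) (Vec.sum e)))
           (≡.trans (cong (_+ Vec.sum e) (ℕ.m+[n∸m]≡n w≤x)) eq)))

    sum-++ : ∀ {m n} (u : Vec ℕ m) (v : Vec ℕ n) → Vec.sum (u Vec.++ v) ≡ Vec.sum u + Vec.sum v
    sum-++ []      v = refl
    sum-++ (x ∷ u) v = ≡.trans (cong (_+_ x) (sum-++ u v)) (≡.sym (ℕ.+-assoc x _ _))

    ∑-fromℕ : ∀ {n} (e : Vec ℕ n) → ∑ (λ i → fromℕ (lookup e i)) ≃ fromℕ (Vec.sum e)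
    ∑-fromℕ []      = R.refl
    ∑-fromℕ (x ∷ e) = R.trans (R.+-congˡ (∑-fromℕ e)) (R.sym (fromℕ-+ x (Vec.sum e)))

  -- Stated for all a, because the excess at a child is handed up to its parent.
  points⇒polytope+ : ∀ {n} (T : Tree n) a {q} → q ∈ points T a →
      Σ[ x ∈ Vector ℝ n ] Σ[ e ∈ Vec ℕ n ]
    (InPolytope T x × Vec.sum e ≡ a × (∀ i → integral q i ≃ x i +ʳ fromℕ (lookup e i)))
  points⇒polytope+ (leaf t) a (here refl) = (λ _ → fromℕ (suc t)) , a ∷ [] ,
    ((λ _ → fromℕ (suc t)) , zeros , record
      { nonneg = λ _ → 0≼fromℕ (suc t) ; support = λ i∉ → contradiction ∈⊤ i∉ ; total =
          R.+-identityʳ _ } ,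
      (λ _ → R.refl) , λ _ → R.sym (R.+-identityʳ _)) ,
    ℕ.+-identityʳ a , λ { zero → fromℕ-+ (suc t) a }
  points⇒polytope+ (node {m} {n} l r w) a q∈ =
    let i , j , u , v , eq , u∈ , v∈ , q≡ = ∈-convolve⁻ Vec._++_ (points l) (points r) (w + a) q∈
        x₁ , e₁ , x₁∈ , s₁ , u≃ = points⇒polytope+ l i u∈
        x₂ , e₂ , x₂∈ , s₂ , v≃ = points⇒polytope+ r j v∈
        e′ , e″ , e≡ , s′ , s″ = distribute (e₁ Vec.++ e₂) w a
          (≡.trans (sum-++ e₁ e₂) (≡.trans (cong₂ _+_ s₁ s₂) eq))
        e≃ = λ k → R.trans (R.reflexive (cong fromℕ (e≡ k))) (fromℕ-+ (lookup e′ k) (lookup e″ k))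
    in (λ k → (x₁ ++ᶠ x₂) k +ʳ fromℕ (lookup e′ k)) , e″ ,
       split⇒polytope l r w (record
         { s = x₁ ; t = x₂ ; e = λ k → fromℕ (lookup e′ k) ; s∈ = x₁∈ ; t∈ = x₂∈
         ; e-nonneg = λ k → 0≼fromℕ (lookup e′ k)
         ; e-total = R.trans (∑-fromℕ e′) (R.reflexive (cong fromℕ s′))
         ; ≃ˡ = λ i → R.+-congʳ (R.reflexive (++ᶠ-↑ˡ x₁ x₂ i))
         ; ≃ʳ = λ j → R.+-congʳ (R.reflexive (++ᶠ-↑ʳ x₁ x₂ j)) }) ,
       s″ , elim-+ m _
         (λ i → R.trans (R.reflexive
             (cong fromℤ (≡.trans (cong (λ p → lookup p (i ↑ˡ n)) q≡) (lookup-++ˡ u v i))))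
           (R.trans (u≃ i) (R.trans (R.+-cong (R.reflexive (≡.sym (++ᶠ-↑ˡ x₁ x₂ i)))
               (R.trans (R.reflexive (cong fromℕ (≡.sym (lookup-++ˡ e₁ e₂ i)))) (e≃ (i ↑ˡ n))))
             (R.sym (R.+-assoc _ _ _)))))
         (λ j → R.trans (R.reflexive
             (cong fromℤ (≡.trans (cong (λ p → lookup p (m ↑ʳ j)) q≡) (lookup-++ʳ u v j))))
           (R.trans (v≃ j) (R.trans (R.+-cong (R.reflexive (≡.sym (++ᶠ-↑ʳ x₁ x₂ j)))
               (R.trans (R.reflexive (cong fromℕ (≡.sym (lookup-++ʳ e₁ e₂ j)))) (e≃ (m ↑ʳ j))))
             (R.sym (R.+-assoc _ _ _)))))

  points⇒polytope : ∀ {n} (T : Tree n) {q} → q ∈ points T 0 → InPolytope T (integral q)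
  points⇒polytope T {q} q∈ = let x , e , x∈ , s , q≃ = points⇒polytope+ T 0 q∈ in
    Sum-resp-≃ (buildingList T) (λ i → R.sym (R.trans (q≃ i)
      (R.trans (R.+-congˡ (R.reflexive (cong fromℕ (sum-zero e s i)))) (R.+-identityʳ (x i))))) x∈
    where
    sum-zero : ∀ {n} (e : Vec ℕ n) → Vec.sum e ≡ 0 → ∀ i → lookup e i ≡ 0
    sum-zero (x ∷ e) s zero    = ℕ.m+n≡0⇒m≡0 x s
    sum-zero (x ∷ e) s (suc i) = sum-zero e (ℕ.m+n≡0⇒n≡0 x s) i

-- Trees give binary nestohedra

module Nestohedra where

  open import Data.List.Membership.Propositional using (_∈_)

  open Integers using (/1-mono-≤)
  open LatticeLists using (points; points-unique)
  open Reals
  open Subsets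
  open Sums
  open TreePolytope
  open Trees using (Tree; leaf; node; tree-size)
  open Weights

  extendˡ≢extendʳ : ∀ {m n} {J : Subset m} {K : Subset n} → Nonempty K → extendˡ n J ≢ extendʳ m K
  extendˡ≢extendʳ {m} {n} {J} {K} K≠∅ eq = ⊥-empty
      (subst Nonempty (≡.sym (++-injectiveʳ J ⊥ eq)) K≠∅)

  extendˡ≢⊤ : ∀ {m n} {J : Subset m} → Nonempty (⊤ {n}) → extendˡ n J ≢ ⊤
  extendˡ≢⊤ {m} {n} {J} ne eq = ⊥-empty
      (subst Nonempty (≡.sym (++-injectiveʳ J ⊤ (≡.trans eq (≡.sym (⊤-++-⊤ m))))) ne)

  extendʳ≢⊤ : ∀ {m n} {K : Subset n} → Nonempty (⊤ {m}) → extendʳ m K ≢ ⊤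
  extendʳ≢⊤ {m} {n} {K} ne eq = ⊥-empty
      (subst Nonempty (≡.sym (++-injectiveˡ ⊥ ⊤ (≡.trans eq (≡.sym (⊤-++-⊤ m))))) ne)

  root-unique : ∀ {n} w → Unique (root {n} w)
  root-unique zero    = []
  root-unique (suc w) = [] ∷ []

  ∈-root : ∀ {n w} {J : Subset n} → J ∈ root w → J ≡ ⊤
  ∈-root {w = suc w} (here refl) = refl

  buildingList-unique : ∀ {n} (T : Tree n) → Unique (buildingList T)
  buildingList-unique (leaf t)             = [] ∷ []
  buildingList-unique (node {m} {n} l r w) =
    Unique.++⁺ (Unique.map⁺ (++-injectiveˡ _ _) (buildingList-unique l))
      (Unique.++⁺ (Unique.map⁺ (++-injectiveʳ (⊥ {m}) ⊥) (buildingList-unique r))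
          (root-unique w) disjointʳ)
      disjointˡ
    where
    disjointʳ : Disjoint (map (extendʳ m) (buildingList r)) (root w)
    disjointʳ (J∈ , J∈′) with _ , _ , refl ← ∈.∈-map⁻ (extendʳ m) J∈ = extendʳ≢⊤ (⊤-nonempty l) (∈-root {w = w} J∈′)
    disjointˡ : Disjoint (map (extendˡ n) (buildingList l))
        (map (extendʳ m) (buildingList r) ++ root w)
    disjointˡ (J∈ , J∈′) with _ , _ , refl ← ∈.∈-map⁻ (extendˡ n) J∈ | ∈.∈-++⁻ (map (extendʳ m) (buildingList r)) J∈′
    ... | inj₁ J∈ʳ with _ , K∈ , eq ← ∈.∈-map⁻ (extendʳ m) J∈ʳ = extendˡ≢extendʳ (buildingList-nonempty r K∈) eq
    ... | inj₂ J∈ᵗ = extendˡ≢⊤ (⊤-nonempty r) (∈-root {w = w} J∈ᵗ)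

  ⁅↑ˡ⁆ : ∀ {m} n (i : Fin m) → ⁅ i ↑ˡ n ⁆ ≡ extendˡ n ⁅ i ⁆
  ⁅↑ˡ⁆ {suc m} n zero    = cong (inside ∷_) (⊥-++-⊥ m)
    where
    ⊥-++-⊥ : ∀ m {n} → ⊥ {m ℕ.+ n} ≡ ⊥ {m} Vec.++ ⊥ {n}
    ⊥-++-⊥ zero    = refl
    ⊥-++-⊥ (suc m) = cong (outside ∷_) (⊥-++-⊥ m)
  ⁅↑ˡ⁆ {suc m} n (suc i) = cong (outside ∷_) (⁅↑ˡ⁆ n i)

  ⁅↑ʳ⁆ : ∀ m {n} (j : Fin n) → ⁅ m ↑ʳ j ⁆ ≡ extendʳ m ⁅ j ⁆
  ⁅↑ʳ⁆ zero    j = refl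
  ⁅↑ʳ⁆ (suc m) j = cong (outside ∷_) (⁅↑ʳ⁆ m j)

  ⊤-interval : ∀ n → IsInterval (⊤ {suc n})
  ⊤-interval n = zero , Fin.fromℕ n , λ x → mk⇔ (λ _ → z≤n , Fin.≤fromℕ x) (λ _ → ∈⊤)

  extendˡ-interval : ∀ {m} n {J : Subset m} → IsInterval J → IsInterval (extendˡ n J)
  extendˡ-interval {m} n {J} (i , j , h) = i ↑ˡ n , j ↑ˡ n , elim-+ m _
    (λ x → mk⇔
      (λ x∈ → let i≤x , x≤j = Equivalence.to (h x) (∈-++⁻ˡ J ⊥ x∈) in mono i≤x , mono x≤j)
      (λ (i≤x , x≤j) → ∈-++⁺ˡ J ⊥ (Equivalence.from (h x) (anti i≤x , anti x≤j))))
    (λ x → mk⇔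
      (λ x∈ → contradiction (∈-++⁻ʳ J ⊥ x∈) ∉⊥)
      (λ (_ , x≤j) → contradiction
        (ℕ.≤-<-trans x≤j (ℕ.≤-<-trans (ℕ.≤-reflexive (Fin.toℕ-↑ˡ j n)) (Fin.toℕ<n j)))
        (ℕ.≤⇒≯ (ℕ.≤-trans (ℕ.m≤m+n m (toℕ x)) (ℕ.≤-reflexive (≡.sym (Fin.toℕ-↑ʳ m x)))))))
    where
    mono : ∀ {x y : Fin m} → x Fin.≤ y → x ↑ˡ n Fin.≤ y ↑ˡ n
    mono {x} {y} = ≡.subst₂ ℕ._≤_ (≡.sym (Fin.toℕ-↑ˡ x n)) (≡.sym (Fin.toℕ-↑ˡ y n))
    anti : ∀ {x y : Fin m} → x ↑ˡ n Fin.≤ y ↑ˡ n → x Fin.≤ y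
    anti {x} {y} = ≡.subst₂ ℕ._≤_ (Fin.toℕ-↑ˡ x n) (Fin.toℕ-↑ˡ y n)

  extendʳ-interval : ∀ m {n} {K : Subset n} → IsInterval K → IsInterval (extendʳ m K)
  extendʳ-interval m {n} {K} (i , j , h) = m ↑ʳ i , m ↑ʳ j , elim-+ m _
    (λ x → mk⇔
      (λ x∈ → contradiction (∈-++⁻ˡ (⊥ {m}) K x∈) ∉⊥)
      (λ (i≤x , _) → contradiction
        (ℕ.≤-<-trans i≤x (ℕ.≤-<-trans (ℕ.≤-reflexive (Fin.toℕ-↑ˡ x n)) (Fin.toℕ<n x)))
        (ℕ.≤⇒≯ (ℕ.≤-trans (ℕ.m≤m+n m (toℕ i)) (ℕ.≤-reflexive (≡.sym (Fin.toℕ-↑ʳ m i)))))))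
    (λ x → mk⇔
      (λ x∈ → let i≤x , x≤j = Equivalence.to (h x) (∈-++⁻ʳ (⊥ {m}) K x∈) in mono i≤x , mono x≤j)
      (λ (i≤x , x≤j) → ∈-++⁺ʳ (⊥ {m}) K (Equivalence.from (h x) (anti i≤x , anti x≤j))))
    where
    mono : ∀ {x y : Fin n} → x Fin.≤ y → m ↑ʳ x Fin.≤ m ↑ʳ y
    mono {x} {y} l = ≡.subst₂ ℕ._≤_ (≡.sym (Fin.toℕ-↑ʳ m x)) (≡.sym (Fin.toℕ-↑ʳ m y))
        (ℕ.+-monoʳ-≤ m l)
    anti : ∀ {x y : Fin n} → m ↑ʳ x Fin.≤ m ↑ʳ y → x Fin.≤ y
    anti {x} {y} l = ℕ.+-cancelˡ-≤ m _ _ (≡.subst₂ ℕ._≤_ (Fin.toℕ-↑ʳ m x) (Fin.toℕ-↑ʳ m y) l)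

  ++-⊆ : ∀ {m n} {J J′ : Subset m} {K K′ : Subset n} → J ⊆ˢ J′ → K ⊆ˢ K′ → (J Vec.++ K) ⊆ˢ
      (J′ Vec.++ K′)
  ++-⊆ {m} {J = J} {J′} {K} {K′} J⊆ K⊆ {x} = elim-+ m (λ x → x ∈ˢ J Vec.++ K → x ∈ˢ J′ Vec.++ K′)
    (λ i → ∈-++⁺ˡ J′ K′ ∘ J⊆ ∘ ∈-++⁻ˡ J K) (λ j → ∈-++⁺ʳ J′ K′ ∘ K⊆ ∘ ∈-++⁻ʳ J K) x

  ++-∩ : ∀ {m n} (J J′ : Subset m) (K K′ : Subset n) → Nonempty ((J Vec.++ K) ∩ (J′ Vec.++ K′)) →
         Nonempty (J ∩ J′) ⊎ Nonempty (K ∩ K′)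
  ++-∩ {m} J J′ K K′ (x , x∈) = elim-+ m
    (λ x → x ∈ˢ J Vec.++ K → x ∈ˢ J′ Vec.++ K′ → Nonempty (J ∩ J′) ⊎ Nonempty (K ∩ K′))
    (λ i i∈ i∈′ → inj₁ (i , x∈p∩q⁺ (∈-++⁻ˡ J K i∈ , ∈-++⁻ˡ J′ K′ i∈′)))
    (λ j j∈ j∈′ → inj₂ (j , x∈p∩q⁺ (∈-++⁻ʳ J K j∈ , ∈-++⁻ʳ J′ K′ j∈′)))
    x (proj₁ x∈both) (proj₂ x∈both)
    where x∈both = x∈p∩q⁻ (J Vec.++ K) (J′ Vec.++ K′) x∈

  buildingList-interval : ∀ {n} (T : Tree n) {I} → I ∈ buildingList T → IsInterval I
  buildingList-interval (leaf t)             (here refl) = ⊤-interval 0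
  buildingList-interval (node {m} {n} l r w) I∈ with inBuildingList l r w I∈
  ... | inˡ J∈ = extendˡ-interval n (buildingList-interval l J∈)
  ... | inʳ K∈ = extendʳ-interval m (buildingList-interval r K∈)
  ... | in⊤ _  = all (tree-size (node l r w))
    where
    all : ∀ {n} → ∃[ k ] n ≡ suc k → IsInterval (⊤ {n})
    all (k , refl) = ⊤-interval k

  buildingList-singleton : ∀ {n} (T : Tree n) i → ⁅ i ⁆ ∈ buildingList T
  buildingList-singleton (leaf t) zero = here refl
  buildingList-singleton (node {m} {n} l r w) = elim-+ m _
    (λ i → subst (_∈ buildingList (node l r w)) (≡.sym (⁅↑ˡ⁆ n i))
      (buildingList-∈ l r w (inˡ (buildingList-singleton l i))))
    (λ j → subst (_∈ buildingList (node l r w)) (≡.sym (⁅↑ʳ⁆ m j))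
      (buildingList-∈ l r w (inʳ (buildingList-singleton r j))))

  ∩⊥-empty : ∀ {n} {K : Subset n} → ¬ Nonempty (K ∩ ⊥)
  ∩⊥-empty {K = K} (x , x∈) = ∉⊥ (proj₂ (x∈p∩q⁻ K ⊥ x∈))

  ⊥∩-empty : ∀ {n} {K : Subset n} → ¬ Nonempty (⊥ ∩ K)
  ⊥∩-empty {K = K} (x , x∈) = ∉⊥ (proj₁ (x∈p∩q⁻ ⊥ K x∈))

  buildingList-laminar : ∀ {n} (T : Tree n) {I J} → I ∈ buildingList T → J ∈ buildingList T →
                         Nonempty (I ∩ J) → (I ⊆ˢ J) ⊎ (J ⊆ˢ I)
  buildingList-laminar (leaf t) (here refl) (here refl) _ = inj₁ λ x∈ → x∈
  buildingList-laminar (node {m} {n} l r w) I∈ J∈ meet with inBuildingList l r w I∈ |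
      inBuildingList l r w J∈
  ... | in⊤ _         | _             = inj₂ λ _ → ∈⊤
  ... | inˡ _         | in⊤ _         = inj₁ λ _ → ∈⊤
  ... | inʳ _         | in⊤ _         = inj₁ λ _ → ∈⊤
  ... | inˡ {J} J∈    | inˡ {J′} J′∈ with ++-∩ J J′ ⊥ ⊥ meet
  ...   | inj₂ meet′ = contradiction meet′ ∩⊥-empty
  ...   | inj₁ meet′ with buildingList-laminar l J∈ J′∈ meet′
  ...     | inj₁ J⊆J′ = inj₁ (++-⊆ J⊆J′ (λ x∈ → x∈))
  ...     | inj₂ J′⊆J = inj₂ (++-⊆ J′⊆J (λ x∈ → x∈))
  buildingList-laminar (node {m} {n} l r w) I∈ J∈ meet | inʳ {K} K∈ | inʳ {K′} K′∈ with ++-∩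
      (⊥ {m}) ⊥ K K′ meet
  ...   | inj₁ meet′ = contradiction meet′ ∩⊥-empty
  ...   | inj₂ meet′ with buildingList-laminar r K∈ K′∈ meet′
  ...     | inj₁ K⊆K′ = inj₁ (++-⊆ {J = ⊥ {m}} (λ x∈ → x∈) K⊆K′)
  ...     | inj₂ K′⊆K = inj₂ (++-⊆ {J = ⊥ {m}} (λ x∈ → x∈) K′⊆K)
  buildingList-laminar (node {m} {n} l r w) I∈ J∈ meet | inˡ {J} _ | inʳ {K} _ with ++-∩ J ⊥ ⊥ K
      meet
  ...   | inj₁ meet′ = contradiction meet′ ∩⊥-empty
  ...   | inj₂ meet′ = contradiction meet′ ⊥∩-empty
  buildingList-laminar (node {m} {n} l r w) I∈ J∈ meet | inʳ {K} _ | inˡ {J} _ with ++-∩ ⊥ J K ⊥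
      meet
  ...   | inj₁ meet′ = contradiction meet′ ⊥∩-empty
  ...   | inj₂ meet′ = contradiction meet′ ∩⊥-empty

  0<fromℤ-suc : ∀ t → D.0ℝ D.< D.fromℤ (+ suc t)
  0<fromℤ-suc t = ½ , ℚ.positive⁻¹ ½ , 0 , λ _ _ →
    ℚ.<-≤-trans ½<1 (/1-mono-≤ {+ 1} {+ suc t} (ℤ.+≤+ (s≤s z≤n)))
    where
    ½<1 : 0ℚ ℚ.+ ½ ℚ.< 1ℚ
    ½<1 = ≡.subst₂ ℚ._<_ (ℚ.+-comm ½ 0ℚ) refl (ℚ.+-monoʳ-< ½ (ℚ.positive⁻¹ ½))

  nestohedron : ∀ {n} → Tree n → BinaryNestohedron n
  nestohedron T = record
    { ℬ = buildingList T
    ; buildingSet = record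
      { unique     = buildingList-unique T
      ; nonempty   = buildingList-nonempty T
      ; intervals  = buildingList-interval T
      ; singletons = buildingList-singleton T
      ; laminar    = buildingList-laminar T }
    ; y = λ J → D.fromℤ (+ weightOf T J)
    ; y-positive = λ {I} I∈ → let t , eq = weightOf-positive T I∈ in
        subst (λ k → D.0ℝ D.< D.fromℤ (+ k)) (≡.sym eq) (0<fromℤ-suc t) }

  module _ {n} (P : BinaryNestohedron n) (T : Tree n) where

    open BinaryNestohedron P
    open IsBinaryBuildingSet buildingSet

    Represents : Set
    Represents = (∀ J → J ∈ ℬ ⇔ J ∈ buildingList T) ×
        (∀ {J} → J ∈ ℬ → y J ≃ D.fromℤ (+ weightOf T J))

    -- ℬ and the building list may be ordered differently. Free of repetitions and with the same
    -- members, they are permutations of each other, and Minkowski sums are invariant under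
    -- permutation.
    lattice-points : Represents → points T 0 Enumerates LatticePoint ⟦ P ⟧
    lattice-points (same , y≃) = points-unique T 0 , λ q → mk⇔
      (λ q∈ → Sum⇒minkowski ℬ
        (λ {J} J∈ → nonempty J∈ , proj₁ (weight-suc J∈) , proj₂ (weight-suc J∈) , y≃′ J∈)
        (Sum-↭ (perm ⁻¹) (Sum-resp-≃ (buildingList T) (λ i → R.sym (D-fromℤ (lookup q i)))
            (points⇒polytope T q∈))))
      (λ q∈ → polytope⇒points T q (Sum-resp-≃ (buildingList T) (λ i → D-fromℤ (lookup q i))
        (Sum-↭ perm (minkowski⇒Sum ℬ {y} y≃′ q∈))))
      where
      open import Data.List.Relation.Binary.Permutation.Propositional using (_↭_; ↭-sym)
      _⁻¹ : ∀ {Js Ks : List (Subset n)} → Js ↭ Ks → Ks ↭ Js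
      _⁻¹ = ↭-sym
      perm : ℬ ↭ buildingList T
      perm = ∼bag⇒↭ (unique∧set⇒bag unique (buildingList-unique T) λ {J} → same J)
      weight-suc : ∀ {J} → J ∈ ℬ → ∃[ t ] weightOf T J ≡ suc t
      weight-suc {J} J∈ = weightOf-positive T (Equivalence.to (same J) J∈)
      y≃′ : ∀ {J} → J ∈ ℬ → y J ≃ fromℕ (weightOf T J)
      y≃′ {J} J∈ = R.trans (y≃ J∈) (D-fromℤ (+ weightOf T J))

-- Integrality of the nestohedron of a tree

module SupportPoints where

  open import Data.List.Membership.Propositional using (_∈_)

  open Reals
  open Sums
  open TreePolytope using (integral; weightOf-positive; weightOf)
  open Trees using (Tree)
  open Nestohedra using (nestohedron)
  open Weights

  Supports : ∀ {n} → Vector ℝ n → PointSet n → Vector ℝ n → Set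
  Supports c S v = S v × (∀ x → S x → c ∙ x ≼ c ∙ v)

  -- The point must be found without deciding which coordinates of c are maximal.
  IntegralFaces : ∀ {n} → PointSet n → Set
  IntegralFaces {n} S = ∀ c v → Supports c S v → Σ[ q ∈ Vec ℤ n ]
      (S (D.fromℤᵖ q) × c ∙ integral q ≃ c ∙ v)

  ≼-cancelˡ : ∀ {x y z} → z + x ≼ z + y → x ≼ y
  ≼-cancelˡ {x} {y} {z} h = +-cancelʳ-≼ z (≼-respˡ-≃ (R.+-comm z x) (≼-respʳ-≃ (R.+-comm z y) h))

  integral≃ : ∀ {n} (q : Vec ℤ n) i → D.fromℤᵖ q i ≃ integral q i
  integral≃ q i = D-fromℤ (lookup q i)

  faces-0 : ∀ {n} → IntegralFaces {n} (λ x → x ≈ᵖ 0ᵖ)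
  faces-0 {n} c v (v≡0 , _) = q ,
    ≃⇒≈ᵖ (D.fromℤᵖ q) 0ᵖ (λ i → R.trans (integral≃ q i) (R.trans (q≃0 i) (R.sym D-0ℝ))) ,
    ∙-cong c λ i → R.trans (q≃0 i) (R.sym (R.trans (≈ᵖ⇒≃ v 0ᵖ v≡0 i) D-0ℝ))
    where
    q : Vec ℤ n
    q = Vec.replicate n (+ 0)
    q≃0 : ∀ i → integral q i ≃ 0ℝ
    q≃0 i = R.reflexive (cong fromℤ (lookup-replicate i (+ 0)))

  -- A maximiser on a Minkowski sum is a sum of maximisers: vary one summand, keep the other and
  -- cancel it.
  faces-⊞ : ∀ {n} {S T : PointSet n} → IntegralFaces S → IntegralFaces T → IntegralFaces (S ⊞ T)
  faces-⊞ {S = S} {T} fS fT c v ((s , t , s∈ , t∈ , v≡) , max) =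
    q , (D.fromℤᵖ (proj₁ S-face) , D.fromℤᵖ (proj₁ T-face) , proj₁ (proj₂ S-face) , proj₁
        (proj₂ T-face) ,
         ≃⇒≈ᵖ (D.fromℤᵖ q) (D.fromℤᵖ (proj₁ S-face) D.+ᵖ D.fromℤᵖ (proj₁ T-face)) λ i →
           R.trans (integral≃ q i) (R.trans (q≃ i)
               (R.sym (R.trans (+ᵖ-def (D.fromℤᵖ (proj₁ S-face)) (D.fromℤᵖ (proj₁ T-face)) i)
             (R.+-cong (integral≃ (proj₁ S-face) i) (integral≃ (proj₁ T-face) i)))))) ,
    R.trans (∙-cong c q≃) (R.trans (∙-+ c (integral (proj₁ S-face)) (integral (proj₁ T-face)))
      (R.trans (R.+-cong (proj₂ (proj₂ S-face)) (proj₂ (proj₂ T-face))) (R.sym c∙v)))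
    where
    v≃ : ∀ i → v i ≃ s i + t i
    v≃ i = R.trans (≈ᵖ⇒≃ v (s D.+ᵖ t) v≡ i) (+ᵖ-def s t i)
    c∙v : c ∙ v ≃ c ∙ s + c ∙ t
    c∙v = R.trans (∙-cong c v≃) (∙-+ c s t)
    sum-max : ∀ x x′ → S x → T x′ → c ∙ x + c ∙ x′ ≼ c ∙ s + c ∙ t
    sum-max x x′ x∈ x′∈ = ≼-respʳ-≃ c∙v (≼-respˡ-≃ (R.trans (∙-cong c (+ᵖ-def x x′)) (∙-+ c x x′))
      (max (x D.+ᵖ x′) (x , x′ , x∈ , x′∈ , ≃⇒≈ᵖ (x D.+ᵖ x′) (x D.+ᵖ x′) λ i → R.refl)))
    S-face = fS c s (s∈ , λ x x∈ → +-cancelʳ-≼ (c ∙ t) (sum-max x t x∈ t∈))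
    T-face = fT c t (t∈ , λ x x∈ → ≼-cancelˡ (sum-max s x s∈ x∈))
    q = Vec.zipWith ℤ._+_ (proj₁ S-face) (proj₁ T-face)
    q≃ : ∀ i → integral q i ≃ integral (proj₁ S-face) i + integral (proj₁ T-face) i
    q≃ i = R.trans (R.reflexive (cong fromℤ (lookup-zipWith ℤ._+_ i (proj₁ S-face) (proj₁ T-face))))
      (fromℤ-+ (lookup (proj₁ S-face) i) (lookup (proj₁ T-face) i))

  weight-resp-≃ : ∀ {n} {J : Subset n} {y v v′} → (∀ i → v i ≃ v′ i) → IsWeight J y v →
      IsWeight J y v′
  weight-resp-≃ e w = record
    { nonneg  = λ i → ≼-respʳ-≃ (e i) (IsWeight.nonneg w i)
    ; support = λ {i} i∉ → R.trans (R.sym (e i)) (IsWeight.support w i∉)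
    ; total   = R.trans (R.sym (sum-cong-≋ e)) (IsWeight.total w) }

  unit-weight : ∀ {n} {J : Subset n} {k y} → k ∈ˢ J → 0ℝ ≼ y → IsWeight J y (λ i → y * unit k i)
  unit-weight {k = k} {y} k∈J 0≼y = record
    { nonneg  = λ i → 0≼-* 0≼y (unit-nonneg k i)
    ; support = λ {i} i∉J → R.trans (R.*-congˡ (unit-other k i λ { refl → i∉J k∈J })) (R.zeroʳ y)
    ; total   = R.trans (R.sym (*-distribˡ-sum y (unit k)))
        (R.trans (R.*-congˡ (∑-unit k)) (R.*-identityʳ y)) }

  ∙-scaled-unit : ∀ {n} (c : Vector ℝ n) y k → c ∙ (λ i → y * unit k i) ≃ y * c k
  ∙-scaled-unit c y k = R.trans
    (sum-cong-≋ λ i → R.trans (R.sym (R.*-assoc (c i) y (unit k i)))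
      (R.trans (R.*-congʳ (R.*-comm (c i) y)) (R.*-assoc y (c i) (unit k i))))
    (R.trans (R.sym (*-distribˡ-sum y (λ i → c i * unit k i))) (R.*-congˡ (∙-unit c k)))

  fromℕ-suc-positive : ∀ t → Positive (fromℕ (suc t))
  fromℕ-suc-positive t = positive-resp-≃ (D-fromℤ (+ suc t)) (positive (Nestohedra.0<fromℤ-suc t))

  integral-unit : ∀ {n} t (i : Fin n) → Σ[ q ∈ Vec ℤ n ]
      (∀ k → integral q k ≃ fromℕ (suc t) * unit i k)
  integral-unit {n} t i = Vec.tabulate z , λ k →
    R.trans (R.reflexive (cong fromℤ (lookup∘tabulate z k))) (z≃ k)
    where
    z : Fin n → ℤ
    z k = if does (i Fin.≟ k) then + suc t else + 0
    z≃ : ∀ k → fromℤ (z k) ≃ fromℕ (suc t) * unit i k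
    z≃ k with does (i Fin.≟ k)
    ... | true  = R.sym (R.*-identityʳ (fromℕ (suc t)))
    ... | false = R.sym (R.zeroʳ (fromℕ (suc t)))

  -- The coordinates of v add up to a positive weight, so some v i is positive. The vertex at such
  -- an i, multiplied by the weight, attains the same value of c as v.
  faces-scaled : ∀ {n} {J : Subset n} {y} t → Nonempty J → y ≃ fromℕ (suc t) → IntegralFaces
      (y ·ˢ Δ J)
  faces-scaled {n} {J} {y} t J≠∅ y≃ c v (v∈ , max) =
    q , weight⇒scaled {J = J} {y = y} {v = D.fromℤᵖ q} t J≠∅ y≃
          (weight-resp-≃ (λ k → R.sym (R.trans (integral≃ q k) (q≃ k))) (unit-weight i∈J 0≼Y)) ,
    R.trans (∙-cong c q≃) (R.trans (∙-scaled-unit c Y i) (≼-antisym (below i i∈J) above))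
    where
    Y = fromℕ (suc t)
    0≼Y : 0ℝ ≼ Y
    0≼Y = 0≼fromℕ (suc t)
    w : IsWeight J Y v
    w = scaled⇒weight {J = J} {y} {Y} {v} y≃ 0≼Y v∈
    found : ∃[ i ] Positive (v i)
    found = ∑-positive v (positive-resp-≃ (R.sym (IsWeight.total w)) (fromℕ-suc-positive t))
    i = proj₁ found
    i∈J : i ∈ˢ J
    i∈J = go (i ∈? J)
      where
      go : Relation.Nullary.Dec (i ∈ˢ J) → i ∈ˢ J
      go (yes i∈) = i∈
      go (no  i∉) = contradiction (positive-resp-≃ (IsWeight.support w i∉) (proj₂ found))
          ¬positive-0
    below : ∀ k → k ∈ˢ J → Y * c k ≼ c ∙ v
    below k k∈ = ≼-respˡ-≃ (∙-scaled-unit c Y k) (max (λ i → Y * unit k i)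
      (weight⇒scaled {J = J} {y = y} {v = λ i → Y * unit k i} t J≠∅ y≃ (unit-weight k∈ 0≼Y)))
    -- The terms are nonnegative and add up to Y (c ∙ v) - Y (c ∙ v) = 0. At i the factor v i is
    -- positive and can be cancelled, which leaves c ∙ v - Y c i ≼ 0.
    gap : Fin n → ℝ
    gap k = v k * (c ∙ v - Y * c k)
    gap-nonneg : ∀ k → 0ℝ ≼ gap k
    gap-nonneg k = go (k ∈? J)
      where
      go : Relation.Nullary.Dec (k ∈ˢ J) → 0ℝ ≼ gap k
      go (yes k∈) = 0≼-* (IsWeight.nonneg w k) (≼⇒0≼ (below k k∈))
      go (no  k∉) = ≼-reflexive (R.sym (R.trans (R.*-congʳ (IsWeight.support w k∉)) (R.zeroˡ _)))
    gap-sum : ∑ gap ≃ 0ℝ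
    gap-sum = begin
      ∑ gap
        ≈⟨ sum-cong-≋ (λ k → R.distribˡ (v k) (c ∙ v) (- (Y * c k))) ⟩
      ∑ (λ k → v k * (c ∙ v) + v k * (- (Y * c k)))
        ≈⟨ ∑-distrib-+ (λ k → v k * (c ∙ v)) (λ k → v k * (- (Y * c k))) ⟩
      ∑ (λ k → v k * (c ∙ v)) + ∑ (λ k → v k * (- (Y * c k)))
        ≈⟨ R.+-cong (R.trans (R.sym (*-distribʳ-sum (c ∙ v) v)) (R.*-congʳ (IsWeight.total w)))
                    (sum-cong-≋ λ k → rearrange (v k) (c k)) ⟩
      Y * (c ∙ v) + ∑ (λ k → (- Y) * (c k * v k))
        ≈⟨ R.+-congˡ (R.trans (R.sym (*-distribˡ-sum (- Y) (λ k → c k * v k)))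
            (R.sym (R.-‿distribˡ-* Y (c ∙ v)))) ⟩
      Y * (c ∙ v) + (- (Y * (c ∙ v)))
        ≈⟨ R.-‿inverseʳ (Y * (c ∙ v)) ⟩
      0ℝ ∎
      where
      open import Relation.Binary.Reasoning.Setoid R.setoid
      rearrange : ∀ a b → a * (- (Y * b)) ≃ (- Y) * (b * a)
      rearrange a b = R.trans (R.*-congˡ (R.-‿distribˡ-* Y b))
          (R.trans (R.*-comm a ((- Y) * b)) (R.*-assoc (- Y) b a))
    above : c ∙ v ≼ Y * c i
    above = 0≼⇒≼′ (*-cancel-≼0 (proj₂ found) (≼-respʳ-≃ gap-sum (∑-term-≼ gap-nonneg i)))
      where
      0≼⇒≼′ : c ∙ v - Y * c i ≼ 0ℝ → c ∙ v ≼ Y * c i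
      0≼⇒≼′ h = ≼-respˡ-≃ (R.trans (R.+-assoc _ _ _)
          (R.trans (R.+-congˡ (R.-‿inverseˡ _)) (R.+-identityʳ _)))
        (≼-respʳ-≃ (R.+-identityˡ _) (+-mono-≼ h (≼-refl {Y * c i})))
    q  = proj₁ (integral-unit t i)
    q≃ = proj₂ (integral-unit t i)

  faces-minkowski : ∀ {n} {y : Subset n → ℝ} Js →
    (∀ {J} → J ∈ Js → Nonempty J × ∃[ t ] y J ≃ fromℕ (suc t)) → IntegralFaces (minkowski y Js)
  faces-minkowski             []       h = faces-0
  faces-minkowski {n} {y = y} (J ∷ Js) h = faces-⊞ {S = y J ·ˢ Δ J} {minkowski y Js}
    (faces-scaled {J = J} {y = y J} (proj₁ (proj₂ (h (here refl)))) (proj₁ (h (here refl)))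
        (proj₂ (proj₂ (h (here refl)))))
    (faces-minkowski Js (h ∘ there))

  -- The functional belonging to a vertex has no other maximiser, so the integral maximiser is the
  -- vertex itself.
  integralFaces⇒IsIntegral : ∀ {n} {S : PointSet n} → IntegralFaces S → IsIntegral S
  integralFaces⇒IsIntegral faces v (v∈ , c , max) =
    let q , q∈ , eq = faces c v (v∈ , λ x x∈ → ≼-respˡ-≃ (∙-def c x) (≼-respʳ-≃ (∙-def c v)
                        (≤⇒≼ {c D.∙ x} {c D.∙ v} (proj₁ (max x x∈)))))
        same = proj₂ (max (D.fromℤᵖ q) q∈) (≃⇒≈ {c D.∙ D.fromℤᵖ q} {c D.∙ v}
          (R.trans (∙-def c (D.fromℤᵖ q))
              (R.trans (∙-cong c (integral≃ q)) (R.trans eq (R.sym (∙-def c v))))))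
    in q , ≃⇒≈ᵖ v (D.fromℤᵖ q) λ i → R.sym (≈ᵖ⇒≃ (D.fromℤᵖ q) v same i)

  nestohedron-integral : ∀ {n} (T : Tree n) → IsIntegral ⟦ nestohedron T ⟧
  nestohedron-integral T = integralFaces⇒IsIntegral {S = ⟦ nestohedron T ⟧}
      (faces-minkowski ℬ λ {J} J∈ →
    let t , eq = weightOf-positive T J∈ in
    nonempty J∈ , t , R.trans (D-fromℤ (+ weightOf T J)) (R.reflexive (cong fromℕ eq)))
    where
    open BinaryNestohedron (nestohedron T)
    open IsBinaryBuildingSet buildingSet

-- Integral vertices force integral weights

module Vertices where

  open import Data.Fin.Subset using (_⊆_)
  open import Data.List.Membership.Propositional using (_∈_)

  open Reals
  open Sums
  open Weights
  open SupportPoints using (∙-scaled-unit)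

  open import Data.Vec.Base using (here; there)

  argmax : ∀ {n} (c : Fin n → ℕ) (J : Subset n) → Nonempty J →
           ∃[ m ] (m ∈ˢ J × (∀ i → i ∈ˢ J → c i ℕ.≤ c m))
  argmax c (outside ∷ J) (suc i , there i∈) =
    let m , m∈ , max = argmax (c ∘ suc) J (i , i∈)
    in suc m , there m∈ , λ { (suc i) (there i∈) → max i i∈ }
  argmax c (inside ∷ J) _ with nonempty? J
  ... | no  J≡∅ = zero , here ,
      λ { zero _ → ℕ.≤-refl ; (suc i) (there i∈) → contradiction (i , i∈) J≡∅ }
  ... | yes J≠∅ with m , m∈ , max ← argmax (c ∘ suc) J J≠∅ | ℕ.≤-total (c zero) (c (suc m))
  ...   | inj₁ c₀≤ = suc m , there m∈ , λ { zero _ → c₀≤ ; (suc i) (there i∈) → max i i∈ }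
  ...   | inj₂ ≤c₀ = zero , here ,
      λ { zero _ → ℕ.≤-refl ; (suc i) (there i∈) → ℕ.≤-trans (max i i∈) ≤c₀ }

  private
    topFrom : ∀ {k} (c : Fin (suc k) → ℕ) J → Dec (Nonempty J) → Fin (suc k)
    topFrom c J (yes J≠∅) = proj₁ (argmax c J J≠∅)
    topFrom c J (no  _)   = zero

    topFrom-∈ : ∀ {k} (c : Fin (suc k) → ℕ) J (d : Dec (Nonempty J)) → Nonempty J →
        topFrom c J d ∈ˢ J
    topFrom-∈ c J (yes J≠∅) _   = proj₁ (proj₂ (argmax c J J≠∅))
    topFrom-∈ c J (no  J≡∅) J≠∅ = contradiction J≠∅ J≡∅

    topFrom-max : ∀ {k} (c : Fin (suc k) → ℕ) J (d : Dec (Nonempty J)) i → i ∈ˢ J → c i ℕ.≤ c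
        (topFrom c J d)
    topFrom-max c J (yes J≠∅) i i∈ = proj₂ (proj₂ (argmax c J J≠∅)) i i∈
    topFrom-max c J (no  J≡∅) i i∈ = contradiction (i , i∈) J≡∅

  top : ∀ {k} → (Fin (suc k) → ℕ) → Subset (suc k) → Fin (suc k)
  top c J = topFrom c J (nonempty? J)

  top-∈ : ∀ {k} (c : Fin (suc k) → ℕ) {J : Subset (suc k)} → Nonempty J → top c J ∈ˢ J
  top-∈ c {J} = topFrom-∈ c J (nonempty? J)

  top-max : ∀ {k} (c : Fin (suc k) → ℕ) {J : Subset (suc k)} i → i ∈ˢ J → c i ℕ.≤ c (top c J)
  top-max c {J} = topFrom-max c J (nonempty? J)

  vertexOf : ∀ {n} → (Subset n → ℝ) → (Subset n → Fin n) → List (Subset n) → Vector ℝ n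
  vertexOf y t []       = zeros
  vertexOf y t (J ∷ Js) = λ i → y J * unit (t J) i + vertexOf y t Js i

  unit-weight-1 : ∀ {n} {J : Subset n} {k} → k ∈ˢ J → IsWeight J 1ℝ (unit k)
  unit-weight-1 {k = k} k∈J = record
    { nonneg  = unit-nonneg k
    ; support = λ {i} i∉J → unit-other k i λ { refl → i∉J k∈J }
    ; total   = ∑-unit k }

  vertexOf-∈ : ∀ {n} (y : Subset n → ℝ) t Js → (∀ {J} → J ∈ Js → t J ∈ˢ J) → minkowski y Js
      (vertexOf y t Js)
  vertexOf-∈ y t []       h = ≃⇒≈ᵖ zeros 0ᵖ λ i → R.sym D-0ℝ
  vertexOf-∈ y t (J ∷ Js) h = v , r ,
    (unit (t J) , weight⇒Δ {J = J} {p = unit (t J)} (t J , h (here refl))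
        (unit-weight-1 (h (here refl))) ,
     ≃⇒≈ᵖ v (y J D.·ᵖ unit (t J)) λ i → R.sym (·ᵖ-def (y J) (unit (t J)) i)) ,
    vertexOf-∈ y t Js (h ∘ there) ,
    ≃⇒≈ᵖ (vertexOf y t (J ∷ Js)) (v D.+ᵖ r) λ i → R.sym (+ᵖ-def v r i)
    where
    v r : Vector ℝ _
    v i = y J * unit (t J) i
    r = vertexOf y t Js

  weight-max : ∀ {n} {J : Subset n} {y s} (h : Vector ℝ n) k → (∀ i → i ∈ˢ J → h i ≼ h k) →
               IsWeight J y s → h ∙ s ≼ y * h k
  weight-max {J = J} {y} {s} h k max w = ≼-respʳ-≃
      (R.trans (R.sym (*-distribʳ-sum (h k) s)) (R.*-congʳ (IsWeight.total w)))
    (∑-mono λ i → term i (i ∈? J))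
    where
    term : ∀ i → Dec (i ∈ˢ J) → h i * s i ≼ s i * h k
    term i (yes i∈) = ≼-respˡ-≃ (R.*-comm (s i) (h i)) (*-monoˡ-≼ (IsWeight.nonneg w i) (max i i∈))
    term i (no  i∉) = ≼-reflexive (R.trans (R.*-congˡ s≃0) (R.trans (R.zeroʳ (h i))
      (R.sym (R.trans (R.*-congʳ s≃0) (R.zeroˡ (h k))))))
      where s≃0 = IsWeight.support w i∉

  -- On a Minkowski sum a functional is maximised summand by summand, and on each simplex at a
  -- vertex of largest value.
  vertexOf-max : ∀ {n} (y : Subset n → ℝ) t Js (h : Vector ℝ n) →
    (∀ {J} → J ∈ Js → 0ℝ ≼ y J) → (∀ {J} → J ∈ Js → ∀ i → i ∈ˢ J → h i ≼ h (t J)) →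
    ∀ x → minkowski y Js x → h ∙ x ≼ h ∙ vertexOf y t Js
  vertexOf-max y t []       h 0≼y max x x≡0 =
    ≼-reflexive (∙-cong h λ i → R.trans (≈ᵖ⇒≃ x 0ᵖ x≡0 i) D-0ℝ)
  vertexOf-max y t (J ∷ Js) h 0≼y max x (s , r , s∈ , r∈ , x≡) =
    ≼-respˡ-≃ (R.sym (R.trans (∙-cong h λ i → R.trans (≈ᵖ⇒≃ x (s D.+ᵖ r) x≡ i) (+ᵖ-def s r i))
        (∙-+ h s r)))
    (≼-respʳ-≃ (R.sym (∙-+ h (λ i → y J * unit (t J) i) (vertexOf y t Js)))
    (+-mono-≼
      (≼-respʳ-≃ (R.sym (∙-scaled-unit h (y J) (t J)))
        (weight-max h (t J) (max (here refl))
          (scaled⇒weight {J = J} {y J} {y J} {s} R.refl (0≼y (here refl)) s∈)))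
      (vertexOf-max y t Js h (0≼y ∘ there) (max ∘ there) r r∈)))

  unit-≼1 : ∀ {n} (k i : Fin n) → unit k i ≼ 1ℝ
  unit-≼1 k i with does (k Fin.≟ i)
  ... | true  = ≼-refl
  ... | false = 0≼1

  ∙-+ˡ : ∀ {n} (u v w : Vector ℝ n) → (λ i → u i + v i) ∙ w ≃ u ∙ w + v ∙ w
  ∙-+ˡ u v w = R.trans (sum-cong-≋ λ i → R.distribʳ (w i) (u i) (v i))
    (∑-distrib-+ (λ i → u i * w i) (λ i → v i * w i))

  unit-∙ : ∀ {n} k (w : Vector ℝ n) → unit k ∙ w ≃ w k
  unit-∙ k w = R.trans (sum-cong-≋ λ i → R.*-comm (unit k i) (w i)) (∙-unit w k)

  neg-unit-∙ : ∀ {n} k (w : Vector ℝ n) → (λ i → - unit k i) ∙ w ≃ - w k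
  neg-unit-∙ k w = begin
    ∑ (λ i → (- unit k i) * w i)       ≈⟨ sum-cong-≋
        (λ i → R.trans (R.sym (R.-‿distribˡ-* (unit k i) (w i))) (neg-1 (unit k i * w i))) ⟩
    ∑ (λ i → (- 1ℝ) * (unit k i * w i)) ≈⟨ *-distribˡ-sum (- 1ℝ) (λ i → unit k i * w i) ⟨
    (- 1ℝ) * (unit k ∙ w)              ≈⟨ R.*-congˡ (unit-∙ k w) ⟩
    (- 1ℝ) * w k                       ≈⟨ neg-1 (w k) ⟨
    - w k                              ∎
    where
    open import Relation.Binary.Reasoning.Setoid R.setoid
    neg-1 : ∀ x → - x ≃ (- 1ℝ) * x
    neg-1 x = R.trans (R.-‿cong (R.sym (R.*-identityˡ x))) (R.-‿distribˡ-* 1ℝ x)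

  neg-anti : ∀ {x y} → x ≼ y → - y ≼ - x
  neg-anti {x} {y} h = ≼-respˡ-≃ lhs (≼-respʳ-≃ rhs (+-mono-≼ h (≼-refl {(- x) + (- y)})))
    where
    lhs : x + ((- x) + (- y)) ≃ - y
    lhs = R.trans (R.sym (R.+-assoc x (- x) (- y)))
        (R.trans (R.+-congʳ (R.-‿inverseʳ x)) (R.+-identityˡ (- y)))
    rhs : y + ((- x) + (- y)) ≃ - x
    rhs = R.trans (R.+-congˡ (R.+-comm (- x) (- y))) (R.trans (R.sym (R.+-assoc y (- y) (- x)))
      (R.trans (R.+-congʳ (R.-‿inverseʳ y)) (R.+-identityˡ (- x))))

  vertex-criterion : ∀ {n} {S : PointSet n} v c → S v → (∀ x → S x → c ∙ x ≼ c ∙ v) →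
    (∀ x → S x → c ∙ x ≃ c ∙ v → ∀ k → x k ≃ v k) → IsVertex S v
  vertex-criterion v c v∈ max unique = v∈ , c , λ x x∈ →
    ≼⇒≤ {c D.∙ x} {c D.∙ v} (≼-respˡ-≃ (R.sym (∙-def c x))
        (≼-respʳ-≃ (R.sym (∙-def c v)) (max x x∈))) ,
    λ same → ≃⇒≈ᵖ x v (unique x x∈ (R.trans (R.sym (∙-def c x))
      (R.trans (≈⇒≃ {c D.∙ x} {c D.∙ v} same) (∙-def c v))))

  -- The functionals c ± e_k attain their maximum at the same vertex as c,
  -- and this pins down its k-th coordinate.
  isVertex : ∀ {n} (y : Subset n → ℝ) t Js (c : Fin n → ℕ) → (∀ {J} → J ∈ Js → 0ℝ ≼ y J) →
    (∀ {J} → J ∈ Js → t J ∈ˢ J) → (∀ {J} → J ∈ Js → ∀ i → i ∈ˢ J → i ≡ t J ⊎ c i ℕ.< c (t J)) →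
    IsVertex (minkowski y Js) (vertexOf y t Js)
  isVertex {n} y t Js c 0≼y t∈ strict = vertex-criterion {S = minkowski y Js} (vertexOf y t Js) C
    (vertexOf-∈ y t Js t∈) (vertexOf-max y t Js C 0≼y max) coordinate
    where
    v = vertexOf y t Js
    C : Vector ℝ n
    C i = fromℕ (c i)
    -- Distinct integer scores differ by at least 1, a gap that adding or subtracting one unit
    -- vector cannot reverse.
    C-< : ∀ {i j} → c i ℕ.< c j → C i + 1ℝ ≼ C j
    C-< {i} {j} lt = ≼-respˡ-≃
        (R.trans (R.reflexive (cong fromℕ (ℕ.+-comm 1 (c i)))) (fromℤ-+ (+ c i) (+ 1)))
      (fromℤ-mono {+ suc (c i)} {+ c j} (ℤ.+≤+ lt))
    max : ∀ {J} → J ∈ Js → ∀ i → i ∈ˢ J → C i ≼ C (t J)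
    max J∈ i i∈ with strict J∈ i i∈
    ... | inj₁ refl = ≼-refl
    ... | inj₂ lt   = ≼-trans (≼-respˡ-≃ (R.+-identityʳ (C i)) (+-mono-≼ ≼-refl 0≼1)) (C-< lt)
    max⁺ : ∀ k {J} → J ∈ Js → ∀ i → i ∈ˢ J → C i + unit k i ≼ C (t J) + unit k (t J)
    max⁺ k {J} J∈ i i∈ with strict J∈ i i∈
    ... | inj₁ refl = ≼-refl
    ... | inj₂ lt   = ≼-trans (+-mono-≼ ≼-refl (unit-≼1 k i)) (≼-trans (C-< lt)
      (≼-respˡ-≃ (R.+-identityʳ _) (+-mono-≼ ≼-refl (unit-nonneg k (t J)))))
    max⁻ : ∀ k {J} → J ∈ Js → ∀ i → i ∈ˢ J → C i + (- unit k i) ≼ C (t J) + (- unit k (t J))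
    max⁻ k {J} J∈ i i∈ with strict J∈ i i∈
    ... | inj₁ refl = ≼-refl
    ... | inj₂ lt   = ≼-trans (≼-respʳ-≃ (R.+-identityʳ (C i)) (+-mono-≼ ≼-refl neg≼0))
      (≼-trans (≼-reflexive (R.sym (R.trans (R.+-assoc (C i) 1ℝ (- 1ℝ))
                 (R.trans (R.+-congˡ (R.-‿inverseʳ 1ℝ)) (R.+-identityʳ (C i))))))
               (+-mono-≼ (C-< lt) (neg-anti (unit-≼1 k (t J)))))
      where
      neg≼0 : - unit k i ≼ 0ℝ
      neg≼0 = ≼-respʳ-≃ R.-0#≈0# (neg-anti (unit-nonneg k i))
    coordinate : ∀ x → minkowski y Js x → C ∙ x ≃ C ∙ v → ∀ k → x k ≃ v k
    coordinate x x∈ same k = ≼-antisym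
      (cancel (≼-respˡ-≃ (expand⁺ x)
          (≼-respʳ-≃ (expand⁺ v) (vertexOf-max y t Js C⁺ 0≼y (max⁺ k) x x∈))))
      (unneg (cancel (≼-respˡ-≃ (expand⁻ x)
          (≼-respʳ-≃ (expand⁻ v) (vertexOf-max y t Js C⁻ 0≼y (max⁻ k) x x∈)))))
      where
      C⁺ C⁻ : Vector ℝ n
      C⁺ i = C i + unit k i
      C⁻ i = C i + (- unit k i)
      expand⁺ : ∀ w → C⁺ ∙ w ≃ w k + C ∙ w
      expand⁺ w = R.trans (∙-+ˡ C (unit k) w) (R.trans (R.+-congˡ (unit-∙ k w)) (R.+-comm _ _))
      expand⁻ : ∀ w → C⁻ ∙ w ≃ (- w k) + C ∙ w
      expand⁻ w = R.trans (∙-+ˡ C (λ i → - unit k i) w)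
          (R.trans (R.+-congˡ (neg-unit-∙ k w)) (R.+-comm _ _))
      cancel : ∀ {a b} → a + C ∙ x ≼ b + C ∙ v → a ≼ b
      cancel {a} {b} h = +-cancelʳ-≼ (C ∙ x) (≼-respʳ-≃ (R.+-congˡ {b} (R.sym same)) h)
      unneg : - x k ≼ - v k → v k ≼ x k
      unneg h = ≼-respˡ-≃ (R.-‿involutive (v k)) (≼-respʳ-≃ (R.-‿involutive (x k)) (neg-anti h))

  IsInteger : ℝ → Set
  IsInteger x = ∃[ i ] x ≃ fromℤ i

  isInteger-+ : ∀ {x y} → IsInteger x → IsInteger y → IsInteger (x + y)
  isInteger-+ (i , x≃) (j , y≃) = i ℤ.+ j , R.trans (R.+-cong x≃ y≃) (R.sym (fromℤ-+ i j))

  isInteger-difference : ∀ {x y} → IsInteger (x + y) → IsInteger y → IsInteger x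
  isInteger-difference {x} {y} (i , s≃) (j , y≃) = i ℤ.+ ℤ.- j , (begin
    x                          ≈⟨ R.+-identityʳ x ⟨
    x + 0ℝ                     ≈⟨ R.+-congˡ (R.-‿inverseʳ y) ⟨
    x + (y + (- y))            ≈⟨ R.+-assoc x y (- y) ⟨
    (x + y) + (- y)            ≈⟨ R.+-cong s≃ (R.trans (R.-‿cong y≃) (R.sym (fromℤ-neg j))) ⟩
    fromℤ i + fromℤ (ℤ.- j)    ≈⟨ fromℤ-+ i (ℤ.- j) ⟨
    fromℤ (i ℤ.+ ℤ.- j)        ∎)
    where open import Relation.Binary.Reasoning.Setoid R.setoid

  isInteger-resp-≃ : ∀ {x y} → x ≃ y → IsInteger x → IsInteger y
  isInteger-resp-≃ e (i , x≃) = i , R.trans (R.sym e) x≃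

  positive-integer : ∀ {x} → IsInteger x → Positive x → ∃[ t ] x ≃ fromℕ (suc t)
  positive-integer (+ zero   , x≃) p = contradiction (positive-resp-≃ x≃ p) ¬positive-0
  positive-integer (+ suc t  , x≃) p = t , x≃
  positive-integer (-[1+ t ] , x≃) p = contradiction
    (≼-respˡ-≃ (R.sym x≃) (fromℤ-mono { -[1+ t ] } {+ 0} ℤ.-≤+)) (positive⇒⋠0 p)

  -- Ranks the elements of I below all others, so that only the members of
  -- the building set inside I can have their maximum in I.
  score : ∀ {n} → Subset n → Fin n → ℕ
  score {n} I i = toℕ i ℕ.+ (if does (i ∈? I) then 0 else n)

  score-in : ∀ {n} (I : Subset n) i → i ∈ˢ I → score I i ≡ toℕ i
  score-in I i i∈ with i ∈? I
  ... | yes _  = ℕ.+-identityʳ (toℕ i)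
  ... | no  i∉ = contradiction i∈ i∉

  score-out : ∀ {n} (I : Subset n) i → i ∉ˢ I → score I i ≡ toℕ i ℕ.+ n
  score-out I i i∉ with i ∈? I
  ... | yes i∈ = contradiction i∈ i∉
  ... | no  _  = refl

  score-injective : ∀ {n} (I : Subset n) i j → score I i ≡ score I j → i ≡ j
  score-injective {n} I i j eq with i ∈? I | j ∈? I
  ... | yes _ | yes _ = Fin.toℕ-injective (ℕ.+-cancelʳ-≡ 0 (toℕ i) (toℕ j) eq)
  ... | no  _ | no  _ = Fin.toℕ-injective (ℕ.+-cancelʳ-≡ n (toℕ i) (toℕ j) eq)
  ... | yes _ | no  _ = contradiction
    (ℕ.≤-<-trans (ℕ.≤-trans (ℕ.m≤n+m n (toℕ j))
        (ℕ.≤-reflexive (≡.trans (≡.sym eq) (ℕ.+-identityʳ (toℕ i))))) (Fin.toℕ<n i))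
    (ℕ.<-irrefl refl)
  ... | no  _ | yes _ = contradiction
    (ℕ.≤-<-trans (ℕ.≤-trans (ℕ.m≤n+m n (toℕ i))
        (ℕ.≤-reflexive (≡.trans eq (ℕ.+-identityʳ (toℕ j))))) (Fin.toℕ<n j))
    (ℕ.<-irrefl refl)

  -- Scores inside I stay below k + 1 and all others reach it, so a set whose top lies in I has no
  -- element outside I.
  score-top : ∀ {k} (I J : Subset (suc k)) → top (score I) J ∈ˢ I → J ⊆ I
  score-top {k} I J top∈I {i} i∈J = decidable-stable (i ∈? I) λ i∉I → ℕ.<-irrefl refl (ℕ.<-≤-trans
    (ℕ.≤-<-trans (ℕ.≤-trans (ℕ.≤-reflexive (≡.sym (score-out I i i∉I))) (top-max (score I) i i∈J))
      (ℕ.≤-<-trans (ℕ.≤-reflexive (score-in I _ top∈I)) (Fin.toℕ<n (top (score I) J))))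
    (ℕ.m≤n+m (suc k) (toℕ i)))

  score-strict : ∀ {k} (I : Subset (suc k)) {J} i → i ∈ˢ J →
                 i ≡ top (score I) J ⊎ score I i ℕ.< score I (top (score I) J)
  score-strict I {J} i i∈ = go (score I i ℕ.≟ score I (top (score I) J))
    where
    go : Dec (score I i ≡ score I (top (score I) J)) → _
    go (yes eq) = inj₁ (score-injective I i _ eq)
    go (no neq) = inj₂ (ℕ.≤∧≢⇒< (top-max (score I) i i∈) neq)

  ⊆-≢⇒∣∣< : ∀ {n} {J I : Subset n} → J ⊆ I → J ≢ I → ∣ J ∣ ℕ.< ∣ I ∣
  ⊆-≢⇒∣∣< {J = J} {I} J⊆I J≢I = go (Fin.any? λ x → (x ∈? I) ×-dec ¬? (x ∈? J))
    where
    go : Dec (∃[ x ] (x ∈ˢ I × ¬ (x ∈ˢ J))) → ∣ J ∣ ℕ.< ∣ I ∣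
    go (yes w) = p⊂q⇒∣p∣<∣q∣ (J⊆I , w)
    go (no ¬w) = contradiction
        (⊆-antisym J⊆I λ {x} x∈I → decidable-stable (x ∈? J) λ x∉J → ¬w (x , x∈I , x∉J)) J≢I

  module _ {k} (P : BinaryNestohedron (suc k)) (integral-P : IsIntegral ⟦ P ⟧) where

    open BinaryNestohedron P
    open IsBinaryBuildingSet buildingSet

    private
      integral-minkowski : IsIntegral (minkowski y ℬ)
      integral-minkowski = integral-P

      0≼y : ∀ {J} → J ∈ ℬ → 0ℝ ≼ y J
      0≼y J∈ = positive⇒≼ (positive (y-positive J∈))

      module _ (I : Subset (suc k)) where

        t : Subset (suc k) → Fin (suc k)
        t = top (score I)

        v-integral : ∃[ q ] (vertexOf y t ℬ ≈ᵖ D.fromℤᵖ q)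
        v-integral = integral-minkowski (vertexOf y t ℬ) (isVertex y t ℬ (score I) 0≼y
          (λ J∈ → top-∈ (score I) (nonempty J∈)) (λ {J} _ i i∈ → score-strict I {J} i i∈))

        v-integer : ∀ i → IsInteger (vertexOf y t ℬ i)
        v-integer i = lookup (proj₁ v-integral) i ,
          R.trans (≈ᵖ⇒≃ (vertexOf y t ℬ) (D.fromℤᵖ (proj₁ v-integral)) (proj₂ v-integral) i)
                  (D-fromℤ (lookup (proj₁ v-integral) i))

        module _ (I∈ℬ : I ∈ ℬ) (smaller : ∀ {J} → J ∈ ℬ → ∣ J ∣ ℕ.< ∣ I ∣ → IsInteger (y J)) where

          -- The summand of J reaches the coordinate `t I` only if J has the same top. Then J is a
          -- proper subset of I, and its weight is an integer by induction.
          term-integer : ∀ {J} → J ∈ ℬ → J ≢ I → IsInteger (y J * unit (t J) (t I))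
          term-integer {J} J∈ J≢I = go (t J Fin.≟ t I)
            where
            go : Dec (t J ≡ t I) → IsInteger (y J * unit (t J) (t I))
            go (no  tJ≢tI) = + 0 , R.trans (R.*-congˡ (unit-other (t J) (t I) tJ≢tI))
                (R.zeroʳ (y J))
            go (yes tJ≡tI) = isInteger-resp-≃
              (R.sym (R.trans (R.*-congˡ
                  (R.trans (R.reflexive (cong (λ i → unit i (t I)) tJ≡tI)) (unit-same (t I))))
                              (R.*-identityʳ (y J))))
              (smaller J∈ (⊆-≢⇒∣∣< (score-top I J
                  (subst (_∈ˢ I) (≡.sym tJ≡tI) (top-∈ (score I) (nonempty I∈ℬ)))) J≢I))

          rest-integer : ∀ Js → (∀ {J} → J ∈ Js → J ∈ ℬ) → All (I ≢_) Js → IsInteger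
              (vertexOf y t Js (t I))
          rest-integer []       sub I∉         = + 0 , R.refl
          rest-integer (J ∷ Js) sub (I≢J ∷ I∉) =
            isInteger-+ (term-integer (sub (here refl)) (I≢J ∘ ≡.sym))
                (rest-integer Js (sub ∘ there) I∉)

          -- The coordinate `t I` of the vertex is an integer; subtracting the integral summands of
          -- all other members leaves the weight of I.
          extract : ∀ Js → (∀ {J} → J ∈ Js → J ∈ ℬ) → Unique Js → I ∈ Js →
                    IsInteger (vertexOf y t Js (t I)) → IsInteger (y I)
          extract (J ∷ Js) sub (I∉ ∷ u) (here refl) h = isInteger-resp-≃
            (R.trans (R.*-congˡ (unit-same (t I))) (R.*-identityʳ (y I)))
            (isInteger-difference h (rest-integer Js (sub ∘ there) I∉))
          extract (J ∷ Js) sub (J∉ ∷ u) (there I∈)  h = extract Js (sub ∘ there) u I∈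
            (isInteger-difference (isInteger-resp-≃ (R.+-comm _ _) h)
              (term-integer (sub (here refl)) (λ { refl → All.lookup J∉ I∈ refl })))

          weight-integer : IsInteger (y I)
          weight-integer = extract ℬ (λ J∈ → J∈) unique I∈ℬ (v-integer (t I))

      weights-integer : ∀ d {I} → ∣ I ∣ ℕ.< d → I ∈ ℬ → IsInteger (y I)
      weights-integer (suc d) {I} (s≤s l) I∈ =
        weight-integer I I∈ λ J∈ lt → weights-integer d (ℕ.<-≤-trans lt l) J∈

    integral⇒weights : ∀ {I} → I ∈ ℬ → ∃[ t ] y I ≃ fromℕ (suc t)
    integral⇒weights {I} I∈ = positive-integer (weights-integer (suc ∣ I ∣) ℕ.≤-refl I∈)
        (positive (y-positive I∈))

-- Refining a laminar family of intervals to a tree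

module LaminarTrees where

  open import Data.List.Membership.Propositional using (_∈_)
  open import Data.Nat using (_+_)

  open Subsets
  open Sums using (elim-+)
  open Trees using (Tree; leaf; node)
  open TreePolytope
  open Nestohedra using (⁅↑ˡ⁆; ⁅↑ʳ⁆)

  -- A predicate in place of a list, and convexity in place of endpoints: both restrict to one half
  -- of the index set by composition with `extendˡ` or `extendʳ`.
  record Laminar {n} (B : Subset n → Set) : Set where
    field
      dec       : ∀ J → Dec (B J)
      nonempty  : ∀ {J} → B J → Nonempty J
      convex    : ∀ {J x y z} → B J → x Fin.≤ y → y Fin.≤ z → x ∈ˢ J → z ∈ˢ J → y ∈ˢ J
      singleton : ∀ i → B ⁅ i ⁆
      laminar   : ∀ {I J} → B I → B J → Nonempty (I ∩ J) → (I ⊆ˢ J) ⊎ (J ⊆ˢ I)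

  prefix : ∀ n → ℕ → Subset n
  prefix zero    k       = []
  prefix (suc n) zero    = outside ∷ prefix n zero
  prefix (suc n) (suc k) = inside ∷ prefix n k

  prefix-0 : ∀ n → prefix n 0 ≡ ⊥
  prefix-0 zero    = refl
  prefix-0 (suc n) = cong (outside ∷_) (prefix-0 n)

  prefix-all : ∀ n → prefix n n ≡ ⊤
  prefix-all zero    = refl
  prefix-all (suc n) = cong (inside ∷_) (prefix-all n)

  prefix-++ : ∀ m n → prefix (m + n) m ≡ ⊤ {m} Vec.++ ⊥ {n}
  prefix-++ zero    n = prefix-0 n
  prefix-++ (suc m) n = cong (inside ∷_) (prefix-++ m n)

  prefix-mono : ∀ n {p m} → p ≤ m → prefix n p ⊆ˢ prefix n m
  prefix-mono (suc n) {zero}          p≤m       (there i∈) =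
    contradiction (subst (_ ∈ˢ_) (prefix-0 n) i∈) ∉⊥
  prefix-mono (suc n) {suc p} {suc m} (s≤s p≤m) here       = here
  prefix-mono (suc n) {suc p} {suc m} (s≤s p≤m) (there i∈) = there (prefix-mono n p≤m i∈)

  downclosed⇒prefix : ∀ {n} (J : Subset n) → (∀ {x y} → x Fin.≤ y → y ∈ˢ J → x ∈ˢ J) →
                      ∃[ p ] (p ≤ n × J ≡ prefix n p)
  downclosed⇒prefix []            d = 0 , z≤n , refl
  downclosed⇒prefix {suc n} (outside ∷ J) d = 0 , z≤n , cong (outside ∷_)
    (≡.trans (Empty-unique λ (x , x∈J) → zero∉ (d {zero} {suc x} z≤n (there x∈J)))
        (≡.sym (prefix-0 n)))
    where
    zero∉ : zero ∉ˢ outside ∷ J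
    zero∉ ()
  downclosed⇒prefix (inside ∷ J)  d =
    let p , p≤n , J≡ = downclosed⇒prefix J λ {x} {y} x≤y y∈J → unsuc (d {suc x} {suc y} (s≤s x≤y) (there y∈J))
    in suc p , s≤s p≤n , cong (inside ∷_) J≡
    where
    unsuc : ∀ {x} → suc x ∈ˢ inside ∷ J → x ∈ˢ J
    unsuc (there x∈J) = x∈J

  largest : ∀ {Q : ℕ → Set} → (∀ i → Dec (Q i)) → ∀ j → Q 1 →
            ∃[ m ] (1 ≤ m × m ≤ suc j × Q m × (∀ i → m < i → i ≤ suc j → ¬ Q i))
  largest Q? zero    q₁ = 1 , s≤s z≤n , s≤s z≤n , q₁ , λ i 1<i i≤1 → contradiction
      (ℕ.<-≤-trans 1<i i≤1) (ℕ.<-irrefl refl)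
  largest Q? (suc j) q₁ with Q? (suc (suc j))
  ... | yes q = suc (suc j) , s≤s z≤n , ℕ.≤-refl , q , λ i m<i i≤m → contradiction
      (ℕ.<-≤-trans m<i i≤m) (ℕ.<-irrefl refl)
  ... | no ¬q =
    let m , 1≤m , m≤ , q , above = largest Q? j q₁
    in m , 1≤m , ℕ.m≤n⇒m≤1+n m≤ , q , λ i m<i i≤ → bound i m<i i≤ above (i ℕ.≟ suc (suc j))
    where
    bound : ∀ {m} i → m < i → i ≤ suc (suc j) → (∀ i → m < i → i ≤ suc j → ¬ _) → Dec
        (i ≡ suc (suc j)) → ¬ _
    bound i m<i i≤ above (yes refl) = ¬q
    bound i m<i i≤ above (no i≢)    = above i m<i (ℕ.s≤s⁻¹ (ℕ.≤∧≢⇒< i≤ i≢))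

  data Separated (m n : ℕ) : Subset (m + n) → Set where
    all   : Separated m n ⊤
    inˡ   : ∀ J → Separated m n (extendˡ n J)
    inʳ   : ∀ K → Separated m n (extendʳ m K)

  module _ {m n} {B : Subset (m + n) → Set} (L : Laminar B) (1≤m : 1 ≤ m)
           (prefix∈ : B (prefix (m + n) m)) (maximal : ∀ i → m < i → i < m + n → ¬ B (prefix (m + n) i)) where

    open Laminar L

    private
      K = ⊤ {m} Vec.++ ⊥ {n}

      K∈ : B K
      K∈ = subst B (prefix-++ m n) prefix∈

      inside-K : ∀ J → J ⊆ˢ K → Separated m n J
      inside-K J J⊆K = subst (Separated m n) (≡.trans
        (cong (left m J Vec.++_) (≡.sym (Empty-unique λ (j , j∈) → ∉⊥ (∈-++⁻ʳ (⊤ {m}) (⊥ {n})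
          (J⊆K (subst (m ↑ʳ j ∈ˢ_) (left-++-right m J) (∈-++⁺ʳ (left m J) (right m J) j∈)))))))
        (left-++-right m J)) (inˡ (left m J))

      outside-K : ∀ J → ¬ Nonempty (J ∩ K) → Separated m n J
      outside-K J J∩K≡∅ = subst (Separated m n) (≡.trans
        (cong (Vec._++ right m J) (≡.sym (Empty-unique λ (i , i∈) → J∩K≡∅ (i ↑ˡ n , x∈p∩q⁺
          (subst (i ↑ˡ n ∈ˢ_) (left-++-right m J) (∈-++⁺ˡ (left m J) (right m J) i∈) ,
           ∈-++⁺ˡ (⊤ {m}) (⊥ {n}) ∈⊤)))))
        (left-++-right m J)) (inʳ (right m J))

      first : ∀ {m} → 1 ≤ m → Σ[ z ∈ Fin m ] toℕ z ≡ 0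
      first (s≤s _) = zero , refl

      around-K : ∀ J → B J → K ⊆ˢ J → Separated m n J
      around-K J J∈ K⊆J with downclosed⇒prefix J downclosed
        where
        z = proj₁ (first 1≤m) ↑ˡ n
        downclosed : ∀ {x y} → x Fin.≤ y → y ∈ˢ J → x ∈ˢ J
        downclosed x≤y y∈J = convex J∈
          (ℕ.≤-trans (ℕ.≤-reflexive
              (≡.trans (Fin.toℕ-↑ˡ (proj₁ (first 1≤m)) n) (proj₂ (first 1≤m)))) z≤n)
          x≤y (K⊆J {z} (∈-++⁺ˡ (⊤ {m}) (⊥ {n}) ∈⊤)) y∈J
      ... | p , p≤ , refl with p ℕ.≤? m | p ℕ.≟ m + n
      ...   | yes p≤m | _        = inside-K _ λ x∈ → subst (_ ∈ˢ_) (prefix-++ m n)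
          (prefix-mono (m + n) p≤m x∈)
      ...   | no  p≰m | yes refl = subst (Separated m n) (≡.sym (prefix-all (m + n))) all
      ...   | no  p≰m | no  p≢   = contradiction J∈ (maximal p (ℕ.≰⇒> p≰m) (ℕ.≤∧≢⇒< p≤ p≢))

    -- A member that meets the prefix K is comparable with K. If it contains K, it contains the
    -- first index and is itself a prefix by convexity; as K is the largest proper prefix in the
    -- family, it is K or the full set. A member disjoint from K lies in the right half.
    separated : ∀ {J} → B J → Separated m n J
    separated {J} J∈ with nonempty? (J ∩ K)
    ... | no  J∩K≡∅ = outside-K J J∩K≡∅
    ... | yes meet with laminar J∈ K∈ meet
    ...   | inj₁ J⊆K = inside-K J J⊆K
    ...   | inj₂ K⊆J = around-K J J∈ K⊆J

  ∩-map : ∀ {m n} {f : Fin m → Fin n} {I J : Subset m} {I′ J′ : Subset n} →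
          (∀ {i} → i ∈ˢ I → f i ∈ˢ I′) → (∀ {i} → i ∈ˢ J → f i ∈ˢ J′) → Nonempty (I ∩ J) →
              Nonempty (I′ ∩ J′)
  ∩-map {f = f} {I} {J} g h (i , i∈) = let i∈I , i∈J = x∈p∩q⁻ I J i∈ in f i , x∈p∩q⁺ (g i∈I , h i∈J)

  module _ {m n} {B : Subset (m + n) → Set} (L : Laminar B) where

    open Laminar L

    laminarˡ : Laminar (B ∘ extendˡ n)
    laminarˡ = record
      { dec       = dec ∘ extendˡ n
      ; nonempty  = λ {J} J∈ → let x , x∈ = nonempty J∈ in
          elim-+ m (λ x → x ∈ˢ extendˡ n J → Nonempty J) (λ i i∈ → i , ∈-++⁻ˡ J ⊥ i∈)
            (λ j j∈ → contradiction (∈-++⁻ʳ J ⊥ j∈) ∉⊥) x x∈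
      ; convex    = λ {J} {x} {y} {z} J∈ x≤y y≤z x∈ z∈ → ∈-++⁻ˡ J ⊥ (convex J∈
          (≡.subst₂ ℕ._≤_ (≡.sym (Fin.toℕ-↑ˡ x n)) (≡.sym (Fin.toℕ-↑ˡ y n)) x≤y)
          (≡.subst₂ ℕ._≤_ (≡.sym (Fin.toℕ-↑ˡ y n)) (≡.sym (Fin.toℕ-↑ˡ z n)) y≤z)
          (∈-++⁺ˡ J ⊥ x∈) (∈-++⁺ˡ J ⊥ z∈))
      ; singleton = λ i → subst B (⁅↑ˡ⁆ n i) (singleton (i ↑ˡ n))
      ; laminar   = λ {I} {J} I∈ J∈ meet → restrict I J
          (laminar I∈ J∈ (∩-map {I = I} {J} (∈-++⁺ˡ I ⊥) (∈-++⁺ˡ J ⊥) meet)) }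
      where
      restrict : ∀ (I J : Subset m) → (extendˡ n I ⊆ˢ extendˡ n J) ⊎
          (extendˡ n J ⊆ˢ extendˡ n I) → (I ⊆ˢ J) ⊎ (J ⊆ˢ I)
      restrict I J (inj₁ I⊆J) = inj₁ λ x∈ → ∈-++⁻ˡ J ⊥ (I⊆J (∈-++⁺ˡ I ⊥ x∈))
      restrict I J (inj₂ J⊆I) = inj₂ λ x∈ → ∈-++⁻ˡ I ⊥ (J⊆I (∈-++⁺ˡ J ⊥ x∈))

    laminarʳ : Laminar (B ∘ extendʳ m)
    laminarʳ = record
      { dec       = dec ∘ extendʳ m
      ; nonempty  = λ {J} J∈ → let x , x∈ = nonempty J∈ in
          elim-+ m (λ x → x ∈ˢ extendʳ m J → Nonempty J)
            (λ i i∈ → contradiction (∈-++⁻ˡ (⊥ {m}) J i∈) ∉⊥)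
                (λ j j∈ → j , ∈-++⁻ʳ (⊥ {m}) J j∈) x x∈
      ; convex    = λ {J} {x} {y} {z} J∈ x≤y y≤z x∈ z∈ → ∈-++⁻ʳ (⊥ {m}) J (convex J∈
          (≡.subst₂ ℕ._≤_ (≡.sym (Fin.toℕ-↑ʳ m x)) (≡.sym (Fin.toℕ-↑ʳ m y)) (ℕ.+-monoʳ-≤ m x≤y))
          (≡.subst₂ ℕ._≤_ (≡.sym (Fin.toℕ-↑ʳ m y)) (≡.sym (Fin.toℕ-↑ʳ m z)) (ℕ.+-monoʳ-≤ m y≤z))
          (∈-++⁺ʳ (⊥ {m}) J x∈) (∈-++⁺ʳ (⊥ {m}) J z∈))
      ; singleton = λ j → subst B (⁅↑ʳ⁆ m j) (singleton (m ↑ʳ j))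
      ; laminar   = λ {I} {J} I∈ J∈ meet → restrict I J
          (laminar I∈ J∈ (∩-map {I = I} {J} (∈-++⁺ʳ (⊥ {m}) I) (∈-++⁺ʳ (⊥ {m}) J) meet)) }
      where
      restrict : ∀ (I J : Subset n) → (extendʳ m I ⊆ˢ extendʳ m J) ⊎
          (extendʳ m J ⊆ˢ extendʳ m I) → (I ⊆ˢ J) ⊎ (J ⊆ˢ I)
      restrict I J (inj₁ I⊆J) = inj₁ λ x∈ → ∈-++⁻ʳ (⊥ {m}) J (I⊆J (∈-++⁺ʳ (⊥ {m}) I x∈))
      restrict I J (inj₂ J⊆I) = inj₂ λ x∈ → ∈-++⁻ʳ (⊥ {m}) I (J⊆I (∈-++⁺ʳ (⊥ {m}) J x∈))

  TreeFor : ∀ {n} → (Subset n → Set) → (Subset n → ℕ) → Set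
  TreeFor {n} B Y = Σ[ T ∈ Tree n ]
      ((∀ J → B J ⇔ J ∈ buildingList T) × (∀ {J} → B J → Y J ≡ weightOf T J))

  -- The full set is the only member that can cross the cut. If it does not belong to the family,
  -- the root receives weight 0.
  join : ∀ {m n} {B : Subset (m + n) → Set} {Y} → Laminar B → (∀ {J} → B J → ∃[ t ] Y J ≡ suc t) →
         (∀ {J} → B J → Separated m n J) → TreeFor (B ∘ extendˡ n) (Y ∘ extendˡ n) →
         TreeFor (B ∘ extendʳ m) (Y ∘ extendʳ m) → TreeFor B Y
  join {m} {n} {B} {Y} L Y>0 separated (l , l⇔ , l≡) (r , r⇔ , r≡) = go (dec ⊤)
    where
    open Laminar L
    assemble : ∀ w → (B ⊤ → Y ⊤ ≡ w) → (w ≢ 0 → B ⊤) → TreeFor B Y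
    assemble w Y⊤≡ w⇒⊤ = node l r w , (λ J → mk⇔ (to J) (from ∘ inBuildingList l r w)) , weights
      where
      w≢0 : B ⊤ → w ≢ 0
      w≢0 ⊤∈ refl with t , eq ← Y>0 ⊤∈ = contradiction (≡.trans (≡.sym eq) (Y⊤≡ ⊤∈)) λ ()
      to : ∀ J → B J → J ∈ buildingList (node l r w)
      to J J∈ with separated J∈
      ... | all   = buildingList-∈ l r w (in⊤ (w≢0 J∈))
      ... | inˡ J = buildingList-∈ l r w (inˡ (Equivalence.to (l⇔ J) J∈))
      ... | inʳ K = buildingList-∈ l r w (inʳ (Equivalence.to (r⇔ K) J∈))
      from : ∀ {J} → InBuildingList l r w J → B J
      from (inˡ {J} J∈) = Equivalence.from (l⇔ J) J∈
      from (inʳ {K} K∈) = Equivalence.from (r⇔ K) K∈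
      from (in⊤ w≢0)    = w⇒⊤ w≢0
      weights : ∀ {J} → B J → Y J ≡ weightOf (node l r w) J
      weights J∈ with separated J∈
      ... | all   = ≡.trans (Y⊤≡ J∈) (≡.sym (weightOf-⊤ l r w))
      ... | inˡ J = ≡.trans (l≡ J∈) (≡.sym (weightOf-extendˡ l r w J))
      ... | inʳ K = ≡.trans (r≡ J∈)
          (≡.sym (weightOf-extendʳ l r w K (Laminar.nonempty (laminarʳ L) J∈)))
    go : Dec (B ⊤) → TreeFor B Y
    go (yes ⊤∈) = assemble (Y ⊤) (λ _ → refl) (λ _ → ⊤∈)
    go (no  ⊤∉) = assemble 0 (λ ⊤∈ → contradiction ⊤∈ ⊤∉) (λ 0≢0 → contradiction refl 0≢0)

  laminar⇒tree : ∀ {n} → 1 ≤ n → ∀ {B : Subset n → Set} {Y} → Laminar B →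
                 (∀ {J} → B J → ∃[ t ] Y J ≡ suc t) → TreeFor B Y
  laminar⇒tree {n} = build n ℕ.≤-refl
    where
    build : ∀ d {n} → n ≤ d → 1 ≤ n → ∀ {B : Subset n → Set} {Y} → Laminar B →
            (∀ {J} → B J → ∃[ t ] Y J ≡ suc t) → TreeFor B Y
    -- The size enters as an equation m + n′ ≡ n, so that a prefix length can be turned into a
    -- concatenation by matching on `refl`.
    divide : ∀ d {n} m n′ → m + n′ ≡ n → n ≤ suc d → 1 ≤ m → 1 ≤ n′ → ∀ {B : Subset n → Set} {Y} →
        Laminar B →
             (∀ {J} → B J → ∃[ t ] Y J ≡ suc t) → B (prefix n m) →
                 (∀ i → m < i → i < n → ¬ B (prefix n i)) → TreeFor B Y

    build (suc d) {suc zero} l _ {B} {Y} L Y>0 =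
      leaf (proj₁ (Y>0 (singleton zero))) ,
          (λ J → mk⇔ (here ∘ is-⊤ J) λ { (here refl) → singleton zero }) ,
      λ {J} J∈ → ≡.trans (cong Y (is-⊤ J J∈)) (proj₂ (Y>0 (singleton zero)))
      where
      open Laminar L
      is-⊤ : ∀ J → B J → J ≡ ⊤
      is-⊤ (inside  ∷ []) J∈ = refl
      is-⊤ (outside ∷ []) J∈ with nonempty J∈
      ... | zero , ()
    build (suc d) {suc (suc k)} l _ {B} L Y>0 =
      -- The cut is placed after the largest proper prefix in the family. The prefix of length 1 is
      -- a singleton and hence a member, so there is one.
      let m , 1≤m , m≤ , m∈ , above = largest {λ i → B (prefix (suc (suc k)) i)} (dec ∘ prefix (suc (suc k))) k
            (subst B (cong (inside ∷_) (≡.sym (prefix-0 (suc k)))) (singleton zero))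
      in divide d m (suc (suc k) ℕ.∸ m) (ℕ.m+[n∸m]≡n (ℕ.m≤n⇒m≤1+n m≤)) l 1≤m
          (ℕ.m<n⇒0<n∸m (s≤s m≤)) L Y>0 m∈
           λ i m<i i< → above i m<i (ℕ.s≤s⁻¹ i<)
      where open Laminar L

    divide d m n′ refl l 1≤m 1≤n′ L Y>0 m∈ maximal = join L Y>0 (separated L 1≤m m∈ maximal)
      (build d (ℕ.s≤s⁻¹ (ℕ.≤-trans (ℕ.+-mono-≤ 1≤n′ (ℕ.≤-refl {m}))
          (ℕ.≤-trans (ℕ.≤-reflexive (ℕ.+-comm n′ m)) l)))
        1≤m (laminarˡ L) Y>0)
      (build d (ℕ.s≤s⁻¹ (ℕ.≤-trans (ℕ.+-mono-≤ 1≤m (ℕ.≤-refl {n′})) l)) 1≤n′ (laminarʳ L) Y>0)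

-- The two implications

open import Data.List.Membership.Propositional using (_∈_)

open import Defs
open Polynomial
open RealRoots
open Fertility using (fert)
open Preimages using (∑-fibre; isPermutation-↭; preimages; preimages-enumerates)
open Trees using (Tree; leaf; treeₛ; tree-size; WordTree; wordTree; treeOfWord; module TreeWord; wordOfTree)
open LatticeLists using (points; ∑-points)
open Nestohedra using (nestohedron; lattice-points)
open SupportPoints using (nestohedron-integral)
open Reals using (module R; _≃_; D-fromℤ)
open Nestohedra using (Represents)
open Vertices using (integral⇒weights)
open LaminarTrees using (Laminar; TreeFor; laminar⇒tree)
open Weights using (fromℕ)
open TreePolytope using (weightOf)

FibresRealRooted NestohedraRealRooted : Set
FibresRealRooted = ∀ π → IsPermutation π →
  ∀ σs → σs Enumerates (λ σ → IsPermutation σ × stackSort σ ≡ π) →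
  OnlyRealRoots (∑ σs (λ σ → monomial 1ℚ (suc (des σ))))
NestohedraRealRooted = ∀ k (P : BinaryNestohedron (suc k)) → IsIntegral ⟦ P ⟧ →
  ∀ qs → qs Enumerates LatticePoint ⟦ P ⟧ →
  OnlyRealRoots (∑ qs narayanaᵛ)

nestohedra⇒tree : NestohedraRealRooted → ∀ {n} (T : Tree n) → OnlyRealRoots
    (∑ (points T 0) narayanaᵛ)
nestohedra⇒tree B T = go (tree-size T) T
  where
  go : ∀ {n} → ∃[ k ] n ≡ suc k → (T : Tree n) → OnlyRealRoots (∑ (points T 0) narayanaᵛ)
  go (k , refl) T = B k (nestohedron T) (nestohedron-integral T) (points T 0)
    (lattice-points (nestohedron T) T ((λ J → mk⇔ (λ J∈ → J∈) (λ J∈ → J∈)) , λ _ → R.refl))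

nestohedra⇒fert : NestohedraRealRooted → ∀ w → IsPermutation w → OnlyRealRoots (fert w)
-- For the empty permutation F = x = N₁, the sum over the single lattice point of the one-leaf tree
-- of weight 1.
nestohedra⇒fert B []      perm = OnlyRealRoots-resp-≋ (∑-points (leaf 0) 0)
    (nestohedra⇒tree B (leaf 0))
nestohedra⇒fert B (n ∷ w) perm = go (treeOfWord (n ∷ w) (λ ()) (proj₂ perm))
  where
  go : WordTree (n ∷ w) → OnlyRealRoots (fert (n ∷ w))
  go (wordTree T zero    e) = OnlyRealRoots-resp-≋ (≋-trans (∑-points T 0) (≋-sym (e 0)))
      (nestohedra⇒tree B T)
  -- A positive deficit with no maximum appended: F is the zero polynomial, which counts as
  -- real-rooted.
  go (wordTree T (suc d) e) = OnlyRealRoots-resp-≋ (≋-sym (e 0)) (inj₁ [])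

nestohedra⇒fibres : NestohedraRealRooted → FibresRealRooted
nestohedra⇒fibres B π perm σs σs-enum = OnlyRealRoots-resp-≋
  (≋-sym (∑-fibre w perm-w (subst (λ π → σs Enumerates (λ σ → IsPermutation σ × stackSort σ ≡ π))
    (≡.sym (reverse-involutive π)) σs-enum)))
  (nestohedra⇒fert B w perm-w)
  where
  w = reverse π
  perm-w = isPermutation-↭ (↭.↭-sym (↭.↭-reverse π)) perm

module _ {k} (P : BinaryNestohedron (suc k)) (integral-P : IsIntegral ⟦ P ⟧) where

  open BinaryNestohedron P
  open IsBinaryBuildingSet buildingSet

  private
    _∈ℬ? : ∀ J → Dec (J ∈ ℬ)
    J ∈ℬ? = DecMembership._∈?_ (≡-dec _≟ᵇ_) J ℬ

    weightFrom : ∀ {J} → Dec (J ∈ ℬ) → ℕ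
    weightFrom (yes J∈) = suc (proj₁ (integral⇒weights P integral-P J∈))
    weightFrom (no  _)  = 0

    weightFrom-suc : ∀ {J} (d : Dec (J ∈ ℬ)) → J ∈ ℬ → ∃[ t ] weightFrom d ≡ suc t
    weightFrom-suc (yes J∈) _  = _ , refl
    weightFrom-suc (no  J∉) J∈ = contradiction J∈ J∉

    weightFrom-≃ : ∀ {J} (d : Dec (J ∈ ℬ)) → J ∈ ℬ → y J ≃ fromℕ (weightFrom d)
    weightFrom-≃ (yes J∈) _  = proj₂ (integral⇒weights P integral-P J∈)
    weightFrom-≃ (no  J∉) J∈ = contradiction J∈ J∉

    ℬ-laminar : Laminar (_∈ ℬ)
    ℬ-laminar = record
      { dec = _∈ℬ? ; nonempty = nonempty ; singleton = singletons ; laminar = laminar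
      ; convex = λ {_} {x} {y} {z} J∈ x≤y y≤z x∈ z∈ → let i , j , h = intervals J∈ in
          Equivalence.from (h y) (ℕ.≤-trans (proj₁ (Equivalence.to (h x) x∈)) x≤y ,
                                  ℕ.≤-trans y≤z (proj₂ (Equivalence.to (h z) z∈))) }

    treeFor : TreeFor (_∈ ℬ) (λ J → weightFrom (J ∈ℬ?))
    treeFor = laminar⇒tree (ℕ.s≤s ℕ.z≤n) ℬ-laminar λ {J} → weightFrom-suc (J ∈ℬ?)

  treeOf : Tree (suc k)
  treeOf = proj₁ treeFor

  treeOf-represents : Represents P treeOf
  treeOf-represents = proj₁ (proj₂ treeFor) , λ {J} J∈ →
    R.trans (weightFrom-≃ (J ∈ℬ?) J∈) (R.trans
      (R.reflexive (≡.cong fromℕ (proj₂ (proj₂ treeFor) J∈)))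
      (R.sym (D-fromℤ (+ weightOf treeOf J))))

-- The word built from a tree has no deficit, so the fibre over that very permutation realises the
-- sum of the tree.
fibres⇒tree : FibresRealRooted → ∀ {n} (T : Tree n) → OnlyRealRoots (treeₛ T 0)
fibres⇒tree A T = OnlyRealRoots-resp-≋ (fertₛ≋ 0) (OnlyRealRoots-resp-≋ (∑-fibre w perm enum)
  (A (reverse w) (isPermutation-↭ (↭.↭-sym (↭.↭-reverse w)) perm) (preimages (length w) w) enum))
  where
  open TreeWord (wordOfTree T 0)
  w = max ∷ rest
  perm : IsPermutation w
  -- Building the word above the offset 0 makes its letters positive.
  perm = above , unique
  enum = preimages-enumerates w perm

fibres⇒nestohedra : FibresRealRooted → NestohedraRealRooted
fibres⇒nestohedra A k P integral-P qs qs-enum = OnlyRealRoots-resp-≋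
  (≋-sym (≋-trans (∑-enumerations narayanaᵛ qs-enum
      (lattice-points P T (treeOf-represents P integral-P)))
                  (∑-points T 0)))
  (fibres⇒tree A T)
  where T = treeOf P integral-P

corollary3p3 : (∀ π → IsPermutation π →
    ∀ σs → σs Enumerates (λ σ → IsPermutation σ × stackSort σ ≡ π) →
    OnlyRealRoots (∑ σs (λ σ → monomial 1ℚ (suc (des σ)))))
    ⇔
    (∀ k (P : BinaryNestohedron (suc k)) → IsIntegral ⟦ P ⟧ →
    ∀ qs → qs Enumerates LatticePoint ⟦ P ⟧ →
    OnlyRealRoots (∑ qs narayanaᵛ))
corollary3p3 = mk⇔ fibres⇒nestohedra nestohedra⇒fibres
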